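{- Let $\epsilon>0$, let $s$ be a positive integer, and let $g:\mathbb{N}\to(0,1)$ be a decreasing function. Let $\delta(t)=\min\big(\frac{g(t)^3}{32t^2},\epsilon/2\big)$. Let $t_1=s$ and for $i\ge1$ let $t_{i+1}=t_i\,k(\delta(t_i))$. Let $T_0=t_j$ with $j=4\epsilon^{ -2}$ and $T=16T_0/\delta(T_0)^2$. Then for every graph $G$ on $n$ vertices one can add to or remove from $G$ at most $\epsilon n^2$ edges and thus obtain a graph $G'$ that has a $g$-regular equitable vertex partition into $k$ parts for some $s\le k\le T$.
   Context: For vertex subsets $X,Y$, $e(X,Y)$ is the number of pairs in $X\times Y$ that are edges and $d(X,Y)=e(X,Y)/(|X||Y|)$. A partition $V=V_1\cup\dots\cup V_k$ is weak $\alpha$-regular if for all $A,B\subset V$, $|e(A,B)-\sum_{i,j}d(V_i,V_j)|A\cap V_i||B\cap V_j||\le\alpha|V|^2$. Here $k(\alpha)$ denotes the bound in the Frieze–Kannan weak regularity lemma: every graph has an equitable weak $\alpha$-regular vertex partition into at most $k(\alpha)$ parts (one may take $k(\alpha)=2^{O(\alpha^{ -2})}$). A pair $(A,B)$ is $\gamma$-regular if for all $A'\subset A$, $B'\subset B$ with $|A'|\ge\gamma|A|$, $|B'|\ge\gamma|B|$, $|d(A',B')-d(A,B)|\le\gamma$. An equitable partition (part sizes differ by at most 1) into $k$ parts is $g$-regular if all pairs of distinct parts are $g(k)$-regular.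
   Formalization: The number ε, the values of the function g, and the parameter α of the weak regularity bound k(α) are taken to be rational instead of real. -}

module Defs where

open import Data.Nat as ℕ using (ℕ; zero; suc; _∸_; _<ᵇ_)
open import Data.Integer as ℤ using (ℤ; +_; -[1+_])
open import Data.Rational as ℚ using (ℚ; mkℚ; 0ℚ; 1/_; _/_; ½; ceiling; ∣_∣; _⊓_)
open import Data.Fin using (Fin; zero; suc; toℕ; _≟_)
open import Data.Bool using (Bool; true; false; _∧_; _xor_; if_then_else_)
open import Data.Product using (Σ; ∃; _×_; _,_)
open import Relation.Binary.PropositionalEquality using (_≡_; _≢_)
open import Relation.Nullary.Decidable using (⌊_⌋)

toℚ : ℕ → ℚ
toℚ n = + n / 1

inv : ℚ → ℚ
inv p@(mkℚ (+ zero) _ _) = 0ℚ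
inv p@(mkℚ (+ suc _) _ _) = 1/ p
inv p@(mkℚ -[1+ _ ] _ _) = 1/ p

Σℕ : (n : ℕ) → (Fin n → ℕ) → ℕ
Σℕ zero f = 0
Σℕ (suc n) f = f zero ℕ.+ Σℕ n (λ i → f (suc i))

Σℚ : (n : ℕ) → (Fin n → ℚ) → ℚ
Σℚ zero f = 0ℚ
Σℚ (suc n) f = f zero ℚ.+ Σℚ n (λ i → f (suc i))

record Graph (n : ℕ) : Set where
  field
    adj    : Fin n → Fin n → Bool
    sym    : ∀ u v → adj u v ≡ adj v u
    irrefl : ∀ u → adj u u ≡ false
open Graph public

VSet : ℕ → Set
VSet n = Fin n → Bool

_⊆_ : ∀ {n} → VSet n → VSet n → Set
X ⊆ Y = ∀ v → X v ≡ true → Y v ≡ true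

_∩_ : ∀ {n} → VSet n → VSet n → VSet n
(X ∩ Y) v = X v ∧ Y v

size : ∀ {n} → VSet n → ℕ
size {n} X = Σℕ n (λ v → if X v then 1 else 0)

e : ∀ {n} → Graph n → VSet n → VSet n → ℕ
e {n} G X Y = Σℕ n (λ u → Σℕ n (λ v → if X u ∧ Y v ∧ adj G u v then 1 else 0))

-- d(X,Y) = e(X,Y)/(|X||Y|)  (convention: 0 if X or Y is empty)
d : ∀ {n} → Graph n → VSet n → VSet n → ℚ
d G X Y = toℚ (e G X Y) ℚ.* inv (toℚ (size X ℕ.* size Y))

-- a vertex partition into k (labelled) parts is a map Fin n → Fin k
part : ∀ {n k} → (Fin n → Fin k) → Fin k → VSet n
part P i v = ⌊ P v ≟ i ⌋

Equitable : ∀ {n k} → (Fin n → Fin k) → Set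
Equitable {k = k} P = ∀ (i j : Fin k) → size (part P i) ℕ.≤ size (part P j) ℕ.+ 1

WeakRegular : ∀ {n k} → Graph n → (Fin n → Fin k) → ℚ → Set
WeakRegular {n} {k} G P α = ∀ (A B : VSet n) →
  ∣ toℚ (e G A B) ℚ.- Σℚ k (λ i → Σℚ k (λ j →
        d G (part P i) (part P j) ℚ.* toℚ (size (A ∩ part P i)) ℚ.* toℚ (size (B ∩ part P j)))) ∣
    ℚ.≤ α ℚ.* toℚ (n ℕ.* n)

RegularPair : ∀ {n} → Graph n → ℚ → VSet n → VSet n → Set
RegularPair {n} G γ A B = ∀ (A′ B′ : VSet n) → A′ ⊆ A → B′ ⊆ B →
  γ ℚ.* toℚ (size A) ℚ.≤ toℚ (size A′) → γ ℚ.* toℚ (size B) ℚ.≤ toℚ (size B′) →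
  ∣ d G A′ B′ ℚ.- d G A B ∣ ℚ.≤ γ

GRegularPartition : ∀ {n k} → Graph n → (ℕ → ℚ) → (Fin n → Fin k) → Set
GRegularPartition {k = k} G g P =
  Equitable P × (∀ (i j : Fin k) → i ≢ j → RegularPair G (g k) (part P i) (part P j))

-- k is a valid Frieze–Kannan bound: for every α > 0 every graph has an
-- equitable weak α-regular partition into at most k(α) parts
FKBound : (ℚ → ℕ) → Set
FKBound k = ∀ (α : ℚ) → 0ℚ ℚ.< α → ∀ (n : ℕ) (G : Graph n) →
  ∃ λ m → m ℕ.≤ k α × ∃ λ (P : Fin n → Fin m) → Equitable P × WeakRegular G P α

editDist : ∀ {n} → Graph n → Graph n → ℕ
editDist {n} G G′ = Σℕ n (λ u → Σℕ n (λ v →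
  if (toℕ u <ᵇ toℕ v) ∧ (adj G u v xor adj G′ u v) then 1 else 0))

δ : (ℕ → ℚ) → ℚ → ℕ → ℚ
δ g ε t = (g t ℚ.* g t ℚ.* g t ℚ.* inv (toℚ (32 ℕ.* t ℕ.* t))) ⊓ (ε ℚ.* ½)

-- tSeq i = t_{i+1}:  t_1 = s,  t_{i+1} = t_i · k(δ(t_i))
tSeq : (ℚ → ℕ) → (ℕ → ℚ) → ℚ → ℕ → ℕ → ℕ
tSeq k g ε s zero = s
tSeq k g ε s (suc i) = tSeq k g ε s i ℕ.* k (δ g ε (tSeq k g ε s i))

jIdx : ℚ → ℕ
jIdx ε = ℤ.∣ ceiling (toℚ 4 ℚ.* inv (ε ℚ.* ε)) ∣

T₀ : (ℚ → ℕ) → (ℕ → ℚ) → ℚ → ℕ → ℕ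
T₀ k g ε s = tSeq k g ε s (jIdx ε ∸ 1)

Tbound : (ℚ → ℕ) → (ℕ → ℚ) → ℚ → ℕ → ℚ
Tbound k g ε s = toℚ 16 ℚ.* toℚ (T₀ k g ε s) ℚ.*
  inv (δ g ε (T₀ k g ε s) ℚ.* δ g ε (T₀ k g ε s))

{-# OPTIONS --safe #-}
-- The hypothesis on k enters only through lower bounds. Complete graphs give k(δ(t)) ≥ 4t and
-- 1/δ(t) ≤ 2(k(δ(t)) + 1)², and a bipartite cube graph shows that k(α) is at least exponential in
-- α^(-1/3); hence t_{i+3} exceeds 2^(poly(1/δ(t_i))), which pays for the following argument.
--
-- Start from an equitable partition P with t_i parts and a symmetric step function F on it, and keep
-- refining to step functions W closer to the adjacency function χ, as long as χ − W correlates with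
-- φ(W,F)·1_{A×B} for some A, B and one of four fixed functions φ. Each refinement lowers the energy
-- Σ(χ − W)² by a fixed amount, so there are at most t_i·4^(poly(1/δ)) parts at the end. If W is close
-- to F in L², the entries of χ are moved by the affine map taking the value of W to that of F. Because
-- the slope of this map is one of the functions φ, the result is within δ of F in cut norm, and a
-- deterministic rounding turns it back into a graph. Otherwise the energy has dropped by more than
-- ε²n², and the argument is repeated with an equitable partition into t_{i+3} parts whose parts
-- mostly lie inside the classes of W. This happens at most about 1/(4ε²) times. Weak regularity of
-- the partitions provided by k would not suffice: the slopes vary from cell to cell, and multiplying
-- χ − W by them may increase its cut norm.
--
-- If n ≤ T₀ the partition into singletons works, and if ε ≥ 1/2 all edges may be deleted.
module Submission where

open import Defs
open import Data.Nat as ℕ using (ℕ; zero; suc)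
open import Data.Nat.Properties as ℕₚ using ()
open import Data.Nat.Coprimality as Coprimality using ()
open import Data.Nat.DivMod as ℕDM using ()
open import Data.Nat.Tactic.RingSolver as ℕSolver using ()
open import Data.Integer as ℤ using (ℤ; +_; -[1+_])
open import Data.Integer.Properties as ℤₚ using ()
open import Data.Integer.DivMod as ℤDM using ()
open import Data.Rational as ℚ using (ℚ; mkℚ; 0ℚ; 1ℚ; ½; _+_; _*_; _-_; -_; _≤_; _<_; _⊓_; _⊔_; ∣_∣; ceiling)
open import Data.Rational.Properties as ℚₚ using (≤-refl; ≤-trans; ≤-reflexive; <⇒≤)
open import Data.Rational.Unnormalised as ℚᵘ using (mkℚᵘ)
open import Data.Rational.Unnormalised.Properties as ℚᵘₚ using ()
open import Data.Fin as Fin using (Fin; zero; suc; toℕ; _≟_)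
open import Data.Fin.Properties as Finₚ using ()
open import Data.Fin.Subset.Properties using (anySubset?)
open import Data.Vec using (lookup; tabulate)
open import Data.Vec.Properties using (lookup∘tabulate)
open import Data.Bool using (Bool; true; false; _∧_; _∨_; not; _xor_; if_then_else_)
open import Data.Bool.Properties as Boolₚ using ()
open import Data.Product using (∃; _×_; _,_; proj₁; proj₂)
open import Data.Sum using (_⊎_; inj₁; inj₂)
open import Data.Empty using (⊥; ⊥-elim)
open import Data.Maybe using (Maybe; just; nothing)
open import Function using (_∘_; case_of_)
open import Level using (0ℓ)
open import Relation.Nullary using (¬_; Dec; yes; no)
open import Relation.Nullary.Decidable using (⌊_⌋)
open import Relation.Binary.PropositionalEquality using (_≡_; _≢_; refl; trans; cong; cong₂; subst) renaming (sym to ≡-sym)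
open import Tactic.RingSolver using (solve-∀)
open import Tactic.RingSolver.Core.AlmostCommutativeRing using (AlmostCommutativeRing; fromCommutativeRing)
open import Relation.Binary.Definitions using (tri<; tri≈; tri>)

-- The function `g` may decrease arbitrarily fast, so nothing can be estimated in terms of t_i
-- alone. With T = t_{i+1}, however, 1/δ(t_i) is at most 8T² whatever `g` is, so the costs of a
-- round at t_i are measured by a number K polynomial in T. Since k(δ(t)) is at least exponential in
-- t^(2/3), t_{i+2} exceeds the power of K that occurs, and t_{i+3} exceeds 2K·t_i·4^(K²), the
-- number of parts that a round may call for: hence three indices per round.
--
-- The threshold 2ε²n² for the squared distance of W and F serves both alternatives. Below it, AM-GM
-- bounds the total movement by about (3/2)εn² over ordered pairs, which is (3/4)εn² edges. Above
-- it, the energy still falls by ε²n² after all error terms.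
--
-- The rounding has to control all pairs of vertex sets. Instead of treating them one by one it
-- keeps the error rows nearly orthogonal, a condition on pairs of rows that conditional
-- expectations can maintain; this bounds the norm of every sum of rows at once.

ring : AlmostCommutativeRing 0ℓ 0ℓ
ring = fromCommutativeRing ℚₚ.+-*-commutativeRing is0
  where
  is0 : ∀ x → Maybe (0ℚ ≡ x)
  is0 x with 0ℚ ℚₚ.≟ x
  ... | yes p = just p
  ... | no _ = nothing

-- Rational arithmetic

2ℚ : ℚ
2ℚ = 1ℚ + 1ℚ

0≤+ : ∀ {x y} → 0ℚ ≤ x → 0ℚ ≤ y → 0ℚ ≤ x + y
0≤+ p q = ℚₚ.+-mono-≤ p q

0≤* : ∀ {x y} → 0ℚ ≤ x → 0ℚ ≤ y → 0ℚ ≤ x * y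
0≤* {x} {y} p q = ≤-trans (≤-reflexive (≡-sym (ℚₚ.*-zeroʳ x)))
  (ℚₚ.*-monoˡ-≤-nonNeg x {{ℚ.nonNegative p}} q)

0<* : ∀ {x y} → 0ℚ < x → 0ℚ < y → 0ℚ < x * y
0<* {x} {y} p q = ℚₚ.positive⁻¹ (x * y) {{ℚₚ.pos*pos⇒pos x {{ℚ.positive p}} y {{ℚ.positive q}}}}

≤⇒0≤ : ∀ {x y} → x ≤ y → 0ℚ ≤ y - x
≤⇒0≤ {x} {y} p = ≤-trans (≤-reflexive (≡-sym (ℚₚ.+-inverseʳ x))) (ℚₚ.+-monoˡ-≤ (- x) p)

-- Certificates: the difference of the two sides is written as a visibly nonnegative expression, and
-- the identity is left to the ring solver. Most estimates below take this form.
by : ∀ {x y z} → 0ℚ ≤ z → z ≡ y - x → x ≤ y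
by {x} {y} {z} p eq = ≤-trans (≤-reflexive (≡-sym (ℚₚ.+-identityʳ x)))
  (≤-trans (ℚₚ.+-monoʳ-≤ x (≤-trans p (≤-reflexive eq))) (≤-reflexive (lem x y)))
  where
  lem : ∀ x y → x + (y - x) ≡ y
  lem = solve-∀ ring

byPos : ∀ {z w} → 0ℚ ≤ z → z ≡ w → 0ℚ ≤ w
byPos p eq = ≤-trans p (≤-reflexive eq)

0≤1 : 0ℚ ≤ 1ℚ
0≤1 = ℚₚ.nonNegative⁻¹ 1ℚ

0≤½ : 0ℚ ≤ ½
0≤½ = ℚₚ.nonNegative⁻¹ ½

0≤2 : 0ℚ ≤ 2ℚ
0≤2 = ℚₚ.nonNegative⁻¹ 2ℚ

≤-mulˡ : ∀ {x y} z → 0ℚ ≤ z → x ≤ y → z * x ≤ z * y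
≤-mulˡ z p q = ℚₚ.*-monoˡ-≤-nonNeg z {{ℚ.nonNegative p}} q

≤-cancelˡ : ∀ {x y} z → 0ℚ < z → z * x ≤ z * y → x ≤ y
≤-cancelˡ z p q = ℚₚ.*-cancelˡ-≤-pos z {{ℚ.positive p}} q

≤-mul : ∀ {a b x y} → 0ℚ ≤ a → a ≤ b → 0ℚ ≤ x → x ≤ y → a * x ≤ b * y
≤-mul {a} {b} {x} {y} p q r s = by
  (0≤+ (0≤* (≤⇒0≤ q) (≤-trans r s)) (0≤* p (≤⇒0≤ s))) (lem a b x y)
  where
  lem : ∀ a b x y → (b - a) * y + a * (y - x) ≡ b * y - a * x
  lem = solve-∀ ring

0≤-neg : ∀ {x} → x ≤ 0ℚ → 0ℚ ≤ - x
0≤-neg p = ℚₚ.neg-antimono-≤ p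

neg-² : ∀ x → - x * - x ≡ x * x
neg-² = solve-∀ ring

0≤² : ∀ x → 0ℚ ≤ x * x
0≤² x with ℚₚ.≤-total 0ℚ x
... | inj₁ p = 0≤* p p
... | inj₂ p = byPos (0≤* (0≤-neg p) (0≤-neg p)) (neg-² x)

≤⇒≯ : ∀ {x y} → x ≤ y → ¬ (y < x)
≤⇒≯ p q = ℚₚ.<-irrefl refl (ℚₚ.<-≤-trans q p)

≤-sqrt : ∀ {x y} → 0ℚ ≤ y → x * x ≤ y * y → x ≤ y
≤-sqrt {x} {y} p q with x ℚₚ.≤? y
... | yes r = r
... | no r = ⊥-elim (≤⇒≯ q (ℚₚ.≤-<-trans
      (≤-mulˡ y p (<⇒≤ y<x))
      (ℚₚ.*-monoˡ-<-pos x {{ℚ.positive (ℚₚ.≤-<-trans p y<x)}} y<x)))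
  where y<x = ℚₚ.≰⇒> r

∣∣-≤ : ∀ {x y} → x ≤ y → - x ≤ y → ∣ x ∣ ≤ y
∣∣-≤ {x} p q with ℚₚ.∣p∣≡p∨∣p∣≡-p x
... | inj₁ eq = ≤-trans (≤-reflexive eq) p
... | inj₂ eq = ≤-trans (≤-reflexive eq) q

x≤∣x∣ : ∀ x → x ≤ ∣ x ∣
x≤∣x∣ x with ℚₚ.≤-total 0ℚ x
... | inj₁ p = ≤-reflexive (≡-sym (ℚₚ.0≤p⇒∣p∣≡p p))
... | inj₂ p = ≤-trans p (ℚₚ.0≤∣p∣ x)

-x≤∣x∣ : ∀ x → - x ≤ ∣ x ∣
-x≤∣x∣ x = ≤-trans (x≤∣x∣ (- x)) (≤-reflexive (ℚₚ.∣-p∣≡∣p∣ x))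

inv-pos : ∀ {x} → 0ℚ < x → x * inv x ≡ 1ℚ
inv-pos {mkℚ (+ zero) zero _} (ℚ.*<* (ℤ.+<+ ()))
inv-pos {mkℚ (+ zero) (suc _) _} (ℚ.*<* (ℤ.+<+ ()))
inv-pos {p@(mkℚ (+ suc _) _ _)} _ = ℚₚ.*-inverseʳ p
inv-pos {mkℚ -[1+ _ ] zero _} (ℚ.*<* ())
inv-pos {mkℚ -[1+ _ ] (suc _) _} (ℚ.*<* ())

0≤inv : ∀ {x} → 0ℚ ≤ x → 0ℚ ≤ inv x
0≤inv {mkℚ (+ zero) _ _} _ = ≤-refl
0≤inv {p@(mkℚ (+ suc _) _ _)} _ = <⇒≤ (ℚₚ.positive⁻¹ _ {{ℚₚ.1/pos⇒pos p}})
0≤inv {mkℚ -[1+ _ ] zero _} (ℚ.*≤* ())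
0≤inv {mkℚ -[1+ _ ] (suc _) _} (ℚ.*≤* ())

0<inv : ∀ {x} → 0ℚ < x → 0ℚ < inv x
0<inv {x} p with ℚₚ.<-cmp 0ℚ (inv x)
... | tri< r _ _ = r
... | tri≈ _ r _ = ⊥-elim (ℚₚ.1≢0 (trans (≡-sym (inv-pos p)) (trans (cong (x *_) (≡-sym r)) (ℚₚ.*-zeroʳ x))))
... | tri> _ _ r = ⊥-elim (≤⇒≯ (0≤inv (<⇒≤ p)) r)

-- The embedding of the naturals into the rationals

toℚ-mk : ∀ n → toℚ n ≡ mkℚ (+ n) 0 (Coprimality.sym (Coprimality.1-coprimeTo n))
toℚ-mk n = ℚₚ.↥p/↧p≡p (mkℚ (+ n) 0 (Coprimality.sym (Coprimality.1-coprimeTo n)))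

toℚᵘ-toℚ : ∀ n → ℚ.toℚᵘ (toℚ n) ≡ mkℚᵘ (+ n) 0
toℚᵘ-toℚ n = cong ℚ.toℚᵘ (toℚ-mk n)

toℚ-+ : ∀ m n → toℚ (m ℕ.+ n) ≡ toℚ m + toℚ n
toℚ-+ m n = ℚₚ.toℚᵘ-injective (ℚᵘₚ.≃-trans (ℚᵘₚ.≃-reflexive (toℚᵘ-toℚ (m ℕ.+ n)))
  (ℚᵘₚ.≃-sym (ℚᵘₚ.≃-trans (ℚₚ.toℚᵘ-homo-+ (toℚ m) (toℚ n))
  (ℚᵘₚ.≃-trans (ℚᵘₚ.≃-reflexive (cong₂ ℚᵘ._+_ (toℚᵘ-toℚ m) (toℚᵘ-toℚ n)))
  (ℚᵘ.*≡* (cong (ℤ._* + 1) (cong₂ ℤ._+_ (ℤₚ.*-identityʳ (+ m)) (ℤₚ.*-identityʳ (+ n)))))))))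

toℚ-* : ∀ m n → toℚ (m ℕ.* n) ≡ toℚ m * toℚ n
toℚ-* m n = ℚₚ.toℚᵘ-injective (ℚᵘₚ.≃-trans (ℚᵘₚ.≃-reflexive (toℚᵘ-toℚ (m ℕ.* n)))
  (ℚᵘₚ.≃-sym (ℚᵘₚ.≃-trans (ℚₚ.toℚᵘ-homo-* (toℚ m) (toℚ n))
  (ℚᵘₚ.≃-trans (ℚᵘₚ.≃-reflexive (cong₂ ℚᵘ._*_ (toℚᵘ-toℚ m) (toℚᵘ-toℚ n)))
  (ℚᵘ.*≡* (cong (ℤ._* + 1) (≡-sym (ℤₚ.pos-* m n))))))))

toℚ-mono : ∀ {m n} → m ℕ.≤ n → toℚ m ≤ toℚ n
toℚ-mono {m} {n} p = ≤-trans (≤-reflexive (toℚ-mk m)) (≤-trans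
  (ℚ.*≤* (ℤₚ.*-monoʳ-≤-nonNeg (+ 1) (ℤ.+≤+ p))) (≤-reflexive (≡-sym (toℚ-mk n))))

-- An opaque copy of toℚ: the latter unfolds to a gcd computation during unification.
abstract
  ι : ℕ → ℚ
  ι = toℚ

  ι-def : ∀ n → ι n ≡ toℚ n
  ι-def n = refl

  ι-0 : ι 0 ≡ 0ℚ
  ι-0 = refl

  ι-1 : ι 1 ≡ 1ℚ
  ι-1 = refl

  ι-+ : ∀ m n → ι (m ℕ.+ n) ≡ ι m + ι n
  ι-+ = toℚ-+

  ι-* : ∀ m n → ι (m ℕ.* n) ≡ ι m * ι n
  ι-* = toℚ-*

  ι-mono : ∀ {m n} → m ℕ.≤ n → ι m ≤ ι n
  ι-mono {m} {n} p = toℚ-mono {m} {n} p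

ι-suc : ∀ n → ι (suc n) ≡ 1ℚ + ι n
ι-suc n = trans (ι-+ 1 n) (cong (_+ ι n) ι-1)

ι-2 : ι 2 ≡ 2ℚ
ι-2 = trans (ι-+ 1 1) (cong₂ _+_ ι-1 ι-1)

ι-4 : ι 4 ≡ 2ℚ * 2ℚ
ι-4 = trans (ι-* 2 2) (cong₂ _*_ ι-2 ι-2)

ι-8 : ι 8 ≡ 2ℚ * 2ℚ * 2ℚ
ι-8 = trans (ι-* 4 2) (cong₂ _*_ ι-4 ι-2)

0≤ι : ∀ n → 0ℚ ≤ ι n
0≤ι n = ≤-trans (≤-reflexive (≡-sym ι-0)) (ι-mono ℕ.z≤n)

1≤ι : ∀ {n} → 1 ℕ.≤ n → 1ℚ ≤ ι n
1≤ι p = ≤-trans (≤-reflexive (≡-sym ι-1)) (ι-mono p)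

0<1 : 0ℚ < 1ℚ
0<1 = ℚₚ.positive⁻¹ 1ℚ

0<ι : ∀ {n} → 1 ℕ.≤ n → 0ℚ < ι n
0<ι p = ℚₚ.<-≤-trans 0<1 (1≤ι p)

ι-cancel : ∀ {m n} → ι m ≤ ι n → m ℕ.≤ n
ι-cancel {m} {n} p with m ℕ.≤? n
... | yes q = q
... | no q = ⊥-elim (≤⇒≯ p (subst (_< ι m) (ℚₚ.+-identityˡ (ι n)) (ℚₚ.<-≤-trans
      (ℚₚ.+-monoˡ-< (ι n) 0<1)
      (≤-trans (≤-reflexive (≡-sym (ι-suc n))) (ι-mono (ℕₚ.≰⇒> q))))))

-- Finite sums

Σ-cong : ∀ n {f g : Fin n → ℚ} → (∀ i → f i ≡ g i) → Σℚ n f ≡ Σℚ n g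
Σ-cong zero h = refl
Σ-cong (suc n) h = cong₂ _+_ (h zero) (Σ-cong n (h ∘ suc))

Σ-mono : ∀ n {f g : Fin n → ℚ} → (∀ i → f i ≤ g i) → Σℚ n f ≤ Σℚ n g
Σ-mono zero h = ≤-refl
Σ-mono (suc n) h = ℚₚ.+-mono-≤ (h zero) (Σ-mono n (h ∘ suc))

Σ-nonneg : ∀ n {f : Fin n → ℚ} → (∀ i → 0ℚ ≤ f i) → 0ℚ ≤ Σℚ n f
Σ-nonneg zero h = ≤-refl
Σ-nonneg (suc n) h = 0≤+ (h zero) (Σ-nonneg n (h ∘ suc))

Σ-+ : ∀ n (f g : Fin n → ℚ) → Σℚ n (λ i → f i + g i) ≡ Σℚ n f + Σℚ n g
Σ-+ zero f g = refl
Σ-+ (suc n) f g = trans (cong (λ z → f zero + g zero + z) (Σ-+ n (f ∘ suc) (g ∘ suc)))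
  (lem (f zero) (g zero) (Σℚ n (f ∘ suc)) (Σℚ n (g ∘ suc)))
  where
  lem : ∀ a b c d → a + b + (c + d) ≡ (a + c) + (b + d)
  lem = solve-∀ ring

Σ-*ˡ : ∀ n c (f : Fin n → ℚ) → Σℚ n (λ i → c * f i) ≡ c * Σℚ n f
Σ-*ˡ zero c f = ≡-sym (ℚₚ.*-zeroʳ c)
Σ-*ˡ (suc n) c f = trans (cong (λ z → c * f zero + z) (Σ-*ˡ n c (f ∘ suc)))
  (≡-sym (ℚₚ.*-distribˡ-+ c (f zero) (Σℚ n (f ∘ suc))))

Σ-const : ∀ n c → Σℚ n (λ _ → c) ≡ ι n * c
Σ-const zero c = ≡-sym (trans (cong (_* c) ι-0) (ℚₚ.*-zeroˡ c))
Σ-const (suc n) c = trans (cong (λ z → c + z) (Σ-const n c)) (trans (lem c (ι n))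
  (cong (_* c) (≡-sym (ι-suc n))))
  where
  lem : ∀ c m → c + m * c ≡ (1ℚ + m) * c
  lem = solve-∀ ring

Σ-zero : ∀ n {f : Fin n → ℚ} → (∀ i → f i ≡ 0ℚ) → Σℚ n f ≡ 0ℚ
Σ-zero n h = trans (Σ-cong n h) (trans (Σ-const n 0ℚ) (ℚₚ.*-zeroʳ (ι n)))

Σ-swap : ∀ m n (f : Fin m → Fin n → ℚ) →
  Σℚ m (λ i → Σℚ n (f i)) ≡ Σℚ n (λ j → Σℚ m (λ i → f i j))
Σ-swap zero n f = ≡-sym (Σ-zero n (λ _ → refl))
Σ-swap (suc m) n f = trans (cong (λ z → Σℚ n (f zero) + z) (Σ-swap m n (f ∘ suc)))
  (≡-sym (Σ-+ n (f zero) _))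

ι-Σ : ∀ n (f : Fin n → ℕ) → ι (Σℕ n f) ≡ Σℚ n (ι ∘ f)
ι-Σ zero f = ι-0
ι-Σ (suc n) f = trans (ι-+ (f zero) _) (cong (λ z → ι (f zero) + z) (ι-Σ n (f ∘ suc)))

𝟙 : Bool → ℚ
𝟙 b = if b then 1ℚ else 0ℚ

0≤𝟙 : ∀ b → 0ℚ ≤ 𝟙 b
0≤𝟙 true = 0≤1
0≤𝟙 false = ≤-refl

𝟙≤1 : ∀ b → 𝟙 b ≤ 1ℚ
𝟙≤1 true = ≤-refl
𝟙≤1 false = 0≤1

ι-if : ∀ b → ι (if b then 1 else 0) ≡ 𝟙 b
ι-if true = ι-1
ι-if false = ι-0

𝟙-∧ : ∀ a b → 𝟙 (a ∧ b) ≡ 𝟙 a * 𝟙 b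
𝟙-∧ true b = ≡-sym (ℚₚ.*-identityˡ (𝟙 b))
𝟙-∧ false b = ≡-sym (ℚₚ.*-zeroˡ (𝟙 b))

size-ι : ∀ {n} (X : VSet n) → ι (size X) ≡ Σℚ n (λ v → 𝟙 (X v))
size-ι {n} X = trans (ι-Σ n _) (Σ-cong n (λ v → ι-if (X v)))

suc-≟ : ∀ {n} (x i : Fin n) → ⌊ suc x ≟ suc i ⌋ ≡ ⌊ x ≟ i ⌋
suc-≟ x i with x ≟ i
... | yes _ = refl
... | no _ = refl

Σ-pick : ∀ n (x : Fin n) (f : Fin n → ℚ) → Σℚ n (λ a → 𝟙 ⌊ x ≟ a ⌋ * f a) ≡ f x
Σ-pick (suc n) zero f = trans (cong₂ _+_ (ℚₚ.*-identityˡ (f zero))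
  (Σ-zero n (λ i → ℚₚ.*-zeroˡ (f (suc i))))) (ℚₚ.+-identityʳ (f zero))
Σ-pick (suc n) (suc x) f = trans (cong₂ _+_ (ℚₚ.*-zeroˡ (f zero))
  (trans (Σ-cong n (λ i → cong (λ b → 𝟙 b * f (suc i)) (suc-≟ x i))) (Σ-pick n x (f ∘ suc)))) (ℚₚ.+-identityˡ (f (suc x)))

⌊≟⌋-true : ∀ {n} {x y : Fin n} → ⌊ x ≟ y ⌋ ≡ true → x ≡ y
⌊≟⌋-true {x = x} {y} p with x ≟ y
... | yes q = q
⌊≟⌋-true () | no _

⌊≟⌋-refl : ∀ {n} (x : Fin n) → ⌊ x ≟ x ⌋ ≡ true
⌊≟⌋-refl x with x ≟ x
... | yes _ = refl
... | no q = ⊥-elim (q refl)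

ΣΣ : ∀ n → (Fin n → Fin n → ℚ) → ℚ
ΣΣ n f = Σℚ n (λ u → Σℚ n (λ v → f u v))

ΣΣ-cong : ∀ n {f g : Fin n → Fin n → ℚ} → (∀ u v → f u v ≡ g u v) → ΣΣ n f ≡ ΣΣ n g
ΣΣ-cong n h = Σ-cong n (λ u → Σ-cong n (h u))

ΣΣ-mono : ∀ n {f g : Fin n → Fin n → ℚ} → (∀ u v → f u v ≤ g u v) → ΣΣ n f ≤ ΣΣ n g
ΣΣ-mono n h = Σ-mono n (λ u → Σ-mono n (h u))

ΣΣ-nonneg : ∀ n {f : Fin n → Fin n → ℚ} → (∀ u v → 0ℚ ≤ f u v) → 0ℚ ≤ ΣΣ n f
ΣΣ-nonneg n h = Σ-nonneg n (λ u → Σ-nonneg n (h u))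

ΣΣ-+ : ∀ n (f g : Fin n → Fin n → ℚ) → ΣΣ n (λ u v → f u v + g u v) ≡ ΣΣ n f + ΣΣ n g
ΣΣ-+ n f g = trans (Σ-cong n (λ u → Σ-+ n (f u) (g u))) (Σ-+ n _ _)

ΣΣ-*ˡ : ∀ n c (f : Fin n → Fin n → ℚ) → ΣΣ n (λ u v → c * f u v) ≡ c * ΣΣ n f
ΣΣ-*ˡ n c f = trans (Σ-cong n (λ u → Σ-*ˡ n c (f u))) (Σ-*ˡ n c _)

ΣΣ-const : ∀ n c → ΣΣ n (λ _ _ → c) ≡ c * (ι n * ι n)
ΣΣ-const n c = trans (Σ-cong n (λ _ → Σ-const n c)) (trans (Σ-const n _) (lem c (ι n)))
  where
  lem : ∀ c m → m * (m * c) ≡ c * (m * m)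
  lem = solve-∀ ring

ΣΣ-swap : ∀ n (f : Fin n → Fin n → ℚ) → ΣΣ n f ≡ ΣΣ n (λ u v → f v u)
ΣΣ-swap n f = Σ-swap n n f

ΣΣ-prod : ∀ n (f g : Fin n → ℚ) → ΣΣ n (λ u v → f u * g v) ≡ Σℚ n f * Σℚ n g
ΣΣ-prod n f g = trans (Σ-cong n (λ u → trans (Σ-*ˡ n (f u) g) (ℚₚ.*-comm (f u) _)))
  (trans (Σ-*ˡ n (Σℚ n g) f) (ℚₚ.*-comm (Σℚ n g) (Σℚ n f)))

χ : ∀ {n} → Graph n → Fin n → Fin n → ℚ
χ G u v = 𝟙 (adj G u v)

e-Σ : ∀ {n} (G : Graph n) (X Y : VSet n) →
  ι (e G X Y) ≡ ΣΣ n (λ u v → 𝟙 (X u) * 𝟙 (Y v) * χ G u v)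
e-Σ {n} G X Y = trans (ι-Σ n _) (Σ-cong n (λ u → trans (ι-Σ n _) (Σ-cong n (λ v →
  trans (ι-if _) (trans (𝟙-∧ (X u) _) (trans (cong (𝟙 (X u) *_) (𝟙-∧ (Y v) _))
  (≡-sym (ℚₚ.*-assoc (𝟙 (X u)) (𝟙 (Y v)) (χ G u v)))))))))

-- Deterministic rounding

-- x and y are the two values of a random variable of mean zero and absolute value at most 1.
record Balanced (x y : ℚ) : Set where
  field
    wx wy : ℚ
    0≤wx  : 0ℚ ≤ wx
    0≤wy  : 0ℚ ≤ wy
    total : wx + wy ≡ 1ℚ
    mean  : wx * x + wy * y ≡ 0ℚ
    x²≤1  : x * x ≤ 1ℚ
    y²≤1  : y * y ≤ 1ℚ

Σ-square-shift : ∀ m (s D : Fin m → ℚ) z →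
  Σℚ m (λ u → (s u + D u * z) * (s u + D u * z)) ≡
  Σℚ m (λ u → s u * s u) + 2ℚ * z * Σℚ m (λ u → s u * D u) + z * z * Σℚ m (λ u → D u * D u)
Σ-square-shift m s D z = trans (Σ-cong m (λ u → lem (s u) (D u) z))
  (trans (Σ-+ m _ _) (cong₂ _+_ (trans (Σ-+ m _ _) (cong (λ t → Σℚ m (λ u → s u * s u) + t) (Σ-*ˡ m (2ℚ * z) (λ u → s u * D u)))) (Σ-*ˡ m (z * z) (λ u → D u * D u))))
  where
  lem : ∀ s D z → (s + D * z) * (s + D * z) ≡ s * s + 2ℚ * z * (s * D) + z * z * (D * D)
  lem = solve-∀ ring

-- The weighted average over the two values kills the cross term of `Σ-square-shift`, and the
-- squares of the values are at most 1; so one of the two values does no worse than the right-hand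
-- side.
choose : ∀ m (s D : Fin m → ℚ) (val : Bool → ℚ) → Balanced (val false) (val true) →
  ∃ λ b → Σℚ m (λ u → (s u + D u * val b) * (s u + D u * val b)) ≤
          Σℚ m (λ u → s u * s u) + Σℚ m (λ u → D u * D u)
choose m s D val bal = go (f x ℚₚ.≤? B) (f y ℚₚ.≤? B)
  where
  open Balanced bal
  x = val false
  y = val true
  f : ℚ → ℚ
  f z = Σℚ m (λ u → (s u + D u * z) * (s u + D u * z))
  S = Σℚ m (λ u → s u * s u)
  M = Σℚ m (λ u → s u * D u)
  Q = Σℚ m (λ u → D u * D u)
  B = S + Q
  0≤Q : 0ℚ ≤ Q
  0≤Q = Σ-nonneg m (λ u → 0≤² (D u))
  idn : ∀ wx wy x y S M Q → wx * ((1ℚ - x * x) * Q) + wy * ((1ℚ - y * y) * Q) + (wx + wy) * 0ℚ ≡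
    0ℚ - (wx * (S + 2ℚ * x * M + x * x * Q - (S + Q)) + wy * (S + 2ℚ * y * M + y * y * Q - (S + Q))) + 2ℚ * M * (wx * x + wy * y)
  idn = solve-∀ ring
  avg : wx * (f x - B) + wy * (f y - B) ≤ 0ℚ
  avg = by (0≤+ (0≤+ (0≤* 0≤wx (0≤* (≤⇒0≤ x²≤1) 0≤Q)) (0≤* 0≤wy (0≤* (≤⇒0≤ y²≤1) 0≤Q))) (≤-reflexive (≡-sym (ℚₚ.*-zeroʳ (wx + wy)))))
    (trans (idn wx wy x y S M Q) (trans (cong₂ (λ p q → 0ℚ - p + 2ℚ * M * q)
      (cong₂ (λ p q → wx * (p - B) + wy * (q - B)) (≡-sym (Σ-square-shift m s D x)) (≡-sym (Σ-square-shift m s D y))) mean)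
      (lem (wx * (f x - B) + wy * (f y - B)) M)))
    where
    lem : ∀ p M → 0ℚ - p + 2ℚ * M * 0ℚ ≡ 0ℚ - p
    lem = solve-∀ ring
  go : Dec (f x ≤ B) → Dec (f y ≤ B) → ∃ λ b → f (val b) ≤ B
  go (yes p) _ = false , p
  go (no _) (yes p) = true , p
  go (no p) (no q) = ⊥-elim (≤⇒≯ pq≤0 (0<* 0<p 0<q))
    where
    0<- : ∀ {a b} → a < b → 0ℚ < b - a
    0<- {a} {b} h = subst (_< b - a) (ℚₚ.+-inverseʳ a) (ℚₚ.+-monoˡ-< (- a) h)
    P = f x - B
    R = f y - B
    0<p : 0ℚ < P
    0<p = 0<- (ℚₚ.≰⇒> p)
    0<q : 0ℚ < R
    0<q = 0<- (ℚₚ.≰⇒> q)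
    -- One of the weights may vanish, so the contradiction is drawn from the product: since the
    -- weights add up to 1, `P * R` is at most `P + R` times the weighted average of `P` and `R`,
    -- which is not positive.
    pq≤0 : P * R ≤ 0ℚ
    pq≤0 = by (0≤+ (0≤+ (0≤* (<⇒≤ 0<q) (≤⇒0≤ avg)) (0≤* (<⇒≤ 0<p) (≤⇒0≤ avg)))
                (0≤+ (0≤* 0≤wy (0≤* (<⇒≤ 0<q) (<⇒≤ 0<q))) (0≤* 0≤wx (0≤* (<⇒≤ 0<p) (<⇒≤ 0<p)))))
      (trans (l1 wx wy P R) (trans (cong (λ t → 0ℚ - P * R * t) total) (l2 P R)))
      where
      l1 : ∀ a b p q → q * (0ℚ - (a * p + b * q)) + p * (0ℚ - (a * p + b * q)) + (b * (q * q) + a * (p * p)) ≡ 0ℚ - p * q * (a + b)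
      l1 = solve-∀ ring
      l2 : ∀ p q → 0ℚ - p * q * 1ℚ ≡ 0ℚ - p * q
      l2 = solve-∀ ring

-- The method of conditional expectations, one column at a time: `s u` is the running inner product
-- with row `u` of `D`, and each column raises the sum of squares by at most `m`.
choose-row : ∀ n m (val : Fin n → Bool → ℚ) → (∀ v → Balanced (val v false) (val v true)) →
  (D : Fin m → Fin n → ℚ) → (∀ u v → D u v * D u v ≤ 1ℚ) → (s : Fin m → ℚ) →
  ∃ λ (z : Fin n → Bool) →
    Σℚ m (λ u → (s u + Σℚ n (λ v → D u v * val v (z v))) * (s u + Σℚ n (λ v → D u v * val v (z v)))) ≤
    Σℚ m (λ u → s u * s u) + ι n * ι m
choose-row zero m val bal D D² s = (λ ()) , ≤-reflexive (trans
  (Σ-cong m (λ u → cong₂ _*_ (ℚₚ.+-identityʳ (s u)) (ℚₚ.+-identityʳ (s u))))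
  (≡-sym (trans (cong (λ t → Σℚ m (λ u → s u * s u) + t * ι m) ι-0) (lem _ (ι m)))))
  where
  lem : ∀ S m → S + 0ℚ * m ≡ S
  lem = solve-∀ ring
choose-row (suc n) m val bal D D² s
  with choose m s (λ u → D u zero) (val zero) (bal zero)
... | b , hb with choose-row n m (val ∘ suc) (bal ∘ suc) (λ u → D u ∘ suc) (λ u → D² u ∘ suc)
                  (λ u → s u + D u zero * val zero b)
... | z , hz = z′ , ≤-trans (≤-reflexive (Σ-cong m (λ u → cong (λ t → t * t) (≡-sym (ℚₚ.+-assoc (s u) _ _)))))
    (≤-trans hz (by (0≤+ (≤⇒0≤ hb) (≤⇒0≤ col)) (trans (lem (Σℚ m (λ u → s u * s u)) (Σℚ m (λ u → D u zero * D u zero)) X (ι n) (ι m)) (cong (λ t → Σℚ m (λ u → s u * s u) + t * ι m - (X + ι n * ι m)) (≡-sym (ι-suc n))))))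
  where
  X = Σℚ m (λ u → (s u + D u zero * val zero b) * (s u + D u zero * val zero b))
  z′ : Fin (suc n) → Bool
  z′ zero = b
  z′ (suc v) = z v
  col : Σℚ m (λ u → D u zero * D u zero) ≤ ι m
  col = ≤-trans (Σ-mono m (λ u → D² u zero)) (≤-reflexive (trans (Σ-const m 1ℚ) (ℚₚ.*-identityʳ (ι m))))
  lem : ∀ S C X n m → (S + C - X) + (m - C) ≡ S + (1ℚ + n) * m - (X + n * m)
  lem = solve-∀ ring

-- κ T(a) + S² is the potential, where T(a) measures the discrepancy of the rows selected by a
-- and S is the total cost; a new row adds κ² per earlier row by 2κ⟨x,y⟩ ≤ κ² + ⟨x,y⟩², and the
-- squares ⟨x,y⟩² are what choose-row keeps small.
round-rows : ∀ m n (val : Fin m → Fin n → Bool → ℚ) →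
  (∀ u v → Balanced (val u v false) (val u v true)) →
  (c : Fin m → Fin n → ℚ) → (∀ u v → c u v * c u v ≤ 1ℚ) → (κ : ℚ) → 0ℚ ≤ κ →
  ∃ λ (z : Fin m → Fin n → Bool) → ∀ (a : Fin m → Bool) →
    κ * Σℚ n (λ v → Σℚ m (λ u → 𝟙 (a u) * val u v (z u v)) * Σℚ m (λ u → 𝟙 (a u) * val u v (z u v)))
    + Σℚ m (λ u → Σℚ n (λ v → c u v * val u v (z u v))) * Σℚ m (λ u → Σℚ n (λ v → c u v * val u v (z u v)))
    ≤ ι m * ι m * (κ * κ) + ι m * κ * ι n + ι m * ι m * ι n
round-rows zero n val bal c c² κ 0≤κ = (λ ()) , λ a → ≤-reflexive (trans
  (cong (λ t → κ * t + 0ℚ * 0ℚ) (Σ-zero n (λ v → ℚₚ.*-zeroˡ 0ℚ)))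
  (trans (lem κ (ι n)) (cong (λ t → t * t * (κ * κ) + t * κ * ι n + t * t * ι n) (≡-sym ι-0))))
  where
  lem : ∀ κ n → κ * 0ℚ + 0ℚ * 0ℚ ≡ 0ℚ * 0ℚ * (κ * κ) + 0ℚ * κ * n + 0ℚ * 0ℚ * n
  lem = solve-∀ ring
round-rows (suc m) n val bal c c² κ 0≤κ
  with round-rows m n (val ∘ suc) (bal ∘ suc) (c ∘ suc) (c² ∘ suc) κ 0≤κ
... | z , hz with choose-row n (suc m) (val zero) (bal zero) D′ D′² s′
  where
  dd : Fin m → Fin n → ℚ
  dd u v = val (suc u) v (z u v)
  -- The new row is tested against its own costs and against all earlier rounded rows. Only the cost
  -- coordinate has a history, the total cost so far; the inner products with earlier rows start at
  -- 0.
  D′ : Fin (suc m) → Fin n → ℚ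
  D′ zero = c zero
  D′ (suc u) = dd u
  D′² : ∀ u v → D′ u v * D′ u v ≤ 1ℚ
  D′² zero v = c² zero v
  D′² (suc u) v with z u v
  ... | true = Balanced.y²≤1 (bal (suc u) v)
  ... | false = Balanced.x²≤1 (bal (suc u) v)
  s′ : Fin (suc m) → ℚ
  s′ zero = Σℚ m (λ u → Σℚ n (λ v → c (suc u) v * dd u v))
  s′ (suc u) = 0ℚ
... | z₀ , h₀ = z′ , bound
  where
  z′ : Fin (suc m) → Fin n → Bool
  z′ zero = z₀
  z′ (suc u) = z u
  dd : Fin m → Fin n → ℚ
  dd u v = val (suc u) v (z u v)
  x : Fin n → ℚ
  x v = val zero v (z₀ v)
  ip : Fin m → ℚ
  ip u = Σℚ n (λ v → dd u v * x v)
  S = Σℚ m (λ u → Σℚ n (λ v → c (suc u) v * dd u v))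
  C = Σℚ n (λ v → c zero v * x v)
  IP = Σℚ m (λ u → ip u * ip u)
  row : (S + C) * (S + C) + IP ≤ S * S + ι n * (1ℚ + ι m)
  row = ≤-trans (≤-reflexive (cong (λ t → (S + C) * (S + C) + t) (Σ-cong m (λ u → cong (λ t → t * t) (≡-sym (ℚₚ.+-identityˡ (ip u)))))))
    (≤-trans h₀ (≤-reflexive (trans (cong₂ (λ p q → S * S + p + ι n * q) (Σ-zero m (λ _ → refl)) (ι-suc m)) (cong (_+ ι n * (1ℚ + ι m)) (ℚₚ.+-identityʳ (S * S))))))
  x² : ∀ v → x v * x v ≤ 1ℚ
  x² v with z₀ v
  ... | true = Balanced.y²≤1 (bal zero v)
  ... | false = Balanced.x²≤1 (bal zero v)
  bound : ∀ a → _
  bound a = ≤-trans step final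
    where
    α = 𝟙 (a zero)
    y : Fin n → ℚ
    y v = Σℚ m (λ u → 𝟙 (a (suc u)) * dd u v)
    T = Σℚ n (λ v → y v * y v)
    X = Σℚ n (λ v → x v * x v)
    XY = Σℚ n (λ v → y v * x v)
    T′ = Σℚ n (λ v → (α * x v + y v) * (α * x v + y v))
    T′-eq : T′ ≡ T + 2ℚ * α * XY + α * α * X
    T′-eq = trans (Σ-cong n (λ v → cong (λ t → t * t) (trans (ℚₚ.+-comm (α * x v) (y v)) (cong (λ t → y v + t) (ℚₚ.*-comm α (x v))))))
      (Σ-square-shift n y x α)
    XY-eq : XY ≡ Σℚ m (λ u → 𝟙 (a (suc u)) * ip u)
    XY-eq = trans (Σ-cong n (λ v → trans (ℚₚ.*-comm (y v) (x v)) (trans (≡-sym (Σ-*ˡ m (x v) _))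
        (Σ-cong m (λ u → l (x v) (𝟙 (a (suc u))) (dd u v))))))
      (trans (Σ-swap n m _) (Σ-cong m (λ u → Σ-*ˡ n (𝟙 (a (suc u))) _)))
      where
      l : ∀ x a d → x * (a * d) ≡ a * (d * x)
      l = solve-∀ ring
    X≤n : X ≤ ι n
    X≤n = ≤-trans (Σ-mono n x²) (≤-reflexive (trans (Σ-const n 1ℚ) (ℚₚ.*-identityʳ (ι n))))
    amgm : ∀ κ p q r → 0ℚ ≤ p → p ≤ 1ℚ → 0ℚ ≤ q → q ≤ 1ℚ → 2ℚ * κ * p * (q * r) ≤ κ * κ + r * r
    amgm κ p q r p0 p1 q0 q1 = by (0≤+ (0≤² (κ * p * q - r)) (0≤* (0≤² κ) (≤⇒0≤ (≤-mul (0≤* p0 q0) pq (0≤* p0 q0) pq)))) (l κ p q r)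
      where
      pq : p * q ≤ 1ℚ
      pq = ≤-mul p0 p1 q0 q1
      l : ∀ κ p q r → (κ * p * q - r) * (κ * p * q - r) + κ * κ * (1ℚ * 1ℚ - (p * q) * (p * q)) ≡ κ * κ + r * r - 2ℚ * κ * p * (q * r)
      l = solve-∀ ring
    cross : 2ℚ * κ * α * XY ≤ ι m * (κ * κ) + IP
    cross = ≤-trans (≤-reflexive (trans (cong (2ℚ * κ * α *_) XY-eq) (≡-sym (Σ-*ˡ m (2ℚ * κ * α) _))))
      (≤-trans (Σ-mono m (λ u → amgm κ α (𝟙 (a (suc u))) (ip u) (0≤𝟙 (a zero)) (𝟙≤1 (a zero)) (0≤𝟙 (a (suc u))) (𝟙≤1 (a (suc u)))))
      (≤-reflexive (trans (Σ-+ m _ _) (cong (_+ IP) (Σ-const m (κ * κ))))))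
    αα : α * α ≤ 1ℚ
    αα = ≤-mul (0≤𝟙 (a zero)) (𝟙≤1 (a zero)) (0≤𝟙 (a zero)) (𝟙≤1 (a zero))
    0≤X : 0ℚ ≤ X
    0≤X = Σ-nonneg n (λ v → 0≤² (x v))
    step : κ * T′ + (C + S) * (C + S) ≤ κ * T + S * S + (ι m * (κ * κ) + κ * ι n + ι n * (1ℚ + ι m))
    step = ≤-trans (≤-reflexive (cong (λ t → κ * t + (C + S) * (C + S)) T′-eq))
      (by (0≤+ (0≤+ (≤⇒0≤ cross) (≤⇒0≤ row)) (0≤+ (0≤* 0≤κ (≤⇒0≤ X≤n)) (0≤* 0≤κ (0≤* 0≤X (≤⇒0≤ αα)))))
        (l κ T α XY X S C (ι m) (ι n) IP))
      where
      l : ∀ κ T α XY X S C m n IP →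
        (m * (κ * κ) + IP - 2ℚ * κ * α * XY) + (S * S + n * (1ℚ + m) - ((S + C) * (S + C) + IP)) + (κ * (n - X) + κ * (X * (1ℚ - α * α)))
        ≡ κ * T + S * S + (m * (κ * κ) + κ * n + n * (1ℚ + m)) - (κ * (T + 2ℚ * α * XY + α * α * X) + (C + S) * (C + S))
      l = solve-∀ ring
    final : κ * T + S * S + (ι m * (κ * κ) + κ * ι n + ι n * (1ℚ + ι m)) ≤
      ι (suc m) * ι (suc m) * (κ * κ) + ι (suc m) * κ * ι n + ι (suc m) * ι (suc m) * ι n
    final = ≤-trans (ℚₚ.+-monoˡ-≤ _ (hz (a ∘ suc))) (≤-trans
      (by (0≤+ (0≤* (0≤+ 0≤1 (0≤ι m)) (0≤² κ)) (0≤* (0≤ι m) (0≤ι n))) (l κ (ι m) (ι n)))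
      (≤-reflexive (cong (λ t → t * t * (κ * κ) + t * κ * ι n + t * t * ι n) (≡-sym (ι-suc m)))))
      where
      l : ∀ κ m n → (1ℚ + m) * (κ * κ) + m * n ≡
        ((1ℚ + m) * (1ℚ + m) * (κ * κ) + (1ℚ + m) * κ * n + (1ℚ + m) * (1ℚ + m) * n)
        - (m * m * (κ * κ) + m * κ * n + m * m * n + (m * (κ * κ) + κ * n + n * (1ℚ + m)))
      l = solve-∀ ring

-- With `κ` = 3K² and 9K⁴ ≤ n, each of the three terms bounding the potential is at most n³. Hence
-- K²T(a) ≤ n³ for every `a`, and AM-GM over the columns in `b` turns this into the cut bound; the
-- squared cost is at most 3n³ ≤ n⁴/K².
rounding : ∀ n (val : Fin n → Fin n → Bool → ℚ) →
  (∀ u v → Balanced (val u v false) (val u v true)) →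
  (c : Fin n → Fin n → ℚ) → (∀ u v → c u v * c u v ≤ 1ℚ) → (K : ℚ) → 1ℚ ≤ K → 1 ℕ.≤ n →
  (1ℚ + 2ℚ) * (1ℚ + 2ℚ) * (K * K * (K * K)) ≤ ι n →
  ∃ λ (z : Fin n → Fin n → Bool) →
    (∀ (a b : Fin n → Bool) → K * ∣ ΣΣ n (λ u v → 𝟙 (a u) * 𝟙 (b v) * val u v (z u v)) ∣ ≤ ι n * ι n) ×
    K * ΣΣ n (λ u v → c u v * val u v (z u v)) ≤ ι n * ι n
rounding n val bal c c² K 1≤K 1≤n big
  with round-rows n n val bal c c² ((1ℚ + 2ℚ) * (K * K)) (0≤* (0≤+ 0≤1 0≤2) (0≤² K))
... | z , hz = z , cut , cost
  where
  3ℚ = 1ℚ + 2ℚ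
  0≤3 : 0ℚ ≤ 3ℚ
  0≤3 = 0≤+ 0≤1 0≤2
  1≤3 : 1ℚ ≤ 3ℚ
  1≤3 = by 0≤2 refl
  ν = ι n
  κ = 3ℚ * (K * K)
  0≤K : 0ℚ ≤ K
  0≤K = ≤-trans 0≤1 1≤K
  KK = K * K
  1≤KK : 1ℚ ≤ KK
  1≤KK = ≤-mul 0≤1 1≤K 0≤1 1≤K
  3KK≤ν : 3ℚ * KK ≤ ν
  3KK≤ν = ≤-trans (by (0≤+ (0≤* (0≤* 0≤3 (≤⇒0≤ 1≤3)) (0≤² K)) (0≤* (0≤* 0≤3 0≤3) (0≤* (0≤² K) (≤⇒0≤ 1≤KK)))) (l KK 3ℚ)) big
    where
    l : ∀ k t → t * (t - 1ℚ) * k + t * t * (k * (k - 1ℚ)) ≡ t * t * (k * k) - t * k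
    l = solve-∀ ring
  0≤ν : 0ℚ ≤ ν
  0≤ν = 0≤ι n
  total : ν * ν * (κ * κ) + ν * κ * ν + ν * ν * ν ≤ 3ℚ * (ν * ν * ν)
  total = by (0≤+ (0≤* (0≤² ν) (≤⇒0≤ big)) (0≤* (0≤² ν) (≤⇒0≤ 3KK≤ν))) (l ν KK)
    where
    l : ∀ n k → n * n * (n - (1ℚ + 2ℚ) * (1ℚ + 2ℚ) * (k * k)) + n * n * (n - (1ℚ + 2ℚ) * k) ≡
      (1ℚ + 2ℚ) * (n * n * n) - (n * n * ((1ℚ + 2ℚ) * k * ((1ℚ + 2ℚ) * k)) + n * ((1ℚ + 2ℚ) * k) * n + n * n * n)
    l = solve-∀ ring
  S = ΣΣ n (λ u v → c u v * val u v (z u v))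
  cost : K * S ≤ ν * ν
  cost = ≤-sqrt (0≤² ν) (by (0≤+ (0≤* (0≤² K) (≤⇒0≤ S²)) (0≤* (0≤* (0≤² ν) 0≤ν) (≤⇒0≤ 3KK≤ν))) (l K S ν))
    where
    Tf = Σℚ n (λ v → Σℚ n (λ u → 𝟙 false * val u v (z u v)) * Σℚ n (λ u → 𝟙 false * val u v (z u v)))
    S² : S * S ≤ 3ℚ * (ν * ν * ν)
    S² = ≤-trans (by (0≤* (0≤* 0≤3 (0≤² K)) (Σ-nonneg n (λ v → 0≤² (Σℚ n (λ u → 𝟙 false * val u v (z u v)))))) (l′ κ Tf (S * S)))
      (≤-trans (hz (λ _ → false)) total)
      where
      l′ : ∀ k t s → k * t ≡ k * t + s - s
      l′ = solve-∀ ring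
    l : ∀ K S n → K * K * ((1ℚ + 2ℚ) * (n * n * n) - S * S) + n * n * n * (n - (1ℚ + 2ℚ) * (K * K)) ≡ n * n * (n * n) - K * S * (K * S)
    l = solve-∀ ring
  0<ν : 0ℚ < ν
  0<ν = 0<ι 1≤n
  cut : ∀ a b → _
  cut a b = ≤-trans (≤-reflexive (trans (cong (_* ∣ XX ∣) (≡-sym (ℚₚ.0≤p⇒∣p∣≡p 0≤K))) (≡-sym (ℚₚ.∣p*q∣≡∣p∣*∣q∣ K XX))))
      (∣∣-≤ (≤-cancelˡ (2ℚ * ν) (0<* (ℚₚ.positive⁻¹ 2ℚ) 0<ν) (≤-trans (≤-reflexive (cong (λ t → 2ℚ * ν * (K * t)) XX-eq)) (half K refl)))
            (≤-cancelˡ (2ℚ * ν) (0<* (ℚₚ.positive⁻¹ 2ℚ) 0<ν) (≤-trans (≤-reflexive (trans (cong (λ t → 2ℚ * ν * (- (K * t))) XX-eq) (cong (2ℚ * ν *_) (ℚₚ.neg-distribˡ-* K (Σℚ n (λ v → 𝟙 (b v) * y v)))))) (half (- K) (neg-² K)))))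
    where
    XX = ΣΣ n (λ u v → 𝟙 (a u) * 𝟙 (b v) * val u v (z u v))
    y : Fin n → ℚ
    y v = Σℚ n (λ u → 𝟙 (a u) * val u v (z u v))
    T = Σℚ n (λ v → y v * y v)
    XX-eq : XX ≡ Σℚ n (λ v → 𝟙 (b v) * y v)
    XX-eq = trans (Σ-swap n n _) (Σ-cong n (λ v → trans (Σ-cong n (λ u → l (𝟙 (a u)) (𝟙 (b v)) (val u v (z u v)))) (Σ-*ˡ n (𝟙 (b v)) _)))
      where
      l : ∀ a b d → a * b * d ≡ b * (a * d)
      l = solve-∀ ring
    KT : KK * T ≤ ν * ν * ν
    KT = ≤-cancelˡ 3ℚ (ℚₚ.positive⁻¹ 3ℚ) (≤-trans (by (0≤² S) (l′ KK T (S * S))) (≤-trans (hz a) total))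
      where
      l′ : ∀ k t s → s ≡ (1ℚ + 2ℚ) * k * t + s - (1ℚ + 2ℚ) * (k * t)
      l′ = solve-∀ ring
    -- Applied to `K` and to `- K` for the two signs of the absolute value; the estimate sees only
    -- `L * L`.
    half : ∀ L → L * L ≡ KK → 2ℚ * ν * (L * Σℚ n (λ v → 𝟙 (b v) * y v)) ≤ 2ℚ * ν * (ν * ν)
    half L eq = ≤-trans (≤-reflexive (trans (cong (2ℚ * ν *_) (≡-sym (Σ-*ˡ n L _))) (≡-sym (Σ-*ˡ n (2ℚ * ν) _))))
      (≤-trans (Σ-mono n (λ v → per (𝟙 (b v)) (y v) (0≤𝟙 (b v)) (𝟙≤1 (b v))))
      (≤-trans (≤-reflexive (trans (Σ-+ n _ _) (cong₂ _+_ (Σ-*ˡ n (L * L) _) (Σ-const n (ν * ν)))))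
      (by (≤⇒0≤ KT) (trans (cong (λ t → ν * ν * ν - t * T) (≡-sym eq)) (l′ ν (L * L) T)))))
      where
      per : ∀ β y → 0ℚ ≤ β → β ≤ 1ℚ → 2ℚ * ν * (L * (β * y)) ≤ L * L * (y * y) + ν * ν
      per β y p q = by (0≤+ (0≤² (L * y - ν * β)) (0≤* (0≤² ν) (≤⇒0≤ (≤-mul p q p q)))) (l L ν β y)
        where
        l : ∀ L n β y → (L * y - n * β) * (L * y - n * β) + n * n * (1ℚ * 1ℚ - β * β) ≡ L * L * (y * y) + n * n - 2ℚ * n * (L * (β * y))
        l = solve-∀ ring
      l′ : ∀ n k T → n * n * n - k * T ≡ 2ℚ * n * (n * n) - (k * T + n * (n * n))
      l′ = solve-∀ ring

-- Test functions and energy decrement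

unit : ℚ → Set
unit x = 0ℚ ≤ x × x ≤ 1ℚ

1-unit : ∀ {x} → unit x → unit (1ℚ - x)
1-unit {x} (p , q) = ≤⇒0≤ q , by p (lem x)
  where
  lem : ∀ x → x ≡ 1ℚ - (1ℚ - x)
  lem = solve-∀ ring

unit-² : ∀ {x} → unit x → x * x ≤ 1ℚ
unit-² (p , q) = ≤-mul p q p q

-- Division by `y` is safe at 0: there `x ≤ y` forces `x` to vanish, so the quotient is 0 whatever
-- `inv y` is.
ratio : ∀ {x y} → unit x → unit y → x ≤ y → unit (x * inv y) × x * inv y * y ≡ x
ratio {x} {y} (0≤x , _) (0≤y , y≤1) x≤y with 0ℚ ℚₚ.<? y
... | yes 0<y = (0≤* 0≤x (0≤inv 0≤y) , ≤-trans (by (0≤* (≤⇒0≤ x≤y) (0≤inv 0≤y)) (l₁ x y (inv y))) (≤-reflexive (inv-pos 0<y)))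
  , trans (l₂ x y (inv y)) (trans (cong (x *_) (inv-pos 0<y)) (ℚₚ.*-identityʳ x))
  where
  l₁ : ∀ x y i → (y - x) * i ≡ y * i - x * i
  l₁ = solve-∀ ring
  l₂ : ∀ x y i → x * i * y ≡ x * (y * i)
  l₂ = solve-∀ ring
... | no 0≮y = subst unit (≡-sym z) (≤-refl , 0≤1) , trans (cong (_* y) z) (trans (ℚₚ.*-zeroˡ y) (≡-sym x≡0))
  where
  x≡0 : x ≡ 0ℚ
  x≡0 = ℚₚ.≤-antisym (≤-trans x≤y (ℚₚ.≮⇒≥ 0≮y)) 0≤x
  z : x * inv y ≡ 0ℚ
  z = trans (cong (_* inv y) x≡0) (ℚₚ.*-zeroˡ (inv y))

-- The affine map x ↦ c + slope w c * (x - w) fixes 0 or 1, maps w to c and [0,1] into itself;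
-- it moves points in the direction given by sgn.
slope-on : ∀ w c → Dec (c ≤ w) → ℚ
slope-on w c (yes _) = c * inv w
slope-on w c (no _) = (1ℚ - c) * inv (1ℚ - w)

sgn-on : ∀ w c → Dec (c ≤ w) → ℚ
sgn-on w c (yes _) = 1ℚ
sgn-on w c (no _) = - 1ℚ

slope-on-unit : ∀ {w c} → unit w → unit c → ∀ o → unit (slope-on w c o)
slope-on-unit uw uc (yes p) = proj₁ (ratio uc uw p)
slope-on-unit uw uc (no p) = proj₁ (ratio (1-unit uc) (1-unit uw) (ℚₚ.+-monoʳ-≤ 1ℚ (ℚₚ.neg-antimono-≤ (<⇒≤ (ℚₚ.≰⇒> p)))))

sgn-on-² : ∀ w c o → sgn-on w c o * sgn-on w c o ≡ 1ℚ
sgn-on-² w c (yes p) = refl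
sgn-on-² w c (no p) = refl

-- For `c ≤ w` the map is multiplication by c/w ≤ 1, which moves points down. The other case is its
-- mirror image under x ↦ 1 - x: the distance to 1 is multiplied by (1 - c)/(1 - w), which moves
-- points up.
transport-on-unit : ∀ {x w c} → unit x → unit w → unit c → ∀ o →
  unit (c + slope-on w c o * (x - w)) × 0ℚ ≤ sgn-on w c o * (x - (c + slope-on w c o * (x - w)))
transport-on-unit {x} {w} {c} (0≤x , x≤1) uw uc (yes p) = (subst (0ℚ ≤_) (≡-sym H) (0≤* 0≤b 0≤x) , ≤-trans (≤-reflexive H) (≤-trans bx≤x x≤1))
    , byPos (≤⇒0≤ bx≤x) (trans (cong (λ t → x - t) (≡-sym H)) (≡-sym (ℚₚ.*-identityˡ (x - (c + b * (x - w))))))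
  where
  b = c * inv w
  r = ratio uc uw p
  0≤b = proj₁ (proj₁ r)
  H : c + b * (x - w) ≡ b * x
  H = trans (l c b x w) (trans (cong (λ t → b * x + (c - t)) (proj₂ r)) (l′ c b x))
    where
    l : ∀ c b x w → c + b * (x - w) ≡ b * x + (c - b * w)
    l = solve-∀ ring
    l′ : ∀ c b x → b * x + (c - c) ≡ b * x
    l′ = solve-∀ ring
  bx≤x : b * x ≤ x
  bx≤x = by (0≤* (≤⇒0≤ (proj₂ (proj₁ r))) 0≤x) (l b x)
    where
    l : ∀ b x → (1ℚ - b) * x ≡ x - b * x
    l = solve-∀ ring
transport-on-unit {x} {w} {c} (0≤x , x≤1) uw uc (no p) = (subst (0ℚ ≤_) (≡-sym H) (0≤+ 0≤x 0≤gap) , ≤-trans (≤-reflexive H) (by (0≤* 0≤b (≤⇒0≤ x≤1)) (l₃ b x)))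
    , byPos 0≤gap (trans (l₄ b x) (cong (λ t → - 1ℚ * (x - t)) (≡-sym H)))
  where
  b = (1ℚ - c) * inv (1ℚ - w)
  r = ratio (1-unit uc) (1-unit uw) (ℚₚ.+-monoʳ-≤ 1ℚ (ℚₚ.neg-antimono-≤ (<⇒≤ (ℚₚ.≰⇒> p))))
  0≤b = proj₁ (proj₁ r)
  0≤gap : 0ℚ ≤ (1ℚ - b) * (1ℚ - x)
  0≤gap = 0≤* (≤⇒0≤ (proj₂ (proj₁ r))) (≤⇒0≤ x≤1)
  H : c + b * (x - w) ≡ x + (1ℚ - b) * (1ℚ - x)
  H = trans (l c b x w) (trans (cong (λ t → x + (1ℚ - b) * (1ℚ - x) + (t - (1ℚ - c))) (proj₂ r)) (l′ c b x))
    where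
    l : ∀ c b x w → c + b * (x - w) ≡ x + (1ℚ - b) * (1ℚ - x) + (b * (1ℚ - w) - (1ℚ - c))
    l = solve-∀ ring
    l′ : ∀ c b x → x + (1ℚ - b) * (1ℚ - x) + ((1ℚ - c) - (1ℚ - c)) ≡ x + (1ℚ - b) * (1ℚ - x)
    l′ = solve-∀ ring
  l₃ : ∀ b x → b * (1ℚ - x) ≡ 1ℚ - (x + (1ℚ - b) * (1ℚ - x))
  l₃ = solve-∀ ring
  l₄ : ∀ b x → (1ℚ - b) * (1ℚ - x) ≡ - 1ℚ * (x - (x + (1ℚ - b) * (1ℚ - x)))
  l₄ = solve-∀ ring

abstract
  slope sgn : ℚ → ℚ → ℚ
  slope w c = slope-on w c (c ℚₚ.≤? w)
  sgn w c = sgn-on w c (c ℚₚ.≤? w)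

  slope-unit : ∀ {w c} → unit w → unit c → unit (slope w c)
  slope-unit {w} {c} uw uc = slope-on-unit uw uc (c ℚₚ.≤? w)

  sgn-² : ∀ w c → sgn w c * sgn w c ≡ 1ℚ
  sgn-² w c = sgn-on-² w c (c ℚₚ.≤? w)

  transport-unit : ∀ {x w c} → unit x → unit w → unit c →
    unit (c + slope w c * (x - w)) × 0ℚ ≤ sgn w c * (x - (c + slope w c * (x - w)))
  transport-unit {x} {w} {c} ux uw uc = transport-on-unit ux uw uc (c ℚₚ.≤? w)

-- The first two tests bound the cut error of the edited graph, the third the number of edits, and
-- the last the loss of energy when the step function c is replaced by w.
test : Fin 4 → ℚ → ℚ → ℚ
test zero w c = slope w c
test (suc zero) w c = - slope w c
test (suc (suc zero)) w c = sgn w c * (1ℚ - slope w c)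
test (suc (suc (suc zero))) w c = c - w

test-²≤1 : ∀ t {w c} → unit w → unit c → test t w c * test t w c ≤ 1ℚ
test-²≤1 zero uw uc = unit-² (slope-unit uw uc)
test-²≤1 (suc zero) {w} {c} uw uc = ≤-trans (≤-reflexive (neg-² (slope w c))) (unit-² (slope-unit uw uc))
test-²≤1 (suc (suc zero)) {w} {c} uw uc = ≤-trans
  (≤-reflexive (trans (l (sgn w c) (1ℚ - slope w c)) (trans (cong (_* ((1ℚ - slope w c) * (1ℚ - slope w c))) (sgn-² w c)) (ℚₚ.*-identityˡ ((1ℚ - slope w c) * (1ℚ - slope w c))))))
  (unit-² (1-unit (slope-unit uw uc)))
  where
  l : ∀ s x → s * x * (s * x) ≡ s * s * (x * x)
  l = solve-∀ ring
test-²≤1 (suc (suc (suc zero))) {w} {c} (0≤w , w≤1) (0≤c , c≤1) = by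
  (0≤* (0≤+ (≤⇒0≤ c≤1) 0≤w) (0≤+ (≤⇒0≤ w≤1) 0≤c)) (l w c)
  where
  l : ∀ w c → ((1ℚ - c) + w) * ((1ℚ - w) + c) ≡ 1ℚ - (c - w) * (c - w)
  l = solve-∀ ring

abstract
  clamp : ℚ → ℚ
  clamp y = (0ℚ ⊔ y) ⊓ 1ℚ

  clamp-unit : ∀ y → unit (clamp y)
  clamp-unit y = ℚₚ.⊓-glb (ℚₚ.p≤p⊔q 0ℚ y) 0≤1 , ℚₚ.p⊓q≤q (0ℚ ⊔ y) 1ℚ

  -- This lets a corrected step function be truncated to [0,1] at no cost in energy.
  clamp-closer : ∀ {x} y → unit x → (x - clamp y) * (x - clamp y) ≤ (x - y) * (x - y)
  clamp-closer {x} y (0≤x , x≤1) with ℚₚ.≤-total 0ℚ y | ℚₚ.≤-total (0ℚ ⊔ y) 1ℚ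
  ... | inj₁ 0≤y | inj₁ p = ≤-reflexive (cong (λ t → (x - t) * (x - t)) (trans (ℚₚ.p≤q⇒p⊓q≡p p) (ℚₚ.p≤q⇒p⊔q≡q 0≤y)))
  ... | inj₁ 0≤y | inj₂ p = ≤-trans (≤-reflexive (cong (λ t → (x - t) * (x - t)) (ℚₚ.p≥q⇒p⊓q≡q p)))
    (by (0≤* (≤⇒0≤ 1≤y) (0≤+ (≤⇒0≤ (≤-trans x≤1 1≤y)) (≤⇒0≤ x≤1))) (l x y))
    where
    1≤y : 1ℚ ≤ y
    1≤y = ≤-trans p (≤-reflexive (ℚₚ.p≤q⇒p⊔q≡q 0≤y))
    l : ∀ x y → (y - 1ℚ) * ((y - x) + (1ℚ - x)) ≡ (x - y) * (x - y) - (x - 1ℚ) * (x - 1ℚ)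
    l = solve-∀ ring
  ... | inj₂ y≤0 | _ = ≤-trans (≤-reflexive (cong (λ t → (x - t) * (x - t)) (trans (cong (_⊓ 1ℚ) (ℚₚ.p≥q⇒p⊔q≡p y≤0)) (ℚₚ.p≤q⇒p⊓q≡p 0≤1))))
    (by (0≤* (0≤-neg y≤0) (0≤+ (≤⇒0≤ (≤-trans y≤0 0≤x)) 0≤x)) (l x y))
    where
    l : ∀ x y → (- y) * ((x - y) + x) ≡ (x - y) * (x - y) - (x - 0ℚ) * (x - 0ℚ)
    l = solve-∀ ring

χ-unit : ∀ {n} (G : Graph n) u v → unit (χ G u v)
χ-unit G u v = 0≤𝟙 (adj G u v) , 𝟙≤1 (adj G u v)

χ-sym : ∀ {n} (G : Graph n) u v → χ G u v ≡ χ G v u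
χ-sym G u v = cong 𝟙 (sym G u v)

record Kernel (p : ℕ) : Set where
  field
    val  : Fin p → Fin p → ℚ
    symm : ∀ i j → val i j ≡ val j i
    rng  : ∀ i j → unit (val i j)

on : ∀ {n p} → Kernel p → (Fin n → Fin p) → Fin n → Fin n → ℚ
on F P u v = Kernel.val F (P u) (P v)

energy : ∀ {n p} → Graph n → (Fin n → Fin p) → Kernel p → ℚ
energy {n} G P F = ΣΣ n (λ u v → (χ G u v - on F P u v) * (χ G u v - on F P u v))

0≤energy : ∀ {n p} (G : Graph n) (P : Fin n → Fin p) (F : Kernel p) → 0ℚ ≤ energy G P F
0≤energy {n} G P F = ΣΣ-nonneg n (λ u v → 0≤² (χ G u v - on F P u v))

-- `W` is defined on the classes of `Q` and the reference kernel on those of `P`; through the factor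
-- map `π` a test function becomes a function of pairs of classes of `Q`, so a corrected kernel is
-- again a step function.
record Refined {n p : ℕ} (P : Fin n → Fin p) : Set where
  field
    q   : ℕ
    Q   : Fin n → Fin q
    π   : Fin q → Fin p
    πQ  : ∀ u → π (Q u) ≡ P u
    W   : Kernel q

bit : Bool → Fin 2
bit true = zero
bit false = suc zero

unbit : Fin 2 → Bool
unbit zero = true
unbit (suc _) = false

unbit-bit : ∀ b → unbit (bit b) ≡ b
unbit-bit true = refl
unbit-bit false = refl

-- A refinement splits every class by the two sets of a violated test, whence the factor 4 per step
-- in `regularize`.
encode : ∀ {q} → Fin q → Bool → Bool → Fin (q ℕ.* 2 ℕ.* 2)
encode x a b = Fin.combine (Fin.combine x (bit a)) (bit b)

base : ∀ {q} → Fin (q ℕ.* 2 ℕ.* 2) → Fin q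
base {q} y = proj₁ (Fin.remQuot {q} 2 (proj₁ (Fin.remQuot {q ℕ.* 2} 2 y)))

bit₁ bit₂ : ∀ {q} → Fin (q ℕ.* 2 ℕ.* 2) → Bool
bit₁ {q} y = unbit (proj₂ (Fin.remQuot {q} 2 (proj₁ (Fin.remQuot {q ℕ.* 2} 2 y))))
bit₂ {q} y = unbit (proj₂ (Fin.remQuot {q ℕ.* 2} 2 y))

base-encode : ∀ {q} (x : Fin q) a b → base (encode x a b) ≡ x
base-encode {q} x a b = trans (cong (λ t → proj₁ (Fin.remQuot {q} 2 (proj₁ t))) (Finₚ.remQuot-combine (Fin.combine x (bit a)) (bit b)))
  (cong proj₁ (Finₚ.remQuot-combine x (bit a)))

bit₁-encode : ∀ {q} (x : Fin q) a b → bit₁ {q} (encode x a b) ≡ a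
bit₁-encode {q} x a b = trans (cong (λ t → unbit (proj₂ (Fin.remQuot {q} 2 (proj₁ t)))) (Finₚ.remQuot-combine (Fin.combine x (bit a)) (bit b)))
  (trans (cong (unbit ∘ proj₂) (Finₚ.remQuot-combine x (bit a))) (unbit-bit a))

bit₂-encode : ∀ {q} (x : Fin q) a b → bit₂ {q} (encode x a b) ≡ b
bit₂-encode {q} x a b = trans (cong (unbit ∘ proj₂) (Finₚ.remQuot-combine (Fin.combine x (bit a)) (bit b))) (unbit-bit b)

module Decrement {n : ℕ} (G : Graph n) {p : ℕ} (P : Fin n → Fin p) (F : Kernel p) (τ : ℚ) (0<τ : 0ℚ < τ) where

  open Refined

  N² : ℚ
  N² = ι n * ι n

  0≤N² : 0ℚ ≤ N²
  0≤N² = 0≤² (ι n)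

  w : Refined P → Fin n → Fin n → ℚ
  w A = on (W A) (Q A)

  E : Refined P → ℚ
  E A = energy G (Q A) (W A)

  corr : Refined P → Fin 4 → VSet n → VSet n → ℚ
  corr A t a b = ΣΣ n (λ u v → (χ G u v - w A u v) * (test t (w A u v) (on F P u v) * (𝟙 (a u) * 𝟙 (b v))))

  corr-cong : ∀ A t {a a′ b b′} → (∀ u → a u ≡ a′ u) → (∀ u → b u ≡ b′ u) → corr A t a b ≡ corr A t a′ b′
  corr-cong A t ha hb = ΣΣ-cong n (λ u v → cong₂ (λ x y → (χ G u v - w A u v) * (test t (w A u v) (on F P u v) * (𝟙 x * 𝟙 y))) (ha u) (hb v))

  module _ (A : Refined P) (t : Fin 4) (a b : VSet n) (viol : τ * N² < corr A t a b) where

    φ : Fin (q A) → Fin (q A) → ℚ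
    φ x y = test t (Kernel.val (W A) x y) (Kernel.val F (π A x) (π A y))

    -- The average of φ·1_{A×B} and its transpose, so that the corrected kernel stays symmetric. As
    -- `χ - w` and φ are symmetric, averaging leaves the correlation unchanged, which is `dev-h`.
    bump : ℚ → Bool → Bool → Bool → Bool → ℚ
    bump z a₁ b₁ a₂ b₂ = ½ * (z * (𝟙 a₁ * 𝟙 b₂ + 𝟙 a₂ * 𝟙 b₁))

    raw : Fin (q A) → Fin (q A) → Bool → Bool → Bool → Bool → ℚ
    raw x y a₁ b₁ a₂ b₂ = Kernel.val (W A) x y + τ * bump (φ x y) a₁ b₁ a₂ b₂

    q′ : ℕ
    q′ = q A ℕ.* 2 ℕ.* 2

    W′ : Kernel q′
    Kernel.val W′ x y = clamp (raw (base x) (base y) (bit₁ {q A} x) (bit₂ {q A} x) (bit₁ {q A} y) (bit₂ {q A} y))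
    Kernel.symm W′ x y = cong clamp (cong₂ (λ r s → r + τ * (½ * s)) (Kernel.symm (W A) (base x) (base y))
      (cong₂ _*_ (cong₂ (test t) (Kernel.symm (W A) (base x) (base y)) (Kernel.symm F (π A (base x)) (π A (base y))))
        (ℚₚ.+-comm (𝟙 (bit₁ {q A} x) * 𝟙 (bit₂ {q A} y)) (𝟙 (bit₁ {q A} y) * 𝟙 (bit₂ {q A} x)))))
    Kernel.rng W′ x y = clamp-unit (raw (base x) (base y) (bit₁ {q A} x) (bit₂ {q A} x) (bit₁ {q A} y) (bit₂ {q A} y))

    refine : Refined P
    q refine = q′
    Q refine u = encode (Q A u) (a u) (b u)
    π refine x = π A (base x)
    πQ refine u = trans (cong (π A) (base-encode (Q A u) (a u) (b u))) (πQ A u)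
    W refine = W′

    φF : Fin n → Fin n → ℚ
    φF u v = test t (w A u v) (on F P u v)

    h : Fin n → Fin n → ℚ
    h u v = bump (φF u v) (a u) (b u) (a v) (b v)

    w-refine : ∀ u v → w refine u v ≡ clamp (w A u v + τ * h u v)
    w-refine u v = cong clamp (trans
      (cong₂ (λ x y → raw x y (bit₁ {q A} (Q refine u)) (bit₂ {q A} (Q refine u)) (bit₁ {q A} (Q refine v)) (bit₂ {q A} (Q refine v)))
        (base-encode (Q A u) (a u) (b u)) (base-encode (Q A v) (a v) (b v)))
      (cong₂ (λ x y → w A u v + τ * (½ * (x * y)))
        (cong₂ (λ i j → test t (w A u v) (Kernel.val F i j)) (πQ A u) (πQ A v))
        (cong₂ _+_ (cong₂ (λ x y → 𝟙 x * 𝟙 y) (bit₁-encode (Q A u) (a u) (b u)) (bit₂-encode (Q A v) (a v) (b v)))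
                   (cong₂ (λ x y → 𝟙 x * 𝟙 y) (bit₁-encode (Q A v) (a v) (b v)) (bit₂-encode (Q A u) (a u) (b u))))))

    dev : Fin n → Fin n → ℚ
    dev u v = χ G u v - w A u v

    dev-sym : ∀ u v → dev u v ≡ dev v u
    dev-sym u v = cong₂ _-_ (χ-sym G u v) (Kernel.symm (W A) (Q A u) (Q A v))

    φF-sym : ∀ u v → φF u v ≡ φF v u
    φF-sym u v = cong₂ (test t) (Kernel.symm (W A) (Q A u) (Q A v)) (Kernel.symm F (P u) (P v))

    f₁ f₂ : Fin n → Fin n → ℚ
    f₁ u v = dev u v * (φF u v * (𝟙 (a u) * 𝟙 (b v)))
    f₂ u v = dev u v * (φF u v * (𝟙 (a v) * 𝟙 (b u)))

    f₂-f₁ : ΣΣ n f₂ ≡ ΣΣ n f₁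
    f₂-f₁ = trans (ΣΣ-swap n f₂) (ΣΣ-cong n (λ u v → cong₂ (λ x y → x * (y * (𝟙 (a u) * 𝟙 (b v)))) (dev-sym v u) (φF-sym v u)))

    dev-h : ΣΣ n (λ u v → dev u v * h u v) ≡ corr A t a b
    dev-h = trans (ΣΣ-cong n (λ u v → l₁ (dev u v) (φF u v) (𝟙 (a u)) (𝟙 (b v)) (𝟙 (a v)) (𝟙 (b u))))
      (trans (ΣΣ-*ˡ n ½ (λ u v → f₁ u v + f₂ u v)) (trans (cong (½ *_) (trans (ΣΣ-+ n f₁ f₂) (cong (λ z → ΣΣ n f₁ + z) f₂-f₁)))
        (l₂ (ΣΣ n f₁))))
      where
      l₁ : ∀ d f a b a′ b′ → d * (½ * (f * (a * b + a′ * b′))) ≡ ½ * (d * (f * (a * b)) + d * (f * (a′ * b′)))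
      l₁ = solve-∀ ring
      l₂ : ∀ c → ½ * (c + c) ≡ c
      l₂ = solve-∀ ring

    h² : ∀ u v → h u v * h u v ≤ 1ℚ
    h² u v = ≤-trans (≤-reflexive (l (φF u v) (𝟙 (a u) * 𝟙 (b v) + 𝟙 (a v) * 𝟙 (b u))))
      (≤-mul (0≤² (φF u v)) (test-²≤1 t (Kernel.rng (W A) (Q A u) (Q A v)) (Kernel.rng F (P u) (P v)))
        (0≤² (½ * (𝟙 (a u) * 𝟙 (b v) + 𝟙 (a v) * 𝟙 (b u)))) (unit-² hu))
      where
      l : ∀ f s → ½ * (f * s) * (½ * (f * s)) ≡ f * f * (½ * s * (½ * s))
      l = solve-∀ ring
      hu : unit (½ * (𝟙 (a u) * 𝟙 (b v) + 𝟙 (a v) * 𝟙 (b u)))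
      hu = 0≤* 0≤½ (0≤+ (0≤* (0≤𝟙 (a u)) (0≤𝟙 (b v))) (0≤* (0≤𝟙 (a v)) (0≤𝟙 (b u))))
         , ≤-mulˡ ½ 0≤½ (ℚₚ.+-mono-≤ (≤-mul (0≤𝟙 (a u)) (𝟙≤1 (a u)) (0≤𝟙 (b v)) (𝟙≤1 (b v))) (≤-mul (0≤𝟙 (a v)) (𝟙≤1 (a v)) (0≤𝟙 (b u)) (𝟙≤1 (b u))))

    C : ℚ
    C = corr A t a b

    E-refine : E refine ≤ E A + τ * τ * N² + - (2ℚ * τ * C)
    E-refine = ≤-trans (ΣΣ-mono n (λ u v → ≤-trans
        (≤-reflexive (cong (λ z → (χ G u v - z) * (χ G u v - z)) (w-refine u v)))
        (clamp-closer (w A u v + τ * h u v) (χ-unit G u v))))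
      (≤-trans (≤-reflexive (trans (ΣΣ-cong n (λ u v → l (χ G u v) (w A u v) τ (h u v)))
        (trans (ΣΣ-+ n (λ u v → dev u v * dev u v + τ * τ * (h u v * h u v)) (λ u v → - (2ℚ * τ) * (dev u v * h u v)))
          (cong₂ _+_ (trans (ΣΣ-+ n (λ u v → dev u v * dev u v) (λ u v → τ * τ * (h u v * h u v))) (cong (λ z → E A + z) (ΣΣ-*ˡ n (τ * τ) (λ u v → h u v * h u v))))
          (trans (ΣΣ-*ˡ n (- (2ℚ * τ)) (λ u v → dev u v * h u v)) (cong (- (2ℚ * τ) *_) dev-h))))))
      (by (0≤* (0≤² τ) (≤⇒0≤ (≤-trans (ΣΣ-mono n h²) (≤-reflexive (trans (ΣΣ-const n 1ℚ) (ℚₚ.*-identityˡ N²))))))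
        (l′ (E A) τ N² C (ΣΣ n (λ u v → h u v * h u v)))))
      where
      l : ∀ x w t h → (x - (w + t * h)) * (x - (w + t * h)) ≡ (x - w) * (x - w) + t * t * (h * h) + - (2ℚ * t) * ((x - w) * h)
      l = solve-∀ ring
      l′ : ∀ e t m c h → t * t * (m - h) ≡ e + t * t * m + - (2ℚ * t * c) - (e + t * t * h + - (2ℚ * t) * c)
      l′ = solve-∀ ring

    -- A step of length `τ` along `h` changes the energy by at most τ²Σh² - 2τC. Here Σh² ≤ N² and
    -- the violation says C > τN², so the step length equal to the threshold gains more than τ²N².
    decrement : E refine < E A - τ * τ * N²
    decrement = ℚₚ.≤-<-trans E-refine (ℚₚ.<-≤-trans
      (ℚₚ.+-monoʳ-< (E A + τ * τ * N²) (ℚₚ.neg-antimono-< (ℚₚ.*-monoʳ-<-pos (2ℚ * τ) {{ℚ.positive (0<* (ℚₚ.positive⁻¹ 2ℚ) 0<τ)}} viol)))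
      (≤-reflexive (l (E A) τ N²)))
      where
      l : ∀ e t m → e + t * t * m + - (2ℚ * t * (t * m)) ≡ e - t * t * m
      l = solve-∀ ring

  Passes : Refined P → Set
  Passes A = ∀ t a b → corr A t a b ≤ τ * N²

  Violates : Refined P → Fin 4 → VSet n → VSet n → Set
  Violates A t a b = τ * N² < corr A t a b

  -- An exhaustive search: there are finitely many tests and vertex sets, and rationals can be
  -- compared.
  violation? : ∀ A → (∃ λ t → ∃ λ a → ∃ λ b → Violates A t a b) ⊎ Passes A
  violation? A = conclude (Finₚ.any? (λ t → anySubset? (λ a → anySubset? (λ b → (τ * N²) ℚₚ.<? corr A t (lookup a) (lookup b)))))
    where
    conclude : Dec (∃ λ t → ∃ λ a → ∃ λ b → Violates A t (lookup a) (lookup b)) → _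
    conclude (yes (t , a , b , p)) = inj₁ (t , lookup a , lookup b , p)
    conclude (no ¬p) = inj₂ (λ t a b → ℚₚ.≮⇒≥ (λ lt → ¬p (t , tabulate a , tabulate b ,
      subst (τ * N² <_) (corr-cong A t (λ u → ≡-sym (lookup∘tabulate a u)) (λ u → ≡-sym (lookup∘tabulate b u))) lt)))

  Regularized : ℕ → Refined P → Set
  Regularized f A = ∃ λ A′ → q A′ ℕ.≤ q A ℕ.* 4 ℕ.^ f × E A′ ≤ E A × Passes A′

  -- `f` counts the decrements that the current energy can still pay for; at 0 a further one would
  -- make the energy negative.
  regularize : ∀ f A → E A ≤ ι f * (τ * τ * N²) → Regularized f A
  regularize-by : ∀ f A → E A ≤ ι f * (τ * τ * N²) → (∃ λ t → ∃ λ a → ∃ λ b → Violates A t a b) ⊎ Passes A → Regularized f A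

  regularize f A bound = regularize-by f A bound (violation? A)

  regularize-by f A bound (inj₂ ok) = A , ℕₚ.m≤m*n (q A) (4 ℕ.^ f) {{ℕₚ.m^n≢0 4 f}} , ≤-refl , ok
  regularize-by zero A bound (inj₁ (t , a , b , viol)) = ⊥-elim (≤⇒≯ (0≤energy G (Q A′) (W A′))
    (ℚₚ.<-≤-trans (decrement A t a b viol) (by (0≤+ (≤⇒0≤ bound) (0≤* (0≤² τ) 0≤N²)) (trans (cong (λ z → z * X - E A + X) ι-0) (l (E A) X)))))
    where
    A′ = refine A t a b viol
    X = τ * τ * N²
    l : ∀ e x → 0ℚ * x - e + x ≡ 0ℚ - (e - x)
    l = solve-∀ ring
  regularize-by (suc f) A bound (inj₁ (t , a , b , viol)) = A″
      , ℕₚ.≤-trans size″ (ℕₚ.≤-reflexive (ℕlem (q A) (4 ℕ.^ f)))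
      , ≤-trans E″ (≤-trans (<⇒≤ dec) (by (0≤* (0≤² τ) 0≤N²) (l₂ (E A) X))) , ok
    where
    A′ = refine A t a b viol
    X = τ * τ * N²
    dec : E A′ < E A - X
    dec = decrement A t a b viol
    l₁ : ∀ f e x → (1ℚ + f) * x - e ≡ f * x - (e - x)
    l₁ = solve-∀ ring
    l₂ : ∀ e x → x ≡ e - (e - x)
    l₂ = solve-∀ ring
    ih : Regularized f A′
    ih = regularize f A′ (≤-trans (<⇒≤ dec) (by (≤⇒0≤ bound) (trans (cong (λ z → z * X - E A) (ι-suc f)) (l₁ (ι f) (E A) X))))
    A″ = proj₁ ih
    size″ = proj₁ (proj₂ ih)
    E″ = proj₁ (proj₂ (proj₂ ih))
    ok = proj₂ (proj₂ (proj₂ ih))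
    ℕlem : ∀ q x → q ℕ.* 2 ℕ.* 2 ℕ.* x ≡ q ℕ.* (4 ℕ.* x)
    ℕlem = ℕSolver.solve-∀

-- Editing the graph

lt : ∀ {n} → Fin n → Fin n → Bool
lt u v = toℕ u ℕ.<ᵇ toℕ v

-- Indexed by the Booleans `lt u v` and `lt v u`, so that one case distinction evaluates both
-- triangles of a symmetric construction.
data Order {n} (u v : Fin n) : Bool → Bool → Set where
  below : Order u v true false
  above : Order u v false true
  same  : u ≡ v → Order u v false false

order : ∀ {n} (u v : Fin n) → Order u v (lt u v) (lt v u)
order zero zero = same refl
order zero (suc v) = below
order (suc u) zero = above
order (suc u) (suc v) = lift (order u v)
  where
  lift : ∀ {b b′} → Order u v b b′ → Order (suc u) (suc v) b b′
  lift below = below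
  lift above = above
  lift (same eq) = same (cong suc eq)

lt-irrefl : ∀ {n} (u : Fin n) → lt u u ≡ false
lt-irrefl zero = refl
lt-irrefl (suc u) = lt-irrefl u

half-sum : ∀ n (f : Fin n → Fin n → ℚ) → (∀ u v → f u v ≡ f v u) → (∀ u v → 0ℚ ≤ f u v) →
  2ℚ * ΣΣ n (λ u v → 𝟙 (lt u v) * f u v) ≤ ΣΣ n f
half-sum n f f-sym 0≤f = ≤-trans (≤-reflexive (trans (l (ΣΣ n f₁)) (trans (cong (λ t → ΣΣ n f₁ + t)
    (trans (ΣΣ-swap n f₁) (ΣΣ-cong n (λ u v → cong (𝟙 (lt v u) *_) (f-sym v u))))) (≡-sym (ΣΣ-+ n f₁ f₂)))))
  (ΣΣ-mono n (λ u v → pointwise (f u v) (0≤f u v) (order u v)))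
  where
  f₁ f₂ : Fin n → Fin n → ℚ
  f₁ u v = 𝟙 (lt u v) * f u v
  f₂ u v = 𝟙 (lt v u) * f u v
  l : ∀ x → 2ℚ * x ≡ x + x
  l = solve-∀ ring
  pointwise : ∀ {u v : Fin n} {b b′} x → 0ℚ ≤ x → Order u v b b′ → 𝟙 b * x + 𝟙 b′ * x ≤ x
  pointwise x 0≤x below = ≤-reflexive (l₁ x)
    where
    l₁ : ∀ x → 1ℚ * x + 0ℚ * x ≡ x
    l₁ = solve-∀ ring
  pointwise x 0≤x above = ≤-reflexive (l₁ x)
    where
    l₁ : ∀ x → 0ℚ * x + 1ℚ * x ≡ x
    l₁ = solve-∀ ring
  pointwise x 0≤x (same _) = by 0≤x (l₁ x)
    where
    l₁ : ∀ x → x ≡ x - (0ℚ * x + 0ℚ * x)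
    l₁ = solve-∀ ring

-- The error of a coin that shows 1 with probability `h`. The mask `β` switches an entry off by
-- making both outcomes 0; this confines the rounding to the entries above the diagonal.
bernoulli : ∀ β {h} → unit h → Balanced (𝟙 β * (𝟙 false - h)) (𝟙 β * (𝟙 true - h))
bernoulli true {h} (0≤h , h≤1) = record
  { wx = 1ℚ - h ; wy = h ; 0≤wx = ≤⇒0≤ h≤1 ; 0≤wy = 0≤h ; total = l₁ h ; mean = l₂ h
  ; x²≤1 = ≤-trans (≤-reflexive (l₃ h)) (unit-² (0≤h , h≤1))
  ; y²≤1 = ≤-trans (≤-reflexive (l₄ h)) (unit-² (1-unit (0≤h , h≤1))) }
  where
  l₁ : ∀ h → 1ℚ - h + h ≡ 1ℚ
  l₁ = solve-∀ ring
  l₂ : ∀ h → (1ℚ - h) * (1ℚ * (0ℚ - h)) + h * (1ℚ * (1ℚ - h)) ≡ 0ℚ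
  l₂ = solve-∀ ring
  l₃ : ∀ h → 1ℚ * (0ℚ - h) * (1ℚ * (0ℚ - h)) ≡ h * h
  l₃ = solve-∀ ring
  l₄ : ∀ h → 1ℚ * (1ℚ - h) * (1ℚ * (1ℚ - h)) ≡ (1ℚ - h) * (1ℚ - h)
  l₄ = solve-∀ ring
bernoulli false {h} _ = record
  { wx = 1ℚ ; wy = 0ℚ ; 0≤wx = 0≤1 ; 0≤wy = ≤-refl ; total = refl ; mean = l₂ h
  ; x²≤1 = ≤-trans (≤-reflexive (l₃ h)) 0≤1
  ; y²≤1 = ≤-trans (≤-reflexive (l₄ h)) 0≤1 }
  where
  l₂ : ∀ h → 1ℚ * (0ℚ * (0ℚ - h)) + 0ℚ * (0ℚ * (1ℚ - h)) ≡ 0ℚ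
  l₂ = solve-∀ ring
  l₃ : ∀ h → 0ℚ * (0ℚ - h) * (0ℚ * (0ℚ - h)) ≡ 0ℚ
  l₃ = solve-∀ ring
  l₄ : ∀ h → 0ℚ * (1ℚ - h) * (0ℚ * (1ℚ - h)) ≡ 0ℚ
  l₄ = solve-∀ ring

upper-graph : ∀ {n} → (Fin n → Fin n → Bool) → Graph n
adj (upper-graph z) u v = (lt u v ∧ z u v) ∨ (lt v u ∧ z v u)
sym (upper-graph z) u v = Boolₚ.∨-comm (lt u v ∧ z u v) (lt v u ∧ z v u)
irrefl (upper-graph z) u = cong (λ b → (b ∧ z u u) ∨ (b ∧ z u u)) (lt-irrefl u)

editDist-Σ : ∀ {n} (G H : Graph n) → ι (editDist G H) ≡ ΣΣ n (λ u v → 𝟙 (lt u v ∧ (adj G u v xor adj H u v)))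
editDist-Σ {n} G H = trans (ι-Σ n (λ u → Σℕ n (λ v → if lt u v ∧ (adj G u v xor adj H u v) then 1 else 0)))
  (Σ-cong n (λ u → trans (ι-Σ n (λ v → if lt u v ∧ (adj G u v xor adj H u v) then 1 else 0))
    (Σ-cong n (λ v → ι-if (lt u v ∧ (adj G u v xor adj H u v))))))

Disjoint : ∀ {n} → VSet n → VSet n → Set
Disjoint A B = ∀ u → A u ≡ true → B u ≡ true → ⊥

module Edit {n : ℕ} (1≤n : 1 ℕ.≤ n) (G : Graph n) {p : ℕ} (P : Fin n → Fin p) (F : Kernel p)
  (τ : ℚ) (0<τ : 0ℚ < τ) (A : Refined P) (passes : Decrement.Passes G P F τ 0<τ A)
  (K : ℚ) (1≤K : 1ℚ ≤ K) (τK : τ * K ≡ 1ℚ) (big : (1ℚ + 2ℚ) * (1ℚ + 2ℚ) * (K * K * (K * K)) ≤ ι n)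
  (ε : ℚ) (0<ε : 0ℚ < ε) (6τ≤ε : (2ℚ + 2ℚ + 2ℚ) * τ ≤ ε) where

  open Decrement G P F τ 0<τ using (N²; 0≤N²; w; corr)
  open Refined A

  f : Fin n → Fin n → ℚ
  f = on F P

  wA : Fin n → Fin n → ℚ
  wA = w A

  H : Fin n → Fin n → ℚ
  H u v = f u v + slope (wA u v) (f u v) * (χ G u v - wA u v)

  w-unit : ∀ u v → unit (wA u v)
  w-unit u v = Kernel.rng W (Q u) (Q v)

  f-unit : ∀ u v → unit (f u v)
  f-unit u v = Kernel.rng F (P u) (P v)

  w-sym : ∀ u v → wA u v ≡ wA v u
  w-sym u v = Kernel.symm W (Q u) (Q v)

  f-sym : ∀ u v → f u v ≡ f v u
  f-sym u v = Kernel.symm F (P u) (P v)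

  H-unit : ∀ u v → unit (H u v)
  H-unit u v = proj₁ (transport-unit (χ-unit G u v) (w-unit u v) (f-unit u v))

  H-sym : ∀ u v → H u v ≡ H v u
  H-sym u v = cong₂ (λ x y → x + y) (f-sym u v) (cong₂ _*_ (cong₂ slope (w-sym u v) (f-sym u v)) (cong₂ _-_ (χ-sym G u v) (w-sym u v)))

  -- This is |χ - H|, since the sign is known in advance; written so, it is affine in `χ` on each
  -- cell and can be handled by a correlation test.
  move : Fin n → Fin n → ℚ
  move u v = sgn (wA u v) (f u v) * (χ G u v - H u v)

  move-sym : ∀ u v → move u v ≡ move v u
  move-sym u v = cong₂ _*_ (cong₂ sgn (w-sym u v) (f-sym u v)) (cong₂ _-_ (χ-sym G u v) (H-sym u v))

  0≤move : ∀ u v → 0ℚ ≤ move u v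
  0≤move u v = proj₂ (transport-unit (χ-unit G u v) (w-unit u v) (f-unit u v))

  -- For bits, `x xor y` equals (1 - 2x)(y - x). The number of edits is therefore linear in the
  -- rounded bits, and these are the coefficients whose total the rounding controls.
  cost : Fin n → Fin n → ℚ
  cost u v = 1ℚ - 2ℚ * χ G u v

  sign² : ∀ b → (1ℚ - 2ℚ * 𝟙 b) * (1ℚ - 2ℚ * 𝟙 b) ≡ 1ℚ
  sign² true = refl
  sign² false = refl

  rounded : ∃ λ (z : Fin n → Fin n → Bool) →
    (∀ (a b : Fin n → Bool) → K * ∣ ΣΣ n (λ u v → 𝟙 (a u) * 𝟙 (b v) * (𝟙 (lt u v) * (𝟙 (z u v) - H u v))) ∣ ≤ N²) ×
    K * ΣΣ n (λ u v → cost u v * (𝟙 (lt u v) * (𝟙 (z u v) - H u v))) ≤ N²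
  rounded = rounding n (λ u v b → 𝟙 (lt u v) * (𝟙 b - H u v)) (λ u v → bernoulli (lt u v) (H-unit u v))
    cost (λ u v → ≤-reflexive (sign² (adj G u v))) K 1≤K 1≤n big

  z : Fin n → Fin n → Bool
  z = proj₁ rounded

  dd : Fin n → Fin n → ℚ
  dd u v = 𝟙 (lt u v) * (𝟙 (z u v) - H u v)

  unscale : ∀ {x} → K * x ≤ N² → x ≤ τ * N²
  unscale {x} p = ≤-trans (≤-reflexive (trans (≡-sym (ℚₚ.*-identityˡ x)) (trans (cong (_* x) (≡-sym τK)) (ℚₚ.*-assoc τ K x)))) (≤-mulˡ τ (<⇒≤ 0<τ) p)

  cut-dd : ∀ (a b : VSet n) → ∣ ΣΣ n (λ u v → 𝟙 (a u) * 𝟙 (b v) * dd u v) ∣ ≤ τ * N²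
  cut-dd a b = unscale (proj₁ (proj₂ rounded) a b)

  G′ : Graph n
  G′ = upper-graph z

  sum-move : (2ℚ + 2ℚ) * ΣΣ n (λ u v → 𝟙 (lt u v) * move u v) ≤ 2ℚ * ΣΣ n move
  sum-move = by (0≤* 0≤2 (≤⇒0≤ (half-sum n move move-sym 0≤move))) (l (ΣΣ n (λ u v → 𝟙 (lt u v) * move u v)) (ΣΣ n move))
    where
    l : ∀ x y → 2ℚ * (y - 2ℚ * x) ≡ 2ℚ * y - (2ℚ + 2ℚ) * x
    l = solve-∀ ring

  drift : Fin n → Fin n → ℚ
  drift u v = sgn (wA u v) (f u v) * (wA u v - f u v)

  all : VSet n
  all _ = true

  -- `χ - H` is the sum of (1 - slope)(χ - w), which the third test controls once multiplied by the
  -- sign, and of the shift `w - f` between the step functions.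
  move-split : ΣΣ n move ≡ corr A (suc (suc zero)) all all + ΣΣ n drift
  move-split = trans (ΣΣ-cong n (λ u v → l (χ G u v) (wA u v) (f u v) (slope (wA u v) (f u v)) (sgn (wA u v) (f u v))))
    (ΣΣ-+ n (λ u v → (χ G u v - wA u v) * (sgn (wA u v) (f u v) * (1ℚ - slope (wA u v) (f u v)) * (1ℚ * 1ℚ))) drift)
    where
    l : ∀ x w c b s → s * (x - (c + b * (x - w))) ≡ (x - w) * (s * (1ℚ - b) * (1ℚ * 1ℚ)) + s * (w - c)
    l = solve-∀ ring

  sq : Fin n → Fin n → ℚ
  sq u v = (wA u v - f u v) * (wA u v - f u v)

  -- The passage from L² to L¹: 2εsx ≤ x² + ε² for a sign s. Summed, the right-hand side is at most
  -- (2 + 1)ε²N².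
  drift-bound : ΣΣ n sq ≤ 2ℚ * (ε * ε) * N² → 2ℚ * ΣΣ n drift ≤ (1ℚ + 2ℚ) * ε * N²
  drift-bound close = ≤-cancelˡ ε 0<ε (≤-trans (≤-reflexive (trans (l₁ ε (ΣΣ n drift)) (≡-sym (ΣΣ-*ˡ n (2ℚ * ε) drift))))
    (≤-trans (ΣΣ-mono n (λ u v → amgm (sgn (wA u v) (f u v)) (wA u v - f u v) (sgn-² (wA u v) (f u v))))
    (≤-trans (≤-reflexive (trans (ΣΣ-+ n sq (λ _ _ → ε * ε)) (cong (λ t → ΣΣ n sq + t) (ΣΣ-const n (ε * ε)))))
    (by (≤⇒0≤ close) (l₂ (ΣΣ n sq) ε N²)))))
    where
    l₁ : ∀ e x → e * (2ℚ * x) ≡ 2ℚ * e * x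
    l₁ = solve-∀ ring
    l₂ : ∀ s e m → 2ℚ * (e * e) * m - s ≡ e * ((1ℚ + 2ℚ) * e * m) - (s + e * e * m)
    l₂ = solve-∀ ring
    amgm : ∀ s x → s * s ≡ 1ℚ → 2ℚ * ε * (s * x) ≤ x * x + ε * ε
    amgm s x eq = by (0≤² (s * ε - x)) (trans (l s x ε) (trans (cong (λ t → x * x + t * (ε * ε) - 2ℚ * ε * (s * x)) eq) (l′ s x ε)))
      where
      l : ∀ s x e → (s * e - x) * (s * e - x) ≡ x * x + s * s * (e * e) - 2ℚ * e * (s * x)
      l = solve-∀ ring
      l′ : ∀ s x e → x * x + 1ℚ * (e * e) - 2ℚ * e * (s * x) ≡ x * x + e * e - 2ℚ * e * (s * x)
      l′ = solve-∀ ring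

  edit-entry : ∀ u v → 𝟙 (lt u v ∧ (adj G u v xor adj G′ u v)) ≤ cost u v * dd u v + 𝟙 (lt u v) * move u v
  edit-entry u v = go (order u v)
    where
    x = adj G u v
    key : ∀ x′ → 𝟙 (x xor x′) ≤ (1ℚ - 2ℚ * 𝟙 x) * (𝟙 x′ - H u v) + move u v
    key x′ = ≤-trans (≤-reflexive (trans (xor-eq x x′) (l₁ (𝟙 x) (𝟙 x′) (H u v))))
      -- Both quantities are `χ - H` up to sign, so their squares agree; the one on the right is the
      -- nonnegative one.
      (ℚₚ.+-monoʳ-≤ ((1ℚ - 2ℚ * 𝟙 x) * (𝟙 x′ - H u v)) (≤-sqrt (0≤move u v) (≤-reflexive
        (trans (l₂ (1ℚ - 2ℚ * 𝟙 x) (H u v) (𝟙 x)) (trans (cong (_* ((𝟙 x - H u v) * (𝟙 x - H u v))) (trans (sign² x) (≡-sym (sgn-² (wA u v) (f u v)))))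
          (l₃ (sgn (wA u v) (f u v)) (𝟙 x - H u v)))))))
      where
      xor-eq : ∀ x y → 𝟙 (x xor y) ≡ (1ℚ - 2ℚ * 𝟙 x) * (𝟙 y - 𝟙 x)
      xor-eq true true = refl
      xor-eq true false = refl
      xor-eq false true = refl
      xor-eq false false = refl
      l₁ : ∀ x y h → (1ℚ - 2ℚ * x) * (y - x) ≡ (1ℚ - 2ℚ * x) * (y - h) + (1ℚ - 2ℚ * x) * (h - x)
      l₁ = solve-∀ ring
      l₂ : ∀ c h x → c * (h - x) * (c * (h - x)) ≡ c * c * ((x - h) * (x - h))
      l₂ = solve-∀ ring
      l₃ : ∀ s y → s * s * (y * y) ≡ s * y * (s * y)
      l₃ = solve-∀ ring
    go : ∀ {b b′} → Order u v b b′ → 𝟙 (b ∧ (x xor ((b ∧ z u v) ∨ (b′ ∧ z v u)))) ≤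
      cost u v * (𝟙 b * (𝟙 (z u v) - H u v)) + 𝟙 b * move u v
    go below = ≤-trans (≤-reflexive (cong (λ t → 𝟙 (x xor t)) (Boolₚ.∨-identityʳ (z u v))))
      (≤-trans (key (z u v)) (≤-reflexive (l (cost u v) (𝟙 (z u v) - H u v) (move u v))))
      where
      l : ∀ c y m → c * y + m ≡ c * (1ℚ * y) + 1ℚ * m
      l = solve-∀ ring
    go above = ≤-reflexive (l (cost u v) (𝟙 (z u v) - H u v) (move u v))
      where
      l : ∀ c y m → 0ℚ ≡ c * (0ℚ * y) + 0ℚ * m
      l = solve-∀ ring
    go (same _) = ≤-reflexive (l (cost u v) (𝟙 (z u v) - H u v) (move u v))
      where
      l : ∀ c y m → 0ℚ ≡ c * (0ℚ * y) + 0ℚ * m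
      l = solve-∀ ring

  -- In units of N² the rounding costs τ. The movement sums to τ + (3/2)ε over ordered pairs, hence
  -- to half of that over edges. The total (3/4)ε + (3/2)τ is at most ε because 6τ ≤ ε.
  edit-bound : ΣΣ n sq ≤ 2ℚ * (ε * ε) * N² → ι (editDist G G′) ≤ ε * N²
  edit-bound close = ≤-trans (≤-trans (≤-reflexive (editDist-Σ G G′)) (≤-trans (ΣΣ-mono n edit-entry)
      (≤-reflexive (ΣΣ-+ n (λ u v → cost u v * dd u v) (λ u v → 𝟙 (lt u v) * move u v)))))
    (≤-cancelˡ (2ℚ + 2ℚ) (ℚₚ.positive⁻¹ (2ℚ + 2ℚ)) (by
      (0≤+ (0≤+ (0≤+ (0≤+ (0≤* (0≤+ 0≤2 0≤2) (≤⇒0≤ (unscale (proj₂ (proj₂ rounded))))) (≤⇒0≤ sum-move)) (≤⇒0≤ (≤-mulˡ 2ℚ 0≤2 (≤-reflexive move-split))))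
        (0≤+ (≤⇒0≤ (drift-bound close)) (0≤* 0≤2 (≤⇒0≤ (passes (suc (suc zero)) all all))))) (0≤* 0≤N² (≤⇒0≤ 6τ≤ε)))
      (l (ΣΣ n (λ u v → cost u v * dd u v)) (ΣΣ n (λ u v → 𝟙 (lt u v) * move u v)) (ΣΣ n move) (corr A (suc (suc zero)) all all) (ΣΣ n drift) τ N² ε)))
    where
    l : ∀ S M m c D t N e →
      (2ℚ + 2ℚ) * (t * N - S) + (2ℚ * m - (2ℚ + 2ℚ) * M) + (2ℚ * (c + D) - 2ℚ * m) + (((1ℚ + 2ℚ) * e * N - 2ℚ * D) + 2ℚ * (t * N - c)) + N * (e - (2ℚ + 2ℚ + 2ℚ) * t)
      ≡ (2ℚ + 2ℚ) * (e * N) - (2ℚ + 2ℚ) * (S + M)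
    l = solve-∀ ring

  step-corr : ∀ a b → ∣ corr A zero a b ∣ ≤ τ * N²
  step-corr a b = ∣∣-≤ (passes zero a b) (≤-trans (≤-reflexive (≡-sym neg)) (passes (suc zero) a b))
    where
    neg : corr A (suc zero) a b ≡ - corr A zero a b
    neg = trans (ΣΣ-cong n (λ u v → l (χ G u v - wA u v) (slope (wA u v) (f u v)) (𝟙 (a u) * 𝟙 (b v))))
      (trans (ΣΣ-*ˡ n (- 1ℚ) (λ u v → (χ G u v - wA u v) * (slope (wA u v) (f u v) * (𝟙 (a u) * 𝟙 (b v))))) (l′ (corr A zero a b)))
      where
      l : ∀ x s a → x * (- s * a) ≡ - 1ℚ * (x * (s * a))
      l = solve-∀ ring
      l′ : ∀ x → - 1ℚ * x ≡ - x
      l′ = solve-∀ ring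

  -- Three errors of size τN²: the rounding above the diagonal, its mirror image below, and the
  -- slope test for `H - f`. Disjointness keeps the diagonal out, where `G′` has no edges although
  -- `f` may be positive.
  cut-bound : ∀ a b → Disjoint a b →
    ∣ ι (e G′ a b) - ΣΣ n (λ u v → 𝟙 (a u) * 𝟙 (b v) * f u v) ∣ ≤ (1ℚ + 2ℚ) * τ * N²
  cut-bound a b disj = ≤-trans (≤-reflexive (cong ∣_∣ split)) (≤-trans (ℚₚ.∣p+q∣≤∣p∣+∣q∣ (X + Y) Z)
    (≤-trans (ℚₚ.+-monoˡ-≤ ∣ Z ∣ (ℚₚ.∣p+q∣≤∣p∣+∣q∣ X Y))
    (≤-trans (ℚₚ.+-mono-≤ (ℚₚ.+-mono-≤ (cut-dd a b) (cut-dd b a)) (step-corr a b)) (≤-reflexive (l τ N²)))))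
    where
    l : ∀ t m → t * m + t * m + t * m ≡ (1ℚ + 2ℚ) * t * m
    l = solve-∀ ring
    X = ΣΣ n (λ u v → 𝟙 (a u) * 𝟙 (b v) * dd u v)
    Y = ΣΣ n (λ u v → 𝟙 (b u) * 𝟙 (a v) * dd u v)
    Z = corr A zero a b
    gX gY gZ gF : Fin n → Fin n → ℚ
    gX u v = 𝟙 (a u) * 𝟙 (b v) * dd u v
    gY u v = 𝟙 (b v) * 𝟙 (a u) * dd v u
    gZ u v = (χ G u v - wA u v) * (slope (wA u v) (f u v) * (𝟙 (a u) * 𝟙 (b v)))
    gF u v = 𝟙 (a u) * 𝟙 (b v) * f u v
    pointwise : ∀ u v → 𝟙 (a u) * 𝟙 (b v) * χ G′ u v ≡ gX u v + gY u v + gZ u v + gF u v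
    pointwise u v = trans (go (order u v)) (cong (λ h → 𝟙 (a u) * 𝟙 (b v) * dd u v + 𝟙 (b v) * 𝟙 (a u) * (𝟙 (lt v u) * (𝟙 (z v u) - h))
       + gZ u v + gF u v) (H-sym u v))
      where
      α = 𝟙 (a u)
      β = 𝟙 (b v)
      x = χ G u v
      w₀ = wA u v
      c = f u v
      s = slope (wA u v) (f u v)
      go : ∀ {o o′} → Order u v o o′ → α * β * 𝟙 ((o ∧ z u v) ∨ (o′ ∧ z v u)) ≡
        α * β * (𝟙 o * (𝟙 (z u v) - H u v)) + β * α * (𝟙 o′ * (𝟙 (z v u) - H u v)) + gZ u v + gF u v
      go below = trans (cong (λ t → α * β * 𝟙 t) (Boolₚ.∨-identityʳ (z u v))) (l₁ α β (𝟙 (z u v)) (𝟙 (z v u)) x w₀ c s)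
        where
        l₁ : ∀ a b z z′ x w c s → a * b * z ≡ a * b * (1ℚ * (z - (c + s * (x - w)))) + b * a * (0ℚ * (z′ - (c + s * (x - w))))
          + (x - w) * (s * (a * b)) + a * b * c
        l₁ = solve-∀ ring
      go above = l₁ α β (𝟙 (z u v)) (𝟙 (z v u)) x w₀ c s
        where
        l₁ : ∀ a b z z′ x w c s → a * b * z′ ≡ a * b * (0ℚ * (z - (c + s * (x - w)))) + b * a * (1ℚ * (z′ - (c + s * (x - w))))
          + (x - w) * (s * (a * b)) + a * b * c
        l₁ = solve-∀ ring
      go (same eq) = trans (cong (_* 0ℚ) ab0) (trans (l₁ (𝟙 (z u v)) (𝟙 (z v u)) x w₀ c s (H u v))
        (cong₂ (λ t t′ → t * (0ℚ * (𝟙 (z u v) - H u v)) + t′ * (0ℚ * (𝟙 (z v u) - H u v)) + (x - w₀) * (s * t) + t * c)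
          (≡-sym ab0) (≡-sym (trans (ℚₚ.*-comm β α) ab0))))
        where
        zero-prod : ∀ p q → (p ≡ true → q ≡ true → ⊥) → 𝟙 p * 𝟙 q ≡ 0ℚ
        zero-prod true true h = ⊥-elim (h refl refl)
        zero-prod true false h = refl
        zero-prod false true h = refl
        zero-prod false false h = refl
        ab0 : α * β ≡ 0ℚ
        ab0 = zero-prod (a u) (b v) (λ p q → disj u p (trans (cong b eq) q))
        l₁ : ∀ z z′ x w c s h → 0ℚ * 0ℚ ≡ 0ℚ * (0ℚ * (z - h)) + 0ℚ * (0ℚ * (z′ - h)) + (x - w) * (s * 0ℚ) + 0ℚ * c
        l₁ = solve-∀ ring
    split : ι (e G′ a b) - ΣΣ n gF ≡ X + Y + Z
    split = trans (cong (_- ΣΣ n gF) (trans (e-Σ G′ a b) (trans (ΣΣ-cong n pointwise)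
      (trans (ΣΣ-+ n (λ u v → gX u v + gY u v + gZ u v) gF) (cong (_+ ΣΣ n gF)
      (trans (ΣΣ-+ n (λ u v → gX u v + gY u v) gZ) (cong (_+ Z)
      (trans (ΣΣ-+ n gX gY) (cong (λ t → X + t) (ΣΣ-swap n gY)))))))))) (l′ (X + Y + Z) (ΣΣ n gF))
      where
      l′ : ∀ x y → x + y - y ≡ x
      l′ = solve-∀ ring

-- Equitable partitions

ι-injective : ∀ {m n} → ι m ≡ ι n → m ≡ n
ι-injective eq = ℕₚ.≤-antisym (ι-cancel (≤-reflexive eq)) (ι-cancel (≤-reflexive (≡-sym eq)))

size-cong : ∀ {n} {X Y : VSet n} → (∀ v → X v ≡ Y v) → size X ≡ size Y
size-cong {n} {X} {Y} h = ι-injective (trans (size-ι X) (trans (Σ-cong n (λ v → cong 𝟙 (h v))) (≡-sym (size-ι Y))))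

size-empty : ∀ n → size {n} (λ _ → false) ≡ 0
size-empty n = ι-injective (trans (size-ι {n} (λ _ → false)) (trans (Σ-zero n (λ _ → refl)) (≡-sym ι-0)))

size-full : ∀ n → size {n} (λ _ → true) ≡ n
size-full n = ι-injective (trans (size-ι {n} (λ _ → true)) (trans (Σ-const n 1ℚ) (ℚₚ.*-identityʳ (ι n))))

infixl 6 _∖_
_∖_ : ∀ {n} → VSet n → VSet n → VSet n
(X ∖ Y) v = X v ∧ not (Y v)

size-∖ : ∀ {n} {X Y : VSet n} → Y ⊆ X → size X ≡ size Y ℕ.+ size (X ∖ Y)
size-∖ {n} {X} {Y} Y⊆X = ι-injective (trans (size-ι X) (trans (Σ-cong n (λ v → pointwise (X v) (Y v) (Y⊆X v)))
  (trans (Σ-+ n (λ v → 𝟙 (Y v)) (λ v → 𝟙 ((X ∖ Y) v)))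
  (trans (cong₂ _+_ (≡-sym (size-ι Y)) (≡-sym (size-ι (X ∖ Y)))) (≡-sym (ι-+ (size Y) (size (X ∖ Y))))))))
  where
  pointwise : ∀ x y → (y ≡ true → x ≡ true) → 𝟙 x ≡ 𝟙 y + 𝟙 (x ∧ not y)
  pointwise true true h = refl
  pointwise true false h = refl
  pointwise false true h = case h refl of λ ()
  pointwise false false h = refl

subset-of-size : ∀ {n} (X : VSet n) c → c ℕ.≤ size X → ∃ λ Y → Y ⊆ X × size Y ≡ c
subset-of-size {zero} X c h = X , (λ v p → p) , ≡-sym (ℕₚ.n≤0⇒n≡0 h)
subset-of-size {suc n} X zero h = (λ _ → false) , (λ v ()) , size-empty (suc n)
subset-of-size {suc n} X (suc c) h = go (X zero) refl
  where
  extend : Bool → VSet n → VSet (suc n)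
  extend b Y zero = b
  extend b Y (suc v) = Y v
  go : ∀ b → X zero ≡ b → ∃ λ Y → Y ⊆ X × size Y ≡ suc c
  go true eq with subset-of-size (X ∘ suc) c (ℕₚ.≤-pred (subst (λ b → suc c ℕ.≤ (if b then 1 else 0) ℕ.+ size (X ∘ suc)) eq h))
  ... | Y , Y⊆ , sz = extend true Y , (λ { zero _ → eq ; (suc v) p → Y⊆ v p }) , cong suc sz
  go false eq with subset-of-size (X ∘ suc) (suc c) (subst (λ b → suc c ℕ.≤ (if b then 1 else 0) ℕ.+ size (X ∘ suc)) eq h)
  ... | Y , Y⊆ , sz = extend false Y , (λ { zero () ; (suc v) p → Y⊆ v p }) , sz

-- Only the traces of the parts on `U` are prescribed. Thus parts can be cut off from a shrinking
-- `U` while `P` remains defined on all vertices.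
Fills : ∀ {n p} → VSet n → (Fin p → ℕ) → (Fin n → Fin p) → Set
Fills U caps P = ∀ i → size (U ∩ part P i) ≡ caps i

prepend : ∀ {n p} → VSet n → (Fin n → Fin p) → Fin n → Fin (suc p)
prepend Y P v = if Y v then zero else suc (P v)

prepend-fills : ∀ {n p} (U Y : VSet n) (caps : Fin (suc p) → ℕ) (P : Fin n → Fin p) → Y ⊆ U → size Y ≡ caps zero →
  Fills (U ∖ Y) (caps ∘ suc) P → Fills U caps (prepend Y P)
prepend-fills U Y caps P Y⊆U szY fills zero = trans (size-cong (λ v → pointwise (U v) (Y v) (P v) (Y⊆U v))) szY
  where
  pointwise : ∀ x y {p} (i : Fin p) → (y ≡ true → x ≡ true) → x ∧ ⌊ (if y then zero else suc i) ≟ zero ⌋ ≡ y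
  pointwise true true i h = refl
  pointwise true false i h = refl
  pointwise false true i h = h refl
  pointwise false false i h = refl
prepend-fills U Y caps P Y⊆U szY fills (suc i) = trans (size-cong (λ v → pointwise (U v) (Y v) (P v) i (Y⊆U v))) (fills i)
  where
  pointwise : ∀ x y {p} (j i : Fin p) → (y ≡ true → x ≡ true) → x ∧ ⌊ (if y then zero else suc j) ≟ suc i ⌋ ≡ (x ∧ not y) ∧ ⌊ j ≟ i ⌋
  pointwise true true j i h = refl
  pointwise true false j i h = suc-≟ j i
  pointwise false true j i h = refl
  pointwise false false j i h = refl

one-part : ∀ {n} (U : VSet n) (caps : Fin 1 → ℕ) → size U ≡ Σℕ 1 caps → Fills U caps (λ _ → zero)
one-part U caps eq zero = trans (size-cong {Y = U} (λ v → Boolₚ.∧-identityʳ (U v))) (trans eq (ℕₚ.+-identityʳ (caps zero)))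

remaining : ∀ {n p} (U Y : VSet n) (caps : Fin (suc p) → ℕ) → Y ⊆ U → size Y ≡ caps zero →
  size U ≡ Σℕ (suc p) caps → size (U ∖ Y) ≡ Σℕ p (caps ∘ suc)
remaining U Y caps Y⊆U szY szU = ℕₚ.+-cancelˡ-≡ (caps zero) _ _
  (trans (cong (ℕ._+ size (U ∖ Y)) (≡-sym szY)) (trans (≡-sym (size-∖ {X = U} {Y = Y} Y⊆U)) szU))

fill : ∀ {n} p (caps : Fin (suc p) → ℕ) (U : VSet n) → size U ≡ Σℕ (suc p) caps → ∃ λ P → Fills U caps P
fill zero caps U eq = (λ _ → zero) , one-part U caps eq
fill (suc p) caps U eq = prepend Y (proj₁ rest) , prepend-fills U Y caps (proj₁ rest) (proj₁ (proj₂ Ysub)) (proj₂ (proj₂ Ysub)) (proj₂ rest)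
  where
  Ysub = subset-of-size U (caps zero) (ℕₚ.≤-trans (ℕₚ.m≤m+n (caps zero) _) (ℕₚ.≤-reflexive (≡-sym eq)))
  Y = proj₁ Ysub
  rest = fill p (caps ∘ suc) (U ∖ Y) (remaining U Y caps (proj₁ (proj₂ Ysub)) (proj₂ (proj₂ Ysub)) eq)

impure : ∀ {n p q} → (Fin n → Fin q) → (Fin n → Fin p) → (Fin p → Fin q) → VSet n
impure Q P x u = not ⌊ Q u ≟ x (P u) ⌋

size-mono : ∀ {n} {X Y : VSet n} → X ⊆ Y → size X ℕ.≤ size Y
size-mono {n} {X} {Y} h = ι-cancel (≤-trans (≤-reflexive (size-ι X)) (≤-trans (Σ-mono n (λ v → le (X v) (Y v) (h v))) (≤-reflexive (≡-sym (size-ι Y)))))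
  where
  le : ∀ x y → (x ≡ true → y ≡ true) → 𝟙 x ≤ 𝟙 y
  le true true h = ≤-refl
  le true false h = case h refl of λ ()
  le false y h = 0≤𝟙 y

∩-⊆ˡ : ∀ {n} (X Y : VSet n) → (X ∩ Y) ⊆ X
∩-⊆ˡ X Y v p with X v
... | true = refl

size-by-class : ∀ {n q} (U : VSet n) (Q : Fin n → Fin q) → ι (size U) ≡ Σℚ q (λ y → ι (size (U ∩ part Q y)))
size-by-class {n} {q} U Q = trans (size-ι U) (trans (Σ-cong n (λ v → ≡-sym (trans (Σ-cong q (λ y → trans (𝟙-∧ (U v) ⌊ Q v ≟ y ⌋) (ℚₚ.*-comm (𝟙 (U v)) (𝟙 ⌊ Q v ≟ y ⌋))))
    (Σ-pick q (Q v) (λ _ → 𝟙 (U v))))))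
  (trans (Σ-swap n q (λ v y → 𝟙 ((U ∩ part Q y) v))) (Σ-cong q (λ y → ≡-sym (size-ι (U ∩ part Q y))))))

-- Cut off pure parts as long as some class of Q is large enough; afterwards at most q·M vertices remain.
fill-pure : ∀ {n q} p (caps : Fin (suc p) → ℕ) M → (∀ i → caps i ℕ.≤ M) → (U : VSet n) → size U ≡ Σℕ (suc p) caps →
  (Q : Fin n → Fin q) → Fin q →
  ∃ λ P → Fills U caps P × ∃ λ (x : Fin (suc p) → Fin q) → size (U ∩ impure Q P x) ℕ.≤ q ℕ.* M
fill-pure {n} {suc q-1} zero caps M caps≤M U eq Q y₀ = (λ _ → zero) , one-part U caps eq , (λ _ → y₀) ,
  ℕₚ.≤-trans (size-mono (∩-⊆ˡ U (impure {p = 1} Q (λ _ → zero) (λ _ → y₀))))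
  (ℕₚ.≤-trans (ℕₚ.≤-reflexive (trans eq (ℕₚ.+-identityʳ (caps zero)))) (ℕₚ.≤-trans (caps≤M zero) (ℕₚ.m≤m+n M (q-1 ℕ.* M))))
fill-pure {n} {q} (suc p) caps M caps≤M U eq Q y₀ = go (Finₚ.any? (λ y → caps zero ℕ.≤? size (U ∩ part Q y)))
  where
  Result : Set
  Result = ∃ λ P → Fills U caps P × ∃ λ (x : Fin (suc (suc p)) → Fin q) → size (U ∩ impure Q P x) ℕ.≤ q ℕ.* M
  go : Dec (∃ λ y → caps zero ℕ.≤ size (U ∩ part Q y)) → Result
  -- No class can supply the next part, so the rest is divided arbitrarily; `y₀` is only a default
  -- label for these parts, all of whose vertices may be impure.
  go (no none) = proj₁ filled , proj₂ filled , (λ _ → y₀) ,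
      ℕₚ.≤-trans (size-mono (∩-⊆ˡ U (impure Q (proj₁ filled) (λ _ → y₀)))) small
    where
    filled = fill (suc p) caps U eq
    small : size U ℕ.≤ q ℕ.* M
    small = ι-cancel (≤-trans (≤-reflexive (size-by-class U Q)) (≤-trans
      (Σ-mono q (λ y → ι-mono (ℕₚ.≤-trans (ℕₚ.<⇒≤ (ℕₚ.≰⇒> (λ h → none (y , h)))) (caps≤M zero))))
      (≤-reflexive (trans (Σ-const q (ι M)) (≡-sym (ι-* q M))))))
  go (yes (y , large)) = prepend Y P′ , prepend-fills U Y caps P′ Y⊆U szY fills , x , bad
    where
    Ysub = subset-of-size (U ∩ part Q y) (caps zero) large
    Y = proj₁ Ysub
    Y⊆U : Y ⊆ U
    Y⊆U v p = ∩-⊆ˡ U (part Q y) v (proj₁ (proj₂ Ysub) v p)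
    Y⊆y : ∀ v → Y v ≡ true → ⌊ Q v ≟ y ⌋ ≡ true
    Y⊆y v p with U v | proj₁ (proj₂ Ysub) v p
    ... | true | r = r
    szY = proj₂ (proj₂ Ysub)
    rest = fill-pure p (caps ∘ suc) M (caps≤M ∘ suc) (U ∖ Y) (remaining U Y caps Y⊆U szY eq) Q y₀
    P′ = proj₁ rest
    fills = proj₁ (proj₂ rest)
    x′ = proj₁ (proj₂ (proj₂ rest))
    x : Fin (suc (suc p)) → Fin q
    x zero = y
    x (suc i) = x′ i
    bad : size (U ∩ impure Q (prepend Y P′) x) ℕ.≤ q ℕ.* M
    bad = ℕₚ.≤-trans (ℕₚ.≤-reflexive (size-cong (λ v → pointwise (U v) (Y v) v (Y⊆y v)))) (proj₂ (proj₂ (proj₂ rest)))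
      where
      pointwise : ∀ a b v → (b ≡ true → ⌊ Q v ≟ y ⌋ ≡ true) →
        a ∧ not ⌊ Q v ≟ x (if b then zero else suc (P′ v)) ⌋ ≡ (a ∧ not b) ∧ not ⌊ Q v ≟ x′ (P′ v) ⌋
      pointwise true true v h = cong not (h refl)
      pointwise true false v h = refl
      pointwise false b v h = refl

module _ (n p-1 : ℕ) where

  private
    p = suc p-1
    a = n ℕ./ p
    b = n ℕ.% p

  balanced-caps : Fin p → ℕ
  balanced-caps i = a ℕ.+ (if toℕ i ℕ.<ᵇ b then 1 else 0)

  private
    count-below : ∀ m b → b ℕ.≤ m → Σℕ m (λ i → if toℕ i ℕ.<ᵇ b then 1 else 0) ≡ b
    count-below zero zero h = refl
    count-below (suc m) zero h = count-below m zero ℕ.z≤n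
    count-below (suc m) (suc b) (ℕ.s≤s h) = cong suc (count-below m b h)

    Σℕ-shift : ∀ m c (f : Fin m → ℕ) → Σℕ m (λ i → c ℕ.+ f i) ≡ Σℕ m f ℕ.+ m ℕ.* c
    Σℕ-shift zero c f = refl
    Σℕ-shift (suc m) c f = trans (cong (c ℕ.+ f zero ℕ.+_) (Σℕ-shift m c (f ∘ suc))) (l c (f zero) (Σℕ m (f ∘ suc)) (m ℕ.* c))
      where
      l : ∀ c x s t → c ℕ.+ x ℕ.+ (s ℕ.+ t) ≡ x ℕ.+ s ℕ.+ (c ℕ.+ t)
      l = ℕSolver.solve-∀

    bit≤1 : ∀ c → (if c then 1 else 0) ℕ.≤ 1
    bit≤1 true = ℕₚ.≤-refl
    bit≤1 false = ℕ.z≤n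

  balanced-caps-sum : size {n} (λ _ → true) ≡ Σℕ p balanced-caps
  balanced-caps-sum = trans (size-full n) (trans (ℕDM.m≡m%n+[m/n]*n n p) (≡-sym (trans (Σℕ-shift p a (λ i → if toℕ i ℕ.<ᵇ b then 1 else 0))
    (cong₂ ℕ._+_ (count-below p b (ℕₚ.<⇒≤ (ℕDM.m%n<n n p))) (ℕₚ.*-comm p a)))))

  balanced-caps≤ : ∀ i → balanced-caps i ℕ.≤ a ℕ.+ 1
  balanced-caps≤ i = ℕₚ.+-monoʳ-≤ a (bit≤1 (toℕ i ℕ.<ᵇ b))

  balanced-equitable : (P : Fin n → Fin p) → Fills (λ _ → true) balanced-caps P → Equitable P
  balanced-equitable P fills i j = ℕₚ.≤-trans (ℕₚ.≤-reflexive (fills i)) (ℕₚ.≤-trans (balanced-caps≤ i)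
    (ℕₚ.+-monoˡ-≤ 1 (ℕₚ.≤-trans (ℕₚ.m≤m+n a _) (ℕₚ.≤-reflexive (≡-sym (fills j))))))

equitable-exists : ∀ n p → 1 ℕ.≤ p → ∃ λ (P : Fin n → Fin p) → Equitable P
equitable-exists n (suc p) _ = proj₁ filled , balanced-equitable n p (proj₁ filled) (proj₂ filled)
  where filled = fill p (balanced-caps n p) (λ _ → true) (balanced-caps-sum n p)

-- At most one part's worth of vertices per class of `Q` is impure, and a part has at most n/p + 1 ≤
-- 2n/p vertices since `p ≤ n`.
equitable-pure : ∀ n p q → 1 ℕ.≤ p → p ℕ.≤ n → (Q : Fin n → Fin q) → Fin q →
  ∃ λ (P : Fin n → Fin p) → Equitable P × ∃ λ (x : Fin p → Fin q) → p ℕ.* size (impure Q P x) ℕ.≤ 2 ℕ.* (q ℕ.* n)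
equitable-pure n (suc p-1) q _ p≤n Q y₀ = P , balanced-equitable n p-1 P (proj₁ (proj₂ filled)) , x ,
  ℕₚ.≤-trans (ℕₚ.*-monoʳ-≤ p (proj₂ (proj₂ (proj₂ filled)))) (ℕₚ.≤-trans (ℕₚ.≤-reflexive (l₁ p q a))
    (ℕₚ.≤-trans (ℕₚ.*-monoʳ-≤ q (ℕₚ.+-mono-≤ (ℕDM.m/n*n≤m n p) p≤n)) (ℕₚ.≤-reflexive (l₂ q n))))
  where
  p = suc p-1
  a = n ℕ./ p
  filled = fill-pure p-1 (balanced-caps n p-1) (a ℕ.+ 1) (balanced-caps≤ n p-1) (λ _ → true) (balanced-caps-sum n p-1) Q y₀
  P = proj₁ filled
  x = proj₁ (proj₂ (proj₂ filled))
  l₁ : ∀ p q a → p ℕ.* (q ℕ.* (a ℕ.+ 1)) ≡ q ℕ.* (a ℕ.* p ℕ.+ p)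
  l₁ = ℕSolver.solve-∀
  l₂ : ∀ q n → q ℕ.* (n ℕ.+ n) ≡ 2 ℕ.* (q ℕ.* n)
  l₂ = ℕSolver.solve-∀

equitable-lower : ∀ {n p} (P : Fin n → Fin p) → Equitable P → ∀ i → ι n ≤ ι p * (ι (size (part P i)) + 1ℚ)
equitable-lower {n} {p} P eq i = ≤-trans (≤-reflexive (trans (cong ι (≡-sym (size-full n))) (size-by-class (λ _ → true) P)))
  (≤-trans (Σ-mono p (λ j → ≤-trans (ι-mono (eq j i)) (≤-reflexive (trans (ι-+ (size (part P i)) 1) (cong (λ t → ι (size (part P i)) + t) ι-1)))))
  (≤-reflexive (Σ-const p (ι (size (part P i)) + 1ℚ))))

pull : ∀ {p q} → Kernel q → (Fin p → Fin q) → Kernel p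
Kernel.val (pull W x) i j = Kernel.val W (x i) (x j)
Kernel.symm (pull W x) i j = Kernel.symm W (x i) (x j)
Kernel.rng (pull W x) i j = Kernel.rng W (x i) (x j)

-- The two step functions agree on pairs of pure vertices. Every other pair contributes at most 1,
-- and at most 2n times the number of impure vertices pairs are affected.
energy-pull : ∀ {n p q} (G : Graph n) (Q : Fin n → Fin q) (W : Kernel q) (P : Fin n → Fin p) (x : Fin p → Fin q) →
  energy G P (pull W x) ≤ energy G Q W + 2ℚ * ι n * ι (size (impure Q P x))
energy-pull {n} {p} {q} G Q W P x = ≤-trans (ΣΣ-mono n pointwise) (≤-reflexive
  (trans (ΣΣ-+ n g (λ u v → I u + I v)) (cong (λ t → energy G Q W + t) (trans (ΣΣ-+ n (λ u _ → I u) (λ _ v → I v))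
    (trans (cong₂ _+_ (trans (Σ-cong n (λ u → Σ-const n (I u))) (Σ-*ˡ n (ι n) I)) (Σ-const n (Σℚ n I)))
    (trans (l (ι n) (Σℚ n I)) (cong (2ℚ * ι n *_) (≡-sym (size-ι (impure Q P x))))))))))
  where
  I : Fin n → ℚ
  I u = 𝟙 (impure Q P x u)
  g : Fin n → Fin n → ℚ
  g u v = (χ G u v - on W Q u v) * (χ G u v - on W Q u v)
  l : ∀ n s → n * s + n * s ≡ 2ℚ * n * s
  l = solve-∀ ring
  sq≤1 : ∀ {c w} → unit c → unit w → (c - w) * (c - w) ≤ 1ℚ
  sq≤1 {c} {w} uc uw = test-²≤1 (suc (suc (suc zero))) uw uc
  pointwise : ∀ u v → (χ G u v - on (pull W x) P u v) * (χ G u v - on (pull W x) P u v) ≤ g u v + (I u + I v)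
  pointwise u v = go (Q u ≟ x (P u)) (Q v ≟ x (P v))
    where
    S = (χ G u v - on (pull W x) P u v) * (χ G u v - on (pull W x) P u v)
    S≤1 : S ≤ 1ℚ
    S≤1 = sq≤1 (χ-unit G u v) (Kernel.rng W (x (P u)) (x (P v)))
    0≤g : 0ℚ ≤ g u v
    0≤g = 0≤² (χ G u v - on W Q u v)
    go : (d₁ : Dec (Q u ≡ x (P u))) (d₂ : Dec (Q v ≡ x (P v))) → S ≤ g u v + (𝟙 (not ⌊ d₁ ⌋) + 𝟙 (not ⌊ d₂ ⌋))
    go (yes p₁) (yes p₂) = ≤-reflexive (trans (cong₂ (λ i j → (χ G u v - Kernel.val W i j) * (χ G u v - Kernel.val W i j)) (≡-sym p₁) (≡-sym p₂))
      (≡-sym (l′ (g u v))))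
      where
      l′ : ∀ x → x + (0ℚ + 0ℚ) ≡ x
      l′ = solve-∀ ring
    go (yes p₁) (no p₂) = ≤-trans S≤1 (by 0≤g (l′ (g u v)))
      where
      l′ : ∀ x → x ≡ x + (0ℚ + 1ℚ) - 1ℚ
      l′ = solve-∀ ring
    go (no p₁) (yes p₂) = ≤-trans S≤1 (by 0≤g (l′ (g u v)))
      where
      l′ : ∀ x → x ≡ x + (1ℚ + 0ℚ) - 1ℚ
      l′ = solve-∀ ring
    go (no p₁) (no p₂) = ≤-trans S≤1 (by (0≤+ 0≤g 0≤1) (l′ (g u v)))
      where
      l′ : ∀ x → x + 1ℚ ≡ x + (1ℚ + 1ℚ) - 1ℚ
      l′ = solve-∀ ring

-- Regularity from a step approximation

-- Parts have at least n/(2p) vertices, so A × B has at least γ²n²/(4p²) pairs, and a cut error of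
-- γ³n²/(8p²) shifts a density by at most γ/2. Both densities are therefore within γ/2 of the value
-- `c` of the step function.
step-regular : ∀ {n p} (G : Graph n) (P : Fin n → Fin p) (F : Kernel p) → Equitable P → 1 ℕ.≤ p → 2ℚ * ι p ≤ ι n →
  ∀ γ μ → 0ℚ < γ → γ ≤ 1ℚ → 2ℚ * 2ℚ * 2ℚ * (ι p * ι p) * μ ≤ γ * γ * γ * (ι n * ι n) →
  (∀ a b → Disjoint a b → ∣ ι (e G a b) - ΣΣ n (λ u v → 𝟙 (a u) * 𝟙 (b v) * on F P u v) ∣ ≤ μ) →
  ∀ i j → i ≢ j → RegularPair G γ (part P i) (part P j)
step-regular {n} {p} G P F eq 1≤p 2p≤n γ μ 0<γ γ≤1 small approx i j i≢j A B A⊆ B⊆ hA hB =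
  ≤-trans (≤-reflexive (cong ∣_∣ (l₀ (d G A B) (d G S T) c))) (≤-trans (ℚₚ.∣p-q∣≤∣p∣+∣q∣ (d G A B - c) (d G S T - c))
    (≤-trans (ℚₚ.+-mono-≤ (close A B A⊆ B⊆ (conv A S hA) (conv B T hB)) (close S T (λ _ p → p) (λ _ p → p) (self S) (self T))) (≤-reflexive (l₁ γ))))
  where
  S = part P i
  T = part P j
  c = Kernel.val F i j
  x = ι (size S)
  y = ι (size T)
  l₀ : ∀ a b c → a - b ≡ (a - c) - (b - c)
  l₀ = solve-∀ ring
  l₁ : ∀ g → ½ * g + ½ * g ≡ g
  l₁ = solve-∀ ring
  conv : ∀ (A S : VSet n) → γ * toℚ (size S) ≤ toℚ (size A) → γ * ι (size S) ≤ ι (size A)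
  conv A S h = ≤-trans (≤-reflexive (cong (γ *_) (ι-def (size S)))) (≤-trans h (≤-reflexive (≡-sym (ι-def (size A)))))
  self : ∀ (S : VSet n) → γ * ι (size S) ≤ ι (size S)
  self S = by (0≤* (≤⇒0≤ γ≤1) (0≤ι (size S))) (l γ (ι (size S)))
    where
    l : ∀ g s → (1ℚ - g) * s ≡ s - g * s
    l = solve-∀ ring
  n≤2px : ∀ k → ι n ≤ 2ℚ * ι p * ι (size (part P k))
  n≤2px k = by (0≤+ (0≤+ (≤⇒0≤ (equitable-lower P eq k)) (≤⇒0≤ (equitable-lower P eq k))) (≤⇒0≤ 2p≤n)) (l (ι n) (ι p) (ι (size (part P k))))
    where
    l : ∀ n p s → (p * (s + 1ℚ) - n) + (p * (s + 1ℚ) - n) + (n - 2ℚ * p) ≡ 2ℚ * p * s - n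
    l = solve-∀ ring
  0<p : 0ℚ < ι p
  0<p = 0<ι 1≤p
  0<n : 0ℚ < ι n
  0<n = ℚₚ.<-≤-trans (0<* (ℚₚ.positive⁻¹ 2ℚ) 0<p) 2p≤n
  0<size : ∀ k → 0ℚ < ι (size (part P k))
  0<size k with ℚₚ.<-cmp 0ℚ (ι (size (part P k)))
  ... | tri< r _ _ = r
  ... | tri≈ _ r _ = ⊥-elim (≤⇒≯ (≤-trans (n≤2px k) (≤-reflexive (trans (cong (2ℚ * ι p *_) (≡-sym r)) (ℚₚ.*-zeroʳ (2ℚ * ι p))))) 0<n)
  ... | tri> _ _ r = ⊥-elim (≤⇒≯ (0≤ι (size (part P k))) r)
  2μ≤ : 2ℚ * μ ≤ γ * ((γ * x) * (γ * y))
  2μ≤ = ≤-cancelˡ (2ℚ * 2ℚ * (ι p * ι p)) (0<* (ℚₚ.positive⁻¹ (2ℚ * 2ℚ)) (0<* 0<p 0<p))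
    (≤-trans (≤-reflexive (l₂ (ι p) μ)) (≤-trans small (≤-trans (≤-mulˡ (γ * γ * γ) (0≤* (0≤² γ) (<⇒≤ 0<γ))
      (≤-mul (0≤ι n) (n≤2px i) (0≤ι n) (n≤2px j))) (≤-reflexive (l₃ γ (ι p) x y)))))
    where
    l₂ : ∀ p m → 2ℚ * 2ℚ * (p * p) * (2ℚ * m) ≡ 2ℚ * 2ℚ * 2ℚ * (p * p) * m
    l₂ = solve-∀ ring
    l₃ : ∀ g p x y → g * g * g * (2ℚ * p * x * (2ℚ * p * y)) ≡ 2ℚ * 2ℚ * (p * p) * (g * (g * x * (g * y)))
    l₃ = solve-∀ ring
  close : ∀ A B → A ⊆ S → B ⊆ T → γ * x ≤ ι (size A) → γ * y ≤ ι (size B) → ∣ d G A B - c ∣ ≤ ½ * γ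
  close A B A⊆ B⊆ hA hB = ∣∣-≤
      (≤-cancelˡ m 0<m (≤-trans (≤-reflexive scaled) (≤-trans (x≤∣x∣ (ι (e G A B) - c * m)) E≤)))
      (≤-cancelˡ m 0<m (≤-trans (≤-reflexive (trans (≡-sym (ℚₚ.neg-distribʳ-* m (d G A B - c))) (cong -_ scaled))) (≤-trans (-x≤∣x∣ (ι (e G A B) - c * m)) E≤)))
    where
    m = ι (size A) * ι (size B)
    0<A : 0ℚ < ι (size A)
    0<A = ℚₚ.<-≤-trans (0<* 0<γ (0<size i)) hA
    0<B : 0ℚ < ι (size B)
    0<B = ℚₚ.<-≤-trans (0<* 0<γ (0<size j)) hB
    0<m : 0ℚ < m
    0<m = 0<* 0<A 0<B
    scaled : m * (d G A B - c) ≡ ι (e G A B) - c * m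
    scaled = trans (cong (λ t → m * (t - c)) (cong₂ (λ s t → s * inv t) (≡-sym (ι-def (e G A B))) (trans (≡-sym (ι-def (size A ℕ.* size B))) (ι-* (size A) (size B)))))
      (trans (l m (ι (e G A B)) (inv m) c) (trans (cong (λ t → ι (e G A B) * t - c * m) (inv-pos 0<m)) (l′ (ι (e G A B)) (c * m))))
      where
      l : ∀ m e i c → m * (e * i - c) ≡ e * (m * i) - c * m
      l = solve-∀ ring
      l′ : ∀ e x → e * 1ℚ - x ≡ e - x
      l′ = solve-∀ ring
    constant : ΣΣ n (λ u v → 𝟙 (A u) * 𝟙 (B v) * on F P u v) ≡ c * m
    constant = trans (ΣΣ-cong n (λ u v → pw (A u) (B v) u v (A⊆ u) (B⊆ v))) (trans (ΣΣ-*ˡ n c (λ u v → 𝟙 (A u) * 𝟙 (B v)))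
      (cong (c *_) (trans (ΣΣ-prod n (λ u → 𝟙 (A u)) (λ v → 𝟙 (B v))) (cong₂ _*_ (≡-sym (size-ι A)) (≡-sym (size-ι B))))))
      where
      pw : ∀ a b u v → (a ≡ true → S u ≡ true) → (b ≡ true → T v ≡ true) → 𝟙 a * 𝟙 b * on F P u v ≡ c * (𝟙 a * 𝟙 b)
      pw true true u v h k = trans (cong₂ (λ s t → 1ℚ * 1ℚ * Kernel.val F s t) (⌊≟⌋-true (h refl)) (⌊≟⌋-true (k refl))) (ℚₚ.*-comm (1ℚ * 1ℚ) c)
      pw true false u v h k = trans (ℚₚ.*-zeroˡ (on F P u v)) (≡-sym (ℚₚ.*-zeroʳ c))
      pw false true u v h k = trans (ℚₚ.*-zeroˡ (on F P u v)) (≡-sym (ℚₚ.*-zeroʳ c))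
      pw false false u v h k = trans (ℚₚ.*-zeroˡ (on F P u v)) (≡-sym (ℚₚ.*-zeroʳ c))
    disjoint : Disjoint A B
    disjoint u p q = i≢j (trans (≡-sym (⌊≟⌋-true (A⊆ u p))) (⌊≟⌋-true (B⊆ u q)))
    E≤ : ∣ ι (e G A B) - c * m ∣ ≤ m * (½ * γ)
    E≤ = ≤-trans (≤-trans (≤-reflexive (cong (λ t → ∣ ι (e G A B) - t ∣) (≡-sym constant))) (approx A B disjoint))
      (≤-cancelˡ 2ℚ (ℚₚ.positive⁻¹ 2ℚ) (≤-trans 2μ≤ (≤-trans (≤-mulˡ γ (<⇒≤ 0<γ)
        (≤-mul (0≤* (<⇒≤ 0<γ) (0≤ι (size S))) hA (0≤* (<⇒≤ 0<γ) (0≤ι (size T))) hB)) (≤-reflexive (l γ m)))))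
      where
      l : ∀ g m → g * m ≡ 2ℚ * (m * (½ * g))
      l = solve-∀ ring

-- Lower bounds for weak regularity

-- The number of neighbours in `B` that the step function predicts for a vertex of part `i`.
profile : ∀ {n k} → Graph n → (Fin n → Fin k) → VSet n → Fin k → ℚ
profile {n} {k} G P B i = Σℚ k (λ j → d G (part P i) (part P j) * ι (size (B ∩ part P j)))

-- The prediction depends on a vertex of `A` only through its part; both lower bounds for `k` rest
-- on this.
weak-profile : ∀ {n k} (G : Graph n) (P : Fin n → Fin k) α → WeakRegular G P α → ∀ A B →
  ∣ ι (e G A B) - Σℚ n (λ u → 𝟙 (A u) * profile G P B (P u)) ∣ ≤ α * (ι n * ι n)
weak-profile {n} {k} G P α wr A B = ≤-trans (≤-reflexive (cong₂ (λ s t → ∣ s - t ∣) (ι-def (e G A B)) (≡-sym sum-eq)))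
  (≤-trans (wr A B) (≤-reflexive (cong (α *_) (trans (≡-sym (ι-def (n ℕ.* n))) (ι-* n n)))))
  where
  f = profile G P B
  row : ∀ i → Σℚ k (λ j → d G (part P i) (part P j) * toℚ (size (A ∩ part P i)) * toℚ (size (B ∩ part P j)))
    ≡ Σℚ n (λ u → 𝟙 ⌊ P u ≟ i ⌋ * (𝟙 (A u) * f i))
  row i = trans (Σ-cong k (λ j → trans (cong₂ (λ s t → d G (part P i) (part P j) * s * t) (≡-sym (ι-def (size (A ∩ part P i)))) (≡-sym (ι-def (size (B ∩ part P j)))))
      (l (d G (part P i) (part P j)) (ι (size (A ∩ part P i))) (ι (size (B ∩ part P j))))))
    (trans (Σ-*ˡ k (ι (size (A ∩ part P i))) (λ j → d G (part P i) (part P j) * ι (size (B ∩ part P j))))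
    (trans (ℚₚ.*-comm (ι (size (A ∩ part P i))) (f i)) (trans (cong (f i *_) (size-ι (A ∩ part P i)))
    (trans (≡-sym (Σ-*ˡ n (f i) (λ u → 𝟙 ((A ∩ part P i) u)))) (Σ-cong n (λ u → trans (cong (f i *_) (𝟙-∧ (A u) ⌊ P u ≟ i ⌋)) (l′ (f i) (𝟙 (A u)) (𝟙 ⌊ P u ≟ i ⌋))))))))
    where
    l : ∀ d s t → d * s * t ≡ s * (d * t)
    l = solve-∀ ring
    l′ : ∀ f a b → f * (a * b) ≡ b * (a * f)
    l′ = solve-∀ ring
  sum-eq : Σℚ k (λ i → Σℚ k (λ j → d G (part P i) (part P j) * toℚ (size (A ∩ part P i)) * toℚ (size (B ∩ part P j))))
    ≡ Σℚ n (λ u → 𝟙 (A u) * f (P u))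
  sum-eq = trans (Σ-cong k row) (trans (Σ-swap k n (λ i u → 𝟙 ⌊ P u ≟ i ⌋ * (𝟙 (A u) * f i)))
    (Σ-cong n (λ u → Σ-pick k (P u) (λ i → 𝟙 (A u) * f i))))

≟-comm : ∀ {n} (u v : Fin n) → ⌊ u ≟ v ⌋ ≡ ⌊ v ≟ u ⌋
≟-comm u v with u ≟ v | v ≟ u
... | yes _ | yes _ = refl
... | yes p | no q = ⊥-elim (q (≡-sym p))
... | no p | yes q = ⊥-elim (p (≡-sym q))
... | no _ | no _ = refl

complete : ∀ n → Graph n
adj (complete n) u v = not ⌊ u ≟ v ⌋
sym (complete n) u v = cong not (≟-comm u v)
irrefl (complete n) u = cong not (⌊≟⌋-refl u)

point : ∀ {n} → Fin n → VSet n
point u v = ⌊ u ≟ v ⌋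

e-point : ∀ {n} (G : Graph n) u v → ι (e G (point u) (point v)) ≡ χ G u v
e-point {n} G u v = trans (e-Σ G (point u) (point v)) (trans
  (Σ-cong n (λ x → trans (Σ-cong n (λ y → ℚₚ.*-assoc (𝟙 ⌊ u ≟ x ⌋) (𝟙 ⌊ v ≟ y ⌋) (χ G x y)))
    (trans (Σ-*ˡ n (𝟙 ⌊ u ≟ x ⌋) (λ y → 𝟙 ⌊ v ≟ y ⌋ * χ G x y)) (cong (𝟙 ⌊ u ≟ x ⌋ *_) (Σ-pick n v (χ G x))))))
  (Σ-pick n u (λ x → χ G x v)))

-- Two vertices of a complete graph in the same part cannot be told apart by the step function.
complete-bound : ∀ (k : ℚ → ℕ) → FKBound k → ∀ α → 0ℚ < α → ∀ m → 2ℚ * (α * (ι m * ι m)) < 1ℚ → m ℕ.≤ k α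
complete-bound k fk α 0<α m small = ℕₚ.≤-trans (ℕₚ.≮⇒≥ (λ m′<m → collide (Finₚ.pigeonhole m′<m P))) (proj₁ (proj₂ reg))
  where
  G = complete m
  reg = fk α 0<α m G
  P : Fin m → Fin (proj₁ reg)
  P = proj₁ (proj₂ (proj₂ reg))
  wr : WeakRegular G P α
  wr = proj₂ (proj₂ (proj₂ (proj₂ reg)))
  collide : (∃ λ u → ∃ λ v → u Fin.< v × P u ≡ P v) → ⊥
  collide (u , v , u<v , Pu≡Pv) = ≤⇒≯ large small
    where
    -- The common prediction for the pairs `(u , v)` and `(v , v)`, whose true values are 1 and 0:
    -- the two errors add up to at least 1.
    s = profile G P (point v) (P u)
    S : ∀ w → Σℚ m (λ x → 𝟙 ⌊ w ≟ x ⌋ * profile G P (point v) (P x)) ≡ profile G P (point v) (P w)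
    S w = Σ-pick m w (λ x → profile G P (point v) (P x))
    uv : χ G u v ≡ 1ℚ
    uv with u ≟ v
    ... | no _ = refl
    ... | yes eq = ⊥-elim (Finₚ.<-irrefl eq u<v)
    vv : χ G v v ≡ 0ℚ
    vv = cong 𝟙 (irrefl G v)
    one : 1ℚ - s ≤ α * (ι m * ι m)
    one = ≤-trans (≤-trans (≤-reflexive (cong₂ _-_ (≡-sym (trans (e-point G u v) uv)) (≡-sym (S u))))
      (x≤∣x∣ (ι (e G (point u) (point v)) - Σℚ m (λ x → 𝟙 ⌊ u ≟ x ⌋ * profile G P (point v) (P x))))) (weak-profile G P α wr (point u) (point v))
    none : - (0ℚ - s) ≤ α * (ι m * ι m)
    none = ≤-trans (≤-trans (≤-reflexive (cong -_ (cong₂ _-_ (≡-sym (trans (e-point G v v) vv)) (≡-sym (trans (S v) (cong (profile G P (point v)) (≡-sym Pu≡Pv)))))))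
      (-x≤∣x∣ (ι (e G (point v) (point v)) - Σℚ m (λ x → 𝟙 ⌊ v ≟ x ⌋ * profile G P (point v) (P x))))) (weak-profile G P α wr (point v) (point v))
    l : ∀ s x → x - (1ℚ - s) + (x - - (0ℚ - s)) ≡ 2ℚ * x - 1ℚ
    l = solve-∀ ring
    large : 1ℚ ≤ 2ℚ * (α * (ι m * ι m))
    large = by (0≤+ (≤⇒0≤ one) (≤⇒0≤ none)) (l s (α * (ι m * ι m)))

Σ-combine : ∀ m k (f : Fin (m ℕ.* k) → ℚ) → Σℚ (m ℕ.* k) f ≡ Σℚ m (λ i → Σℚ k (λ j → f (Fin.combine i j)))
Σ-combine zero k f = refl
Σ-combine (suc m) k f = trans (split k (m ℕ.* k) f) (cong (λ t → Σℚ k (λ j → f (j Fin.↑ˡ (m ℕ.* k))) + t) (Σ-combine m k (f ∘ (k Fin.↑ʳ_))))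
  where
  split : ∀ a b (f : Fin (a ℕ.+ b) → ℚ) → Σℚ (a ℕ.+ b) f ≡ Σℚ a (λ i → f (i Fin.↑ˡ b)) + Σℚ b (λ j → f (a Fin.↑ʳ j))
  split zero b f = ≡-sym (ℚₚ.+-identityˡ (Σℚ b f))
  split (suc a) b f = trans (cong (λ t → f zero + t) (split a b (f ∘ suc))) (≡-sym (ℚₚ.+-assoc (f zero) (Σℚ a (λ i → f (suc (i Fin.↑ˡ b)))) (Σℚ b (λ j → f (suc (a Fin.↑ʳ j))))))

Σ-term : ∀ n (f : Fin n → ℚ) → (∀ i → 0ℚ ≤ f i) → ∀ i → f i ≤ Σℚ n f
Σ-term (suc n) f 0≤f zero = by (Σ-nonneg n (0≤f ∘ suc)) (l (f zero) (Σℚ n (f ∘ suc)))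
  where
  l : ∀ x y → y ≡ x + y - x
  l = solve-∀ ring
Σ-term (suc n) f 0≤f (suc i) = ≤-trans (Σ-term n (f ∘ suc) (0≤f ∘ suc) i) (by (0≤f zero) (l (f zero) (Σℚ n (f ∘ suc))))
  where
  l : ∀ x y → x ≡ x + y - y
  l = solve-∀ ring

funToFin-cong : ∀ {m n} (f g : Fin m → Fin n) → (∀ i → f i ≡ g i) → Fin.funToFin f ≡ Fin.funToFin g
funToFin-cong {zero} f g h = refl
funToFin-cong {suc m} f g h = cong₂ Fin.combine (h zero) (funToFin-cong (f ∘ suc) (g ∘ suc) (h ∘ suc))

bit-unbit : ∀ i → bit (unbit i) ≡ i
bit-unbit zero = refl
bit-unbit (suc zero) = refl

abstract
  leq : ℚ → ℚ → Bool
  leq x y = ⌊ x ℚₚ.≤? y ⌋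

  leq-true : ∀ x y → leq x y ≡ true → x ≤ y
  leq-true x y h with x ℚₚ.≤? y
  ... | yes p = p
  leq-true x y () | no _

  leq-false : ∀ x y → leq x y ≡ false → y ≤ x
  leq-false x y h with x ℚₚ.≤? y
  ... | no p = <⇒≤ (ℚₚ.≰⇒> p)
  leq-false x y () | yes _

-- The vertices are the pairs (i, x) with i ≤ r and x ∈ {0,1}^r; (0, x) and (j+1, y) are adjacent
-- when bit j of x is 1. A step function with small cut error determines most x from their part.
module Cube (r : ℕ) where

  M N : ℕ
  M = 2 ℕ.^ r
  N = suc r ℕ.* M

  layer : Fin N → Fin (suc r)
  layer u = proj₁ (Fin.remQuot {suc r} M u)

  word : Fin N → Fin M
  word u = proj₂ (Fin.remQuot {suc r} M u)

  letter : Fin M → Fin r → Bool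
  letter x j = unbit (Fin.finToFun {2} {r} x j)

  link : Fin (suc r) → Fin (suc r) → Fin M → Fin M → Bool
  link zero zero x y = false
  link zero (suc j) x y = letter x j
  link (suc i) zero x y = letter y i
  link (suc i) (suc j) x y = false

  cube : Graph N
  adj cube u v = link (layer u) (layer v) (word u) (word v)
  sym cube u v = go (layer u) (layer v) (word u) (word v)
    where
    go : ∀ i j x y → link i j x y ≡ link j i y x
    go zero zero x y = refl
    go zero (suc j) x y = refl
    go (suc i) zero x y = refl
    go (suc i) (suc j) x y = refl
  irrefl cube u = go (layer u) (word u)
    where
    go : ∀ i x → link i i x x ≡ false
    go zero x = refl
    go (suc i) x = refl

  bottom : Fin M → Fin N
  bottom x = Fin.combine {suc r} zero x

  Σ-layer : ∀ i (f : Fin M → Fin N → ℚ) → Σℚ N (λ u → 𝟙 ⌊ i ≟ layer u ⌋ * f (word u) u) ≡ Σℚ M (λ x → f x (Fin.combine i x))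
  Σ-layer i f = trans (Σ-combine (suc r) M (λ u → 𝟙 ⌊ i ≟ layer u ⌋ * f (word u) u)) (trans
    (Σ-cong (suc r) (λ i′ → trans (Σ-cong M (λ x → cong (λ t → 𝟙 ⌊ i ≟ proj₁ t ⌋ * f (proj₂ t) (Fin.combine i′ x)) (Finₚ.remQuot-combine i′ x)))
      (Σ-*ˡ M (𝟙 ⌊ i ≟ i′ ⌋) (λ x → f x (Fin.combine i′ x)))))
    (Σ-pick (suc r) i (λ i′ → Σℚ M (λ x → f x (Fin.combine i′ x)))))

  adjacent-on : ∀ j i i′ x y b → 𝟙 (⌊ zero ≟ i ⌋ ∧ (letter x j ∧ b)) * 𝟙 ⌊ suc j ≟ i′ ⌋ * 𝟙 (link i i′ x y) ≡ 𝟙 (⌊ zero ≟ i ⌋ ∧ (letter x j ∧ b)) * 𝟙 ⌊ suc j ≟ i′ ⌋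
  adjacent-on j (suc i) i′ x y b = trans (cong (_* 𝟙 (link (suc i) i′ x y)) (ℚₚ.*-zeroˡ (𝟙 ⌊ suc j ≟ i′ ⌋))) (trans (ℚₚ.*-zeroˡ (𝟙 (link (suc i) i′ x y))) (≡-sym (ℚₚ.*-zeroˡ (𝟙 ⌊ suc j ≟ i′ ⌋))))
  adjacent-on j zero i′ x y b = on-bottom (letter x j) refl
    where
    on-bottom : ∀ c → letter x j ≡ c → 𝟙 (c ∧ b) * 𝟙 ⌊ suc j ≟ i′ ⌋ * 𝟙 (link zero i′ x y) ≡ 𝟙 (c ∧ b) * 𝟙 ⌊ suc j ≟ i′ ⌋
    on-bottom false eq = trans (cong (_* 𝟙 (link zero i′ x y)) (ℚₚ.*-zeroˡ (𝟙 ⌊ suc j ≟ i′ ⌋))) (trans (ℚₚ.*-zeroˡ (𝟙 (link zero i′ x y))) (≡-sym (ℚₚ.*-zeroˡ (𝟙 ⌊ suc j ≟ i′ ⌋))))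
    on-bottom true eq with suc j ≟ i′
    ... | yes refl = trans (cong (λ t → 𝟙 b * 1ℚ * 𝟙 t) eq) (ℚₚ.*-identityʳ (𝟙 b * 1ℚ))
    ... | no _ = trans (cong (_* 𝟙 (link zero i′ x y)) (ℚₚ.*-zeroʳ (𝟙 b))) (trans (ℚₚ.*-zeroˡ (𝟙 (link zero i′ x y))) (≡-sym (ℚₚ.*-zeroʳ (𝟙 b))))

  adjacent-off : ∀ j i i′ x y b → 𝟙 (⌊ zero ≟ i ⌋ ∧ (not (letter x j) ∧ b)) * 𝟙 ⌊ suc j ≟ i′ ⌋ * 𝟙 (link i i′ x y) ≡ 0ℚ
  adjacent-off j (suc i) i′ x y b = trans (cong (_* 𝟙 (link (suc i) i′ x y)) (ℚₚ.*-zeroˡ (𝟙 ⌊ suc j ≟ i′ ⌋))) (ℚₚ.*-zeroˡ (𝟙 (link (suc i) i′ x y)))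
  adjacent-off j zero i′ x y b = on-bottom (letter x j) refl
    where
    on-bottom : ∀ c → letter x j ≡ c → 𝟙 (not c ∧ b) * 𝟙 ⌊ suc j ≟ i′ ⌋ * 𝟙 (link zero i′ x y) ≡ 0ℚ
    on-bottom true eq = trans (cong (_* 𝟙 (link zero i′ x y)) (ℚₚ.*-zeroˡ (𝟙 ⌊ suc j ≟ i′ ⌋))) (ℚₚ.*-zeroˡ (𝟙 (link zero i′ x y)))
    on-bottom false eq with suc j ≟ i′
    ... | yes refl = trans (cong (λ t → 𝟙 b * 1ℚ * 𝟙 t) eq) (ℚₚ.*-zeroʳ (𝟙 b * 1ℚ))
    ... | no _ = trans (cong (_* 𝟙 (link zero i′ x y)) (ℚₚ.*-zeroʳ (𝟙 b))) (ℚₚ.*-zeroˡ (𝟙 (link zero i′ x y)))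

  module _ {m : ℕ} (P : Fin N → Fin m) (α : ℚ) (wr : WeakRegular cube P α) where

    B : Fin r → VSet N
    B j v = ⌊ suc j ≟ layer v ⌋

    ∣B∣ : ∀ j → Σℚ N (λ v → 𝟙 (B j v)) ≡ ι M
    ∣B∣ j = trans (Σ-cong N (λ v → ≡-sym (ℚₚ.*-identityʳ (𝟙 (B j v))))) (trans (Σ-layer (suc j) (λ _ _ → 1ℚ)) (trans (Σ-const M 1ℚ) (ℚₚ.*-identityʳ (ι M))))

    f : Fin r → Fin m → ℚ
    f j = profile cube P (B j)

    -- A vertex of layer 0 is adjacent to all `M` vertices of layer j+1 or to none of them,
    -- according to its bit `j`; the threshold M/2 decodes this bit, as 0 when `low` holds.
    low : Fin r → Fin m → Bool
    low j a = leq (2ℚ * f j a) (ι M)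

    -- The two kinds of decoding error at bit `j`: a 1 read as 0, and a 0 read as 1.
    A₁ A₀ : Fin r → VSet N
    A₁ j u = ⌊ zero ≟ layer u ⌋ ∧ (letter (word u) j ∧ low j (P u))
    A₀ j u = ⌊ zero ≟ layer u ⌋ ∧ (not (letter (word u) j) ∧ not (low j (P u)))

    ∣A_∣ : VSet N → ℚ
    ∣A A ∣ = Σℚ N (λ u → 𝟙 (A u))

    bound : ℚ
    bound = α * (ι N * ι N)

    e-A₁ : ∀ j → ι (e cube (A₁ j) (B j)) ≡ ∣A A₁ j ∣ * ι M
    e-A₁ j = trans (e-Σ cube (A₁ j) (B j)) (trans (ΣΣ-cong N (λ u v → adjacent-on j (layer u) (layer v) (word u) (word v) (low j (P u))))
      (trans (ΣΣ-prod N (λ u → 𝟙 (A₁ j u)) (λ v → 𝟙 (B j v))) (cong (∣A A₁ j ∣ *_) (∣B∣ j))))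

    e-A₀ : ∀ j → ι (e cube (A₀ j) (B j)) ≡ 0ℚ
    e-A₀ j = trans (e-Σ cube (A₀ j) (B j)) (trans (ΣΣ-cong N (λ u v → adjacent-off j (layer u) (layer v) (word u) (word v) (not (low j (P u)))))
      (trans (ΣΣ-const N 0ℚ) (ℚₚ.*-zeroˡ (ι N * ι N))))

    -- Each vertex of `A₁ j` has `M` neighbours in `B j`, at most half of which are predicted. It
    -- thus adds at least M/2 to the error of this one cut, which weak regularity bounds.
    small-A₁ : ∀ j → ∣A A₁ j ∣ * ι M ≤ 2ℚ * bound
    small-A₁ j = by (0≤+ (0≤* 0≤2 (≤⇒0≤ upper)) (≤⇒0≤ half)) (l (∣A A₁ j ∣ * ι M) S bound)
      where
      S = Σℚ N (λ u → 𝟙 (A₁ j u) * f j (P u))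
      upper : ∣A A₁ j ∣ * ι M - S ≤ bound
      upper = ≤-trans (≤-reflexive (cong (_- S) (≡-sym (e-A₁ j)))) (≤-trans (x≤∣x∣ (ι (e cube (A₁ j) (B j)) - S)) (weak-profile cube P α wr (A₁ j) (B j)))
      pw : ∀ a b u → 𝟙 (a ∧ (b ∧ low j (P u))) * (2ℚ * f j (P u)) ≤ 𝟙 (a ∧ (b ∧ low j (P u))) * ι M
      pw a b u = go (a ∧ (b ∧ low j (P u))) (λ h → leq-true (2ℚ * f j (P u)) (ι M) (∧-right b (low j (P u)) (∧-right a (b ∧ low j (P u)) h)))
        where
        ∧-right : ∀ x y → x ∧ y ≡ true → y ≡ true
        ∧-right true y h = h
        go : ∀ c → (c ≡ true → 2ℚ * f j (P u) ≤ ι M) → 𝟙 c * (2ℚ * f j (P u)) ≤ 𝟙 c * ι M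
        go true h = ≤-mulˡ 1ℚ 0≤1 (h refl)
        go false h = ≤-reflexive (trans (ℚₚ.*-zeroˡ (2ℚ * f j (P u))) (≡-sym (ℚₚ.*-zeroˡ (ι M))))
      half : 2ℚ * S ≤ ∣A A₁ j ∣ * ι M
      half = ≤-trans (≤-reflexive (trans (≡-sym (Σ-*ˡ N 2ℚ (λ u → 𝟙 (A₁ j u) * f j (P u)))) (Σ-cong N (λ u → l₁ (𝟙 (A₁ j u)) (f j (P u))))))
        (≤-trans (Σ-mono N (λ u → pw ⌊ zero ≟ layer u ⌋ (letter (word u) j) u)) (≤-reflexive (trans (Σ-cong N (λ u → ℚₚ.*-comm (𝟙 (A₁ j u)) (ι M)))
          (trans (Σ-*ˡ N (ι M) (λ u → 𝟙 (A₁ j u))) (ℚₚ.*-comm (ι M) ∣A A₁ j ∣)))))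
        where
        l₁ : ∀ a f → 2ℚ * (a * f) ≡ a * (2ℚ * f)
        l₁ = solve-∀ ring
      l : ∀ a s b → 2ℚ * (b - (a - s)) + (a - 2ℚ * s) ≡ 2ℚ * b - a
      l = solve-∀ ring

    small-A₀ : ∀ j → ∣A A₀ j ∣ * ι M ≤ 2ℚ * bound
    small-A₀ j = by (0≤+ (0≤* 0≤2 (≤⇒0≤ upper)) (≤⇒0≤ half)) (l (∣A A₀ j ∣ * ι M) S bound)
      where
      S = Σℚ N (λ u → 𝟙 (A₀ j u) * f j (P u))
      upper : - (0ℚ - S) ≤ bound
      upper = ≤-trans (≤-reflexive (cong (λ t → - (t - S)) (≡-sym (e-A₀ j)))) (≤-trans (-x≤∣x∣ (ι (e cube (A₀ j) (B j)) - S)) (weak-profile cube P α wr (A₀ j) (B j)))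
      not-false : ∀ {b} → not b ≡ true → b ≡ false
      not-false {false} h = refl
      pw : ∀ a b u → 𝟙 (a ∧ (b ∧ not (low j (P u)))) * ι M ≤ 𝟙 (a ∧ (b ∧ not (low j (P u)))) * (2ℚ * f j (P u))
      pw a b u = go (a ∧ (b ∧ not (low j (P u)))) (λ h → leq-false (2ℚ * f j (P u)) (ι M) (not-false (∧-right b (not (low j (P u))) (∧-right a (b ∧ not (low j (P u))) h))))
        where
        ∧-right : ∀ x y → x ∧ y ≡ true → y ≡ true
        ∧-right true y h = h
        go : ∀ c → (c ≡ true → ι M ≤ 2ℚ * f j (P u)) → 𝟙 c * ι M ≤ 𝟙 c * (2ℚ * f j (P u))
        go true h = ≤-mulˡ 1ℚ 0≤1 (h refl)
        go false h = ≤-reflexive (trans (ℚₚ.*-zeroˡ (ι M)) (≡-sym (ℚₚ.*-zeroˡ (2ℚ * f j (P u)))))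
      half : ∣A A₀ j ∣ * ι M ≤ 2ℚ * S
      half = ≤-trans (≤-reflexive (≡-sym (trans (Σ-cong N (λ u → ℚₚ.*-comm (𝟙 (A₀ j u)) (ι M)))
          (trans (Σ-*ˡ N (ι M) (λ u → 𝟙 (A₀ j u))) (ℚₚ.*-comm (ι M) ∣A A₀ j ∣)))))
        (≤-trans (Σ-mono N (λ u → pw ⌊ zero ≟ layer u ⌋ (not (letter (word u) j)) u))
        (≤-reflexive (≡-sym (trans (≡-sym (Σ-*ˡ N 2ℚ (λ u → 𝟙 (A₀ j u) * f j (P u)))) (Σ-cong N (λ u → l₁ (𝟙 (A₀ j u)) (f j (P u))))))))
        where
        l₁ : ∀ a f → 2ℚ * (a * f) ≡ a * (2ℚ * f)
        l₁ = solve-∀ ring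
      l : ∀ a s b → 2ℚ * (b - - (0ℚ - s)) + (2ℚ * s - a) ≡ 2ℚ * b - a
      l = solve-∀ ring

    cls : Fin M → Fin m
    cls x = P (bottom x)

    wrong : Fin M → Fin r → ℚ
    wrong x j = 𝟙 (letter x j ∧ low j (cls x)) + 𝟙 (not (letter x j) ∧ not (low j (cls x)))

    Good : Fin M → Set
    Good x = ∀ j → letter x j ≡ not (low j (cls x))

    good? : ∀ x → Dec (Good x)
    good? x = Finₚ.all? (λ j → letter x j Boolₚ.≟ not (low j (cls x)))

    0≤wrong : ∀ x j → 0ℚ ≤ wrong x j
    0≤wrong x j = 0≤+ (0≤𝟙 (letter x j ∧ low j (cls x))) (0≤𝟙 (not (letter x j) ∧ not (low j (cls x))))

    cover : ∀ x → 1ℚ ≤ Σℚ r (wrong x) + 𝟙 ⌊ good? x ⌋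
    cover x = go (good? x)
      where
      l : ∀ s → s ≡ s + 1ℚ - 1ℚ
      l = solve-∀ ring
      one : ∀ a b → a ≢ not b → 1ℚ ≤ 𝟙 (a ∧ b) + 𝟙 (not a ∧ not b)
      one true true h = ≤-refl
      one true false h = ⊥-elim (h refl)
      one false true h = ⊥-elim (h refl)
      one false false h = ≤-refl
      go : (c : Dec (Good x)) → 1ℚ ≤ Σℚ r (wrong x) + 𝟙 ⌊ c ⌋
      go (yes _) = by (Σ-nonneg r (0≤wrong x)) (l (Σℚ r (wrong x)))
      go (no ¬good) = ≤-trans (one (letter x j) (low j (cls x)) (proj₂ bad)) (≤-trans (Σ-term r (wrong x) (0≤wrong x) j) (≤-reflexive (≡-sym (ℚₚ.+-identityʳ (Σℚ r (wrong x))))))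
        where
        bad = Finₚ.¬∀⟶∃¬ r (λ j → letter x j ≡ not (low j (cls x))) (λ j → letter x j Boolₚ.≟ not (low j (cls x))) ¬good
        j = proj₁ bad

    decode : Fin m → Fin M
    decode a = Fin.funToFin (λ j → bit (not (low j a)))

    good-decode : ∀ x → Good x → decode (cls x) ≡ x
    good-decode x good = trans (funToFin-cong (λ j → bit (not (low j (cls x)))) (Fin.finToFun {2} {r} x) (λ j → trans (cong bit (≡-sym (good j))) (bit-unbit (Fin.finToFun {2} {r} x j))))
      (Finₚ.funToFin-finToFin {r} {2} x)

    -- A good word is decoded from its part alone, so a part contains at most one.
    count-good : Σℚ M (λ x → 𝟙 ⌊ good? x ⌋) ≤ ι m
    count-good = ≤-trans (≤-reflexive (trans (Σ-cong M (λ x → ≡-sym (Σ-pick m (cls x) (λ _ → 𝟙 ⌊ good? x ⌋))))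
        (Σ-swap M m (λ x a → 𝟙 ⌊ cls x ≟ a ⌋ * 𝟙 ⌊ good? x ⌋))))
      (≤-trans (Σ-mono m (λ a → ≤-trans (Σ-mono M (λ x → pw x a (cls x ≟ a) (good? x))) (≤-reflexive (Σ-pick M (decode a) (λ _ → 1ℚ)))))
      (≤-reflexive (trans (Σ-const m 1ℚ) (ℚₚ.*-identityʳ (ι m)))))
      where
      pw : ∀ x a (p : Dec (cls x ≡ a)) (q : Dec (Good x)) → 𝟙 ⌊ p ⌋ * 𝟙 ⌊ q ⌋ ≤ 𝟙 ⌊ decode a ≟ x ⌋ * 1ℚ
      pw x a (no _) q = ≤-trans (≤-reflexive (ℚₚ.*-zeroˡ (𝟙 ⌊ q ⌋))) (0≤* (0≤𝟙 ⌊ decode a ≟ x ⌋) 0≤1)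
      pw x a (yes _) (no _) = ≤-trans (≤-reflexive (ℚₚ.*-zeroʳ 1ℚ)) (0≤* (0≤𝟙 ⌊ decode a ≟ x ⌋) 0≤1)
      pw x a (yes refl) (yes good) = ≤-reflexive (cong (λ b → 𝟙 b * 1ℚ) (≡-sym (trans (cong (λ y → ⌊ y ≟ x ⌋) (good-decode x good)) (⌊≟⌋-refl x))))

    wrong-sum : ∀ j → Σℚ M (λ x → wrong x j) ≡ ∣A A₁ j ∣ + ∣A A₀ j ∣
    wrong-sum j = trans (Σ-+ M (λ x → 𝟙 (letter x j ∧ low j (cls x))) (λ x → 𝟙 (not (letter x j) ∧ not (low j (cls x)))))
      (cong₂ _+_ (≡-sym (trans (Σ-cong N (λ u → 𝟙-∧ ⌊ zero ≟ layer u ⌋ (letter (word u) j ∧ low j (P u)))) (Σ-layer zero (λ x u → 𝟙 (letter x j ∧ low j (P u))))))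
        (≡-sym (trans (Σ-cong N (λ u → 𝟙-∧ ⌊ zero ≟ layer u ⌋ (not (letter (word u) j) ∧ not (low j (P u))))) (Σ-layer zero (λ x u → 𝟙 (not (letter x j) ∧ not (low j (P u))))))))

    -- For each bit at most 4α(r+1)²M words are decoded wrongly. Over all `r` bits this is at most
    -- 4(r+1)³αM ≤ M/2, so at least half of the words are good.
    many-parts : 0ℚ ≤ α → 2ℚ * 2ℚ * 2ℚ * (ι (suc r) * ι (suc r) * ι (suc r)) * α ≤ 1ℚ → 1ℚ * ι M ≤ 2ℚ * ι m
    many-parts 0≤α small = ≤-cancelˡ (ι M) 0<M (≤-trans (≤-reflexive (l₀ (ι M)))
      (by (0≤+ (0≤+ (0≤* 0≤2 (≤⇒0≤ wrongs)) (0≤* (0≤* 0≤2 (0≤ι M)) (≤⇒0≤ (≤-trans covers (ℚₚ.+-monoʳ-≤ W count-good))))) (≤⇒0≤ small′)) (l (ι M) W (ι m) (ι r) bound)))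
      where
      0<M : 0ℚ < ι M
      0<M = 0<ι (ℕₚ.m^n>0 2 r)
      l₀ : ∀ m → m * (1ℚ * m) ≡ m * m
      l₀ = solve-∀ ring
      W = Σℚ M (λ x → Σℚ r (wrong x))
      covers : ι M ≤ W + Σℚ M (λ x → 𝟙 ⌊ good? x ⌋)
      covers = ≤-trans (≤-reflexive (≡-sym (trans (Σ-const M 1ℚ) (ℚₚ.*-identityʳ (ι M))))) (≤-trans (Σ-mono M cover)
        (≤-reflexive (Σ-+ M (λ x → Σℚ r (wrong x)) (λ x → 𝟙 ⌊ good? x ⌋))))
      wrongs : ι M * W ≤ ι r * (2ℚ * bound + 2ℚ * bound)
      wrongs = ≤-trans (≤-reflexive (trans (cong (ι M *_) (trans (Σ-swap M r wrong) (Σ-cong r wrong-sum))) (≡-sym (Σ-*ˡ r (ι M) (λ j → ∣A A₁ j ∣ + ∣A A₀ j ∣)))))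
        (≤-trans (Σ-mono r (λ j → ≤-trans (≤-reflexive (l₁ (ι M) ∣A A₁ j ∣ ∣A A₀ j ∣)) (ℚₚ.+-mono-≤ (small-A₁ j) (small-A₀ j)))) (≤-reflexive (Σ-const r (2ℚ * bound + 2ℚ * bound))))
        where
        l₁ : ∀ m a b → m * (a + b) ≡ a * m + b * m
        l₁ = solve-∀ ring
      small′ : 2ℚ * (ι r * (2ℚ * bound + 2ℚ * bound)) ≤ ι M * ι M
      small′ = ≤-trans (≤-reflexive (cong (λ t → 2ℚ * (ι r * (2ℚ * (α * (t * t)) + 2ℚ * (α * (t * t))))) (ι-* (suc r) M)))
        (by (0≤+ (0≤* (0≤² (ι M)) (≤⇒0≤ small)) (0≤* (0≤* (0≤* (0≤+ 0≤2 (0≤+ 0≤2 (0≤+ 0≤2 0≤2))) (0≤² (ι M))) 0≤α) (0≤* (0≤² (ι (suc r))) (≤⇒0≤ r≤)))) (l₂ (ι M) (ι (suc r)) α (ι r)))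
        where
        r≤ : ι r ≤ ι (suc r)
        r≤ = ι-mono (ℕₚ.n≤1+n r)
        l₂ : ∀ m s a r → m * m * (1ℚ - 2ℚ * 2ℚ * 2ℚ * (s * s * s) * a) + (2ℚ + (2ℚ + (2ℚ + 2ℚ))) * (m * m) * a * (s * s * (s - r))
          ≡ m * m - 2ℚ * (r * (2ℚ * (a * (s * m * (s * m))) + 2ℚ * (a * (s * m * (s * m)))))
        l₂ = solve-∀ ring
      l : ∀ M W m r b → 2ℚ * (r * (2ℚ * b + 2ℚ * b) - M * W) + 2ℚ * M * (W + m - M) + (M * M - 2ℚ * (r * (2ℚ * b + 2ℚ * b))) ≡ M * (2ℚ * m) - M * M
      l = solve-∀ ring

cube-bound : ∀ (k : ℚ → ℕ) → FKBound k → ∀ α → 0ℚ < α → ∀ r →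
  2ℚ * 2ℚ * 2ℚ * (ι (suc r) * ι (suc r) * ι (suc r)) * α ≤ 1ℚ → 2 ℕ.^ r ℕ.≤ 2 ℕ.* k α
cube-bound k fk α 0<α r small = ι-cancel (≤-trans (≤-reflexive (≡-sym (ℚₚ.*-identityˡ (ι (2 ℕ.^ r))))) (≤-trans (Cube.many-parts r P α wr (<⇒≤ 0<α) small)
  (≤-trans (≤-mulˡ 2ℚ 0≤2 (ι-mono (proj₁ (proj₂ reg)))) (≤-reflexive (trans (cong (_* ι (k α)) (≡-sym ι-2)) (≡-sym (ι-* 2 (k α))))))))
  where
  reg = fk α 0<α (Cube.N r) (Cube.cube r)
  P : Fin (Cube.N r) → Fin (proj₁ reg)
  P = proj₁ (proj₂ (proj₂ reg))
  wr : WeakRegular (Cube.cube r) P α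
  wr = proj₂ (proj₂ (proj₂ (proj₂ reg)))

-- Integer cube roots and powers of two

suc≤2^ : ∀ n → suc n ℕ.≤ 2 ℕ.^ n
suc≤2^ zero = ℕₚ.≤-refl
suc≤2^ (suc n) = ℕₚ.≤-trans (ℕₚ.+-mono-≤ (ℕₚ.m^n>0 2 n) (suc≤2^ n)) (ℕₚ.≤-reflexive (cong (2 ℕ.^ n ℕ.+_) (≡-sym (ℕₚ.+-identityʳ (2 ℕ.^ n)))))

cube-root : ∀ T → ∃ λ w → w ℕ.* w ℕ.* w ℕ.≤ T × T ℕ.< suc w ℕ.* suc w ℕ.* suc w
cube-root zero = 0 , ℕ.z≤n , ℕ.s≤s ℕ.z≤n
cube-root (suc T) = go (cube-root T)
  where
  go : (∃ λ w → w ℕ.* w ℕ.* w ℕ.≤ T × T ℕ.< suc w ℕ.* suc w ℕ.* suc w) → ∃ λ w → w ℕ.* w ℕ.* w ℕ.≤ suc T × suc T ℕ.< suc w ℕ.* suc w ℕ.* suc w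
  go (w , lo , hi) = choose-root (suc T ℕ.<? suc w ℕ.* suc w ℕ.* suc w)
    where
    choose-root : Dec (suc T ℕ.< suc w ℕ.* suc w ℕ.* suc w) → ∃ λ w → w ℕ.* w ℕ.* w ℕ.≤ suc T × suc T ℕ.< suc w ℕ.* suc w ℕ.* suc w
    choose-root (yes p) = w , ℕₚ.m≤n⇒m≤1+n lo , p
    choose-root (no p) = suc w , ℕₚ.≮⇒≥ p , ℕₚ.≤-<-trans hi (ℕₚ.*-mono-< (ℕₚ.*-mono-< (ℕₚ.n<1+n (suc w)) (ℕₚ.n<1+n (suc w))) (ℕₚ.n<1+n (suc w)))

2^-+ : ∀ a b → 2 ℕ.^ (a ℕ.+ b) ≡ 2 ℕ.^ a ℕ.* 2 ℕ.^ b
2^-+ = ℕₚ.^-distribˡ-+-* 2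

2^-*≤ : ∀ {x y} a b → x ℕ.≤ 2 ℕ.^ a → y ℕ.≤ 2 ℕ.^ b → x ℕ.* y ℕ.≤ 2 ℕ.^ (a ℕ.+ b)
2^-*≤ a b p q = ℕₚ.≤-trans (ℕₚ.*-mono-≤ p q) (ℕₚ.≤-reflexive (≡-sym (2^-+ a b)))

-- Since suc w ≤ 2^w, the bound reduces to 20 + 36w ≤ w².
poly≤exp : ∀ T w → T ℕ.< suc w ℕ.* suc w ℕ.* suc w → 37 ℕ.≤ w →
  let K = 64 ℕ.* (T ℕ.* T ℕ.* (T ℕ.* T)) in 4 ℕ.* (K ℕ.* K ℕ.* K) ℕ.≤ 2 ℕ.^ (w ℕ.* w)
poly≤exp T w hi 37≤w = ℕₚ.≤-trans (2^-*≤ 2 (k ℕ.+ k ℕ.+ k) ℕₚ.≤-refl (2^-*≤ (k ℕ.+ k) k (2^-*≤ k k K≤ K≤) K≤)) (ℕₚ.^-monoʳ-≤ 2 exponents)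
  where
  K = 64 ℕ.* (T ℕ.* T ℕ.* (T ℕ.* T))
  t = w ℕ.+ w ℕ.+ w
  k = 6 ℕ.+ (t ℕ.+ t ℕ.+ (t ℕ.+ t))
  T≤ : T ℕ.≤ 2 ℕ.^ t
  T≤ = ℕₚ.≤-trans (ℕₚ.<⇒≤ hi) (2^-*≤ (w ℕ.+ w) w (2^-*≤ w w (suc≤2^ w) (suc≤2^ w)) (suc≤2^ w))
  K≤ : K ℕ.≤ 2 ℕ.^ k
  K≤ = 2^-*≤ 6 (t ℕ.+ t ℕ.+ (t ℕ.+ t)) ℕₚ.≤-refl (2^-*≤ (t ℕ.+ t) (t ℕ.+ t) (2^-*≤ t t T≤ T≤) (2^-*≤ t t T≤ T≤))
  exponents : 2 ℕ.+ (k ℕ.+ k ℕ.+ k) ℕ.≤ w ℕ.* w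
  exponents = ℕₚ.≤-trans (ℕₚ.≤-reflexive (l w)) (ℕₚ.≤-trans (ℕₚ.+-monoˡ-≤ (36 ℕ.* w) (ℕₚ.≤-trans (ℕₚ.≤ᵇ⇒≤ 20 37 _) 37≤w)) (ℕₚ.*-monoˡ-≤ w 37≤w))
    where
    l : ∀ w → 2 ℕ.+ ((6 ℕ.+ (w ℕ.+ w ℕ.+ w ℕ.+ (w ℕ.+ w ℕ.+ w) ℕ.+ (w ℕ.+ w ℕ.+ w ℕ.+ (w ℕ.+ w ℕ.+ w)))) ℕ.+ (6 ℕ.+ (w ℕ.+ w ℕ.+ w ℕ.+ (w ℕ.+ w ℕ.+ w) ℕ.+ (w ℕ.+ w ℕ.+ w ℕ.+ (w ℕ.+ w ℕ.+ w)))) ℕ.+ (6 ℕ.+ (w ℕ.+ w ℕ.+ w ℕ.+ (w ℕ.+ w ℕ.+ w) ℕ.+ (w ℕ.+ w ℕ.+ w ℕ.+ (w ℕ.+ w ℕ.+ w))))) ≡ 20 ℕ.+ 36 ℕ.* w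
    l = ℕSolver.solve-∀

-- Growth of the sequence

module Growth (k : ℚ → ℕ) (fk : FKBound k) (ε : ℚ) (0<ε : 0ℚ < ε) (s : ℕ) (1≤s : 1 ℕ.≤ s)
  (g : ℕ → ℚ) (g-rng : ∀ t → 0ℚ < g t × g t < 1ℚ) where

  γ³ : ℕ → ℚ
  γ³ t = g t * g t * g t

  0<γ³ : ∀ t → 0ℚ < γ³ t
  0<γ³ t = 0<* (0<* (proj₁ (g-rng t)) (proj₁ (g-rng t))) (proj₁ (g-rng t))

  γ³<1 : ∀ t → γ³ t < 1ℚ
  γ³<1 t = ℚₚ.≤-<-trans (≤-trans (≤-mul (0≤² γ) (≤-mul 0≤γ γ≤1 0≤γ γ≤1) 0≤γ ≤-refl) (≤-reflexive (l γ))) (proj₂ (g-rng t))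
    where
    γ = g t
    0≤γ : 0ℚ ≤ γ
    0≤γ = <⇒≤ (proj₁ (g-rng t))
    γ≤1 : γ ≤ 1ℚ
    γ≤1 = <⇒≤ (proj₂ (g-rng t))
    l : ∀ x → 1ℚ * 1ℚ * x ≡ x
    l = solve-∀ ring

  abstract
    dl : ℕ → ℚ
    dl t = δ g ε t

    dl-def : ∀ t → dl t ≡ δ g ε t
    dl-def t = refl

    dl≤½ε : ∀ t → dl t ≤ ε * ½
    dl≤½ε t = ℚₚ.p⊓q≤q (γ³ t * inv (toℚ (32 ℕ.* t ℕ.* t))) (ε * ½)

    dl≤γ : ∀ t → dl t ≤ γ³ t * inv (ι (32 ℕ.* t ℕ.* t))
    dl≤γ t = ≤-trans (ℚₚ.p⊓q≤p (γ³ t * inv (toℚ (32 ℕ.* t ℕ.* t))) (ε * ½))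
      (≤-reflexive (cong (λ z → γ³ t * inv z) (≡-sym (ι-def (32 ℕ.* t ℕ.* t)))))

    0<dl : ∀ t → 1 ℕ.≤ t → 0ℚ < dl t
    0<dl t 1≤t = pick (ℚₚ.⊓-sel X (ε * ½))
      where
      X : ℚ
      X = γ³ t * inv (toℚ (32 ℕ.* t ℕ.* t))
      0<32tt : 0ℚ < toℚ (32 ℕ.* t ℕ.* t)
      0<32tt = subst (0ℚ <_) (ι-def (32 ℕ.* t ℕ.* t)) (0<ι (ℕₚ.≤-trans 1≤t (ℕₚ.≤-trans (ℕₚ.m≤m+n t _)
        (ℕₚ.≤-trans (ℕₚ.≤-reflexive (≡-sym (ℕₚ.*-identityʳ (32 ℕ.* t)))) (ℕₚ.*-monoʳ-≤ (32 ℕ.* t) 1≤t)))))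
      pick : X ⊓ (ε * ½) ≡ X ⊎ X ⊓ (ε * ½) ≡ ε * ½ → 0ℚ < X ⊓ (ε * ½)
      pick (inj₁ eq) = subst (0ℚ <_) (≡-sym eq) (0<* (0<γ³ t) (0<inv 0<32tt))
      pick (inj₂ eq) = subst (0ℚ <_) (≡-sym eq) (0<* 0<ε (ℚₚ.positive⁻¹ ½))

    seq : ℕ → ℕ
    seq = tSeq k g ε s

    seq-def : ∀ i → seq i ≡ tSeq k g ε s i
    seq-def i = refl

    seq-zero : seq 0 ≡ s
    seq-zero = refl

    seq-suc : ∀ i → seq (suc i) ≡ seq i ℕ.* k (dl (seq i))
    seq-suc i = refl

  2dl≤ε : ∀ t → 2ℚ * dl t ≤ ε
  2dl≤ε t = ≤-trans (≤-mulˡ 2ℚ 0≤2 (dl≤½ε t)) (≤-reflexive (l ε))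
    where
    l : ∀ e → 2ℚ * (e * ½) ≡ e
    l = solve-∀ ring

  32ℚ : ℚ
  32ℚ = 2ℚ * 2ℚ * 2ℚ * 2ℚ * 2ℚ

  ι-32 : ∀ t → ι (32 ℕ.* t ℕ.* t) ≡ 32ℚ * (ι t * ι t)
  ι-32 t = trans (ι-* (32 ℕ.* t) t) (trans (cong (_* ι t) (trans (ι-* 32 t) (cong (_* ι t) (trans (ι-* 8 4) (cong₂ _*_ ι-8 ι-4)))))
    (ℚₚ.*-assoc 32ℚ (ι t) (ι t)))

  dl-γ : ∀ t → 1 ℕ.≤ t → 32ℚ * (ι t * ι t) * dl t ≤ γ³ t
  dl-γ t 1≤t = ≤-trans (≤-mulˡ (32ℚ * (ι t * ι t)) (<⇒≤ 0<x) (≤-trans (dl≤γ t) (≤-reflexive (cong (λ z → γ³ t * inv z) (ι-32 t)))))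
    (≤-reflexive (trans (l x (γ³ t) (inv x)) (trans (cong (γ³ t *_) (inv-pos 0<x)) (ℚₚ.*-identityʳ (γ³ t)))))
    where
    x = 32ℚ * (ι t * ι t)
    0<x : 0ℚ < x
    0<x = 0<* (ℚₚ.positive⁻¹ 32ℚ) (0<* (0<ι 1≤t) (0<ι 1≤t))
    l : ∀ x g i → x * (g * i) ≡ g * (x * i)
    l = solve-∀ ring

  dl<1 : ∀ t → 1 ℕ.≤ t → 32ℚ * (ι t * ι t) * dl t < 1ℚ
  dl<1 t 1≤t = ℚₚ.≤-<-trans (dl-γ t 1≤t) (γ³<1 t)

  κ : ℕ → ℕ
  κ t = k (dl t)

  -- `complete-bound` with 4t vertices asks for 32t²δ(t) < 1, which the denominator 32t² in δ and
  -- `g` < 1 provide.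
  4t≤κ : ∀ t → 1 ℕ.≤ t → 4 ℕ.* t ℕ.≤ κ t
  4t≤κ t 1≤t = complete-bound k fk (dl t) (0<dl t 1≤t) (4 ℕ.* t)
    (subst (_< 1ℚ) (trans (l (ι t) (dl t)) (cong (λ z → 2ℚ * (dl t * (z * z))) (≡-sym ι-4t))) (dl<1 t 1≤t))
    where
    ι-4t : ι (4 ℕ.* t) ≡ 2ℚ * 2ℚ * ι t
    ι-4t = trans (ι-* 4 t) (cong (_* ι t) ι-4)
    l : ∀ t d → 2ℚ * 2ℚ * 2ℚ * 2ℚ * 2ℚ * (t * t) * d ≡ 2ℚ * (d * (2ℚ * 2ℚ * t * (2ℚ * 2ℚ * t)))
    l = solve-∀ ring

  1≤κ : ∀ t → 1 ℕ.≤ t → 1 ℕ.≤ κ t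
  1≤κ t 1≤t = ℕₚ.≤-trans 1≤t (ℕₚ.≤-trans (ℕₚ.m≤m+n t _) (4t≤κ t 1≤t))

  -- Otherwise `complete-bound` with κ+1 vertices would give κ+1 ≤ κ. It is an upper bound for
  -- 1/δ(t) that does not mention `g`.
  inverse-dl : ∀ t → 1 ℕ.≤ t → 1ℚ ≤ 2ℚ * (dl t * (ι (suc (κ t)) * ι (suc (κ t))))
  inverse-dl t 1≤t = ℚₚ.≮⇒≥ (λ small → ℕₚ.<-irrefl refl (complete-bound k fk (dl t) (0<dl t 1≤t) (suc (κ t)) small))

  -- The hypothesis of `cube-bound` holds because 8(r+1)³δ(t) ≤ 32t²δ(t) < 1.
  cube-growth : ∀ t → 1 ℕ.≤ t → ∀ r → suc r ℕ.* suc r ℕ.* suc r ℕ.≤ 4 ℕ.* (t ℕ.* t) → 2 ℕ.^ r ℕ.≤ 2 ℕ.* κ t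
  cube-growth t 1≤t r small = cube-bound k fk (dl t) (0<dl t 1≤t) r
    (≤-trans (≤-mul (0≤* (0≤* (0≤* 0≤2 0≤2) 0≤2) (0≤* (0≤* 0≤r 0≤r) 0≤r)) (≤-mulˡ (2ℚ * 2ℚ * 2ℚ) (0≤* (0≤* 0≤2 0≤2) 0≤2) cubes) (<⇒≤ (0<dl t 1≤t)) ≤-refl)
      (≤-trans (≤-reflexive (l₂ (ι t) (dl t))) (<⇒≤ (dl<1 t 1≤t))))
    where
    0≤r : 0ℚ ≤ ι (suc r)
    0≤r = 0≤ι (suc r)
    cubes : ι (suc r) * ι (suc r) * ι (suc r) ≤ 2ℚ * 2ℚ * (ι t * ι t)
    cubes = ≤-trans (≤-reflexive (≡-sym (trans (ι-* (suc r ℕ.* suc r) (suc r)) (cong (_* ι (suc r)) (ι-* (suc r) (suc r))))))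
      (≤-trans (ι-mono small) (≤-reflexive (trans (ι-* 4 (t ℕ.* t)) (cong₂ _*_ ι-4 (ι-* t t)))))
    l₂ : ∀ t d → 2ℚ * 2ℚ * 2ℚ * (2ℚ * 2ℚ * (t * t)) * d ≡ 2ℚ * 2ℚ * 2ℚ * 2ℚ * 2ℚ * (t * t) * d
    l₂ = solve-∀ ring

  1≤seq : ∀ i → 1 ℕ.≤ seq i
  1≤seq zero = subst (1 ℕ.≤_) (≡-sym seq-zero) 1≤s
  1≤seq (suc i) = subst (1 ℕ.≤_) (≡-sym (seq-suc i)) (ℕₚ.*-mono-≤ (1≤seq i) (1≤κ (seq i) (1≤seq i)))

  κ≤seq : ∀ i → κ (seq i) ℕ.≤ seq (suc i)
  κ≤seq i = ℕₚ.≤-trans (ℕₚ.≤-reflexive (≡-sym (ℕₚ.*-identityˡ (κ (seq i))))) (ℕₚ.≤-trans (ℕₚ.*-monoˡ-≤ (κ (seq i)) (1≤seq i))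
    (ℕₚ.≤-reflexive (≡-sym (seq-suc i))))

  4sq≤seq : ∀ i → seq i ℕ.* (4 ℕ.* seq i) ℕ.≤ seq (suc i)
  4sq≤seq i = ℕₚ.≤-trans (ℕₚ.*-monoʳ-≤ (seq i) (4t≤κ (seq i) (1≤seq i))) (ℕₚ.≤-reflexive (≡-sym (seq-suc i)))

  seq-step : ∀ i → seq i ℕ.≤ seq (suc i)
  seq-step i = ℕₚ.≤-trans (ℕₚ.m≤m+n (seq i) _) (ℕₚ.≤-trans (4t≤κ (seq i) (1≤seq i)) (κ≤seq i))

  seq-mono : ∀ {i j} → i ℕ.≤ j → seq i ℕ.≤ seq j
  seq-mono {i} {j} i≤j = subst (λ z → seq i ℕ.≤ seq z) (ℕₚ.m+[n∸m]≡n i≤j) (go (j ℕ.∸ i))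
    where
    go : ∀ d → seq i ℕ.≤ seq (i ℕ.+ d)
    go zero = ℕₚ.≤-reflexive (cong seq (≡-sym (ℕₚ.+-identityʳ i)))
    go (suc d) = ℕₚ.≤-trans (go d) (ℕₚ.≤-trans (seq-step (i ℕ.+ d)) (ℕₚ.≤-reflexive (cong seq (≡-sym (ℕₚ.+-suc i d)))))

  -- 50653 is 37³: from here on the cube root of the terms is large enough for `poly≤exp`. This is
  -- why the iteration starts at index 3.
  seq-4 : 50653 ℕ.≤ seq 4
  seq-4 = ℕₚ.≤-trans (ℕₚ.≤ᵇ⇒≤ 50653 (16384 ℕ.* (4 ℕ.* 16384)) _) (next 3 (next 2 {64} (next 1 {4} (next 0 {1} (1≤seq 0)))))
    where
    next : ∀ i {m} → m ℕ.≤ seq i → m ℕ.* (4 ℕ.* m) ℕ.≤ seq (suc i)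
    next i h = ℕₚ.≤-trans (ℕₚ.*-mono-≤ h (ℕₚ.*-monoʳ-≤ 4 h)) (4sq≤seq i)

  -- With T = seq (suc i), complete-bound gives 1/δ ≤ 2(κ+1)² ≤ 8T², so scale i = 64T⁴ is at least 1/δ².
  scale : ℕ → ℕ
  scale i = 64 ℕ.* (seq (suc i) ℕ.* seq (suc i) ℕ.* (seq (suc i) ℕ.* seq (suc i)))

  dl-scale : ∀ i → 1ℚ ≤ dl (seq i) * dl (seq i) * ι (scale i)
  dl-scale i = ≤-trans (≤-mul 0≤1 inverse 0≤1 inverse) (≤-reflexive (trans (l x (ι T)) (cong (x * x *_) (≡-sym ι-scale))))
    where
    t = seq i
    T = seq (suc i)
    x = dl t
    8ℚ : ℚ
    8ℚ = 2ℚ * 2ℚ * 2ℚ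
    κ+1≤ : suc (κ t) ℕ.≤ 2 ℕ.* T
    κ+1≤ = ℕₚ.≤-trans (ℕₚ.+-mono-≤ (1≤seq (suc i)) (κ≤seq i)) (ℕₚ.≤-reflexive (cong (T ℕ.+_) (≡-sym (ℕₚ.+-identityʳ T))))
    κ+1≤ι : ι (suc (κ t)) ≤ 2ℚ * ι T
    κ+1≤ι = ≤-trans (ι-mono κ+1≤) (≤-reflexive (trans (ι-* 2 T) (cong (_* ι T) ι-2)))
    0≤κ+1 : 0ℚ ≤ ι (suc (κ t))
    0≤κ+1 = 0≤ι (suc (κ t))
    inverse : 1ℚ ≤ 8ℚ * (x * (ι T * ι T))
    inverse = ≤-trans (inverse-dl t (1≤seq i)) (≤-trans (≤-mulˡ 2ℚ 0≤2 (≤-mulˡ x (<⇒≤ (0<dl t (1≤seq i))) (≤-mul 0≤κ+1 κ+1≤ι 0≤κ+1 κ+1≤ι)))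
      (≤-reflexive (l′ x (ι T))))
      where
      l′ : ∀ x t → 2ℚ * (x * (2ℚ * t * (2ℚ * t))) ≡ 2ℚ * 2ℚ * 2ℚ * (x * (t * t))
      l′ = solve-∀ ring
    ι-scale : ι (scale i) ≡ 8ℚ * 8ℚ * (ι T * ι T * (ι T * ι T))
    ι-scale = trans (ι-* 64 (T ℕ.* T ℕ.* (T ℕ.* T))) (cong₂ _*_
      (trans (ι-* 8 8) (cong₂ _*_ ι-8 ι-8)) (trans (ι-* (T ℕ.* T) (T ℕ.* T)) (cong₂ _*_ (ι-* T T) (ι-* T T))))
    l : ∀ x t → 2ℚ * 2ℚ * 2ℚ * (x * (t * t)) * (2ℚ * 2ℚ * 2ℚ * (x * (t * t))) ≡ x * x * (2ℚ * 2ℚ * 2ℚ * (2ℚ * 2ℚ * 2ℚ) * (t * t * (t * t)))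
    l = solve-∀ ring

  module _ (i : ℕ) (3≤i : 3 ℕ.≤ i) where

    private
      t = seq i
      T = seq (suc i)
      X = seq (suc (suc i))
      K = scale i

    1≤scale : 1 ℕ.≤ K
    1≤scale = ℕₚ.*-mono-≤ {1} {64} (ℕ.s≤s ℕ.z≤n) (ℕₚ.*-mono-≤ (ℕₚ.*-mono-≤ (1≤seq (suc i)) (1≤seq (suc i))) (ℕₚ.*-mono-≤ (1≤seq (suc i)) (1≤seq (suc i))))

    -- Let w be the integer cube root of T. Then r + 1 = w² satisfies (r+1)³ ≤ T², so 2^(w²) ≤
    -- 4κ(T), and the 4 is absorbed by the factor T in X = T·κ(T).
    4K³≤X : 4 ℕ.* (K ℕ.* K ℕ.* K) ℕ.≤ X
    4K³≤X = go (cube-root T)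
      where
      T-big : 50653 ℕ.≤ T
      T-big = ℕₚ.≤-trans seq-4 (seq-mono (ℕ.s≤s 3≤i))
      go : (∃ λ w → w ℕ.* w ℕ.* w ℕ.≤ T × T ℕ.< suc w ℕ.* suc w ℕ.* suc w) → 4 ℕ.* (K ℕ.* K ℕ.* K) ℕ.≤ X
      go (w , lo , hi) = ℕₚ.≤-trans (poly≤exp T w hi 37≤w) (ℕₚ.≤-trans exp≤ (ℕₚ.≤-trans (ℕₚ.*-monoˡ-≤ (κ T) (ℕₚ.≤-trans (ℕₚ.≤ᵇ⇒≤ 4 50653 _) T-big)) (ℕₚ.≤-reflexive (≡-sym (seq-suc (suc i))))))
        where
        37≤w : 37 ℕ.≤ w
        37≤w = ℕₚ.≮⇒≥ (λ w<37 → ℕₚ.<⇒≱ hi (ℕₚ.≤-trans (ℕₚ.*-mono-≤ (ℕₚ.*-mono-≤ w<37 w<37) w<37) T-big))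
        1≤ww : 1 ℕ.≤ w ℕ.* w
        1≤ww = ℕₚ.*-mono-≤ (ℕₚ.≤-trans (ℕ.s≤s ℕ.z≤n) 37≤w) (ℕₚ.≤-trans (ℕ.s≤s ℕ.z≤n) 37≤w)
        r = ℕ.pred (w ℕ.* w)
        suc-r : suc r ≡ w ℕ.* w
        suc-r = ℕₚ.suc-pred (w ℕ.* w) {{ℕ.>-nonZero 1≤ww}}
        cubes : suc r ℕ.* suc r ℕ.* suc r ℕ.≤ 4 ℕ.* (T ℕ.* T)
        cubes = ℕₚ.≤-trans (ℕₚ.≤-reflexive (trans (cong (λ z → z ℕ.* z ℕ.* z) suc-r) (l w))) (ℕₚ.≤-trans (ℕₚ.*-mono-≤ lo lo) (ℕₚ.m≤m+n (T ℕ.* T) _))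
          where
          l : ∀ w → w ℕ.* w ℕ.* (w ℕ.* w) ℕ.* (w ℕ.* w) ≡ w ℕ.* w ℕ.* w ℕ.* (w ℕ.* w ℕ.* w)
          l = ℕSolver.solve-∀
        exp≤ : 2 ℕ.^ (w ℕ.* w) ℕ.≤ 4 ℕ.* κ T
        exp≤ = ℕₚ.≤-trans (ℕₚ.≤-reflexive (cong (2 ℕ.^_) (≡-sym suc-r))) (ℕₚ.≤-trans (ℕₚ.*-monoʳ-≤ 2 (cube-growth T (1≤seq (suc i)) r cubes))
          (ℕₚ.≤-reflexive (≡-sym (ℕₚ.*-assoc 2 2 (κ T)))))

    -- The number of vertices that the rounding requires, since n is at least this term of the
    -- sequence.
    level-big : 9 ℕ.* (K ℕ.* K ℕ.* (K ℕ.* K)) ℕ.≤ seq (suc (suc (suc i)))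
    level-big = ℕₚ.≤-trans (ℕₚ.*-mono-≤ {9} {64} (ℕₚ.≤ᵇ⇒≤ 9 64 _) (ℕₚ.≤-trans (ℕₚ.≤-reflexive (≡-sym (ℕₚ.*-identityʳ (K ℕ.* K ℕ.* (K ℕ.* K)))))
      (ℕₚ.*-monoʳ-≤ (K ℕ.* K ℕ.* (K ℕ.* K)) (ℕₚ.*-mono-≤ 1≤scale 1≤scale))))
      (ℕₚ.≤-trans (ℕₚ.≤-reflexive (l K)) (ℕₚ.≤-trans (ℕₚ.*-mono-≤ 4K³≤X (ℕₚ.*-monoʳ-≤ 4 4K³≤X)) (4sq≤seq (suc (suc i)))))
      where
      l : ∀ K → 64 ℕ.* (K ℕ.* K ℕ.* (K ℕ.* K) ℕ.* (K ℕ.* K)) ≡ 4 ℕ.* (K ℕ.* K ℕ.* K) ℕ.* (4 ℕ.* (4 ℕ.* (K ℕ.* K ℕ.* K)))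
      l = ℕSolver.solve-∀

    -- A round ends with at most t·4^(K²) classes. With this many parts at the next level,
    -- `equitable-pure` leaves at most n/K impure vertices.
    level-room : 2 ℕ.* K ℕ.* (t ℕ.* 4 ℕ.^ (K ℕ.* K)) ℕ.≤ seq (suc (suc (suc i)))
    level-room = ℕₚ.≤-trans (ℕₚ.≤-reflexive (l K t (4 ℕ.^ (K ℕ.* K)))) (ℕₚ.≤-trans (ℕₚ.*-mono-≤ (ℕₚ.≤-trans (seq-step i) (seq-step (suc i))) κ-big)
      (ℕₚ.≤-reflexive (≡-sym (seq-suc (suc (suc i))))))
      where
      l : ∀ K t x → 2 ℕ.* K ℕ.* (t ℕ.* x) ≡ t ℕ.* (2 ℕ.* K ℕ.* x)
      l = ℕSolver.solve-∀
      -- Chosen as r + 1 because (4K²)³ = 4(4K³)², which is at most 4X².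
      z = 4 ℕ.* (K ℕ.* K)
      1≤z : 1 ℕ.≤ z
      1≤z = ℕₚ.*-mono-≤ {1} {4} (ℕ.s≤s ℕ.z≤n) (ℕₚ.*-mono-≤ 1≤scale 1≤scale)
      r = ℕ.pred z
      suc-r : suc r ≡ z
      suc-r = ℕₚ.suc-pred z {{ℕ.>-nonZero 1≤z}}
      cubes : suc r ℕ.* suc r ℕ.* suc r ℕ.≤ 4 ℕ.* (X ℕ.* X)
      cubes = ℕₚ.≤-trans (ℕₚ.≤-reflexive (trans (cong (λ y → y ℕ.* y ℕ.* y) suc-r) (l′ K))) (ℕₚ.*-monoʳ-≤ 4 (ℕₚ.*-mono-≤ 4K³≤X 4K³≤X))
        where
        l′ : ∀ K → 4 ℕ.* (K ℕ.* K) ℕ.* (4 ℕ.* (K ℕ.* K)) ℕ.* (4 ℕ.* (K ℕ.* K)) ≡ 4 ℕ.* (4 ℕ.* (K ℕ.* K ℕ.* K) ℕ.* (4 ℕ.* (K ℕ.* K ℕ.* K)))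
        l′ = ℕSolver.solve-∀
      64≤K : 64 ℕ.≤ K
      64≤K = ℕₚ.≤-trans (ℕₚ.≤-reflexive (≡-sym (ℕₚ.*-identityʳ 64))) (ℕₚ.*-monoʳ-≤ 64 (ℕₚ.*-mono-≤ (ℕₚ.*-mono-≤ (1≤seq (suc i)) (1≤seq (suc i))) (ℕₚ.*-mono-≤ (1≤seq (suc i)) (1≤seq (suc i)))))
      exponents : 3 ℕ.+ (K ℕ.+ 2 ℕ.* (K ℕ.* K)) ℕ.≤ suc r
      exponents = ℕₚ.≤-trans (ℕₚ.+-mono-≤ (ℕₚ.≤-trans (ℕₚ.≤ᵇ⇒≤ 3 64 _) (ℕₚ.≤-trans 64≤K K≤KK)) (ℕₚ.+-monoˡ-≤ (2 ℕ.* (K ℕ.* K)) K≤KK))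
          (ℕₚ.≤-reflexive (trans (l′ (K ℕ.* K)) (≡-sym suc-r)))
        where
        K≤KK : K ℕ.≤ K ℕ.* K
        K≤KK = ℕₚ.≤-trans (ℕₚ.≤-reflexive (≡-sym (ℕₚ.*-identityʳ K))) (ℕₚ.*-monoʳ-≤ K 1≤scale)
        l′ : ∀ x → x ℕ.+ (x ℕ.+ 2 ℕ.* x) ≡ 4 ℕ.* x
        l′ = ℕSolver.solve-∀
      κ-big : 2 ℕ.* K ℕ.* 4 ℕ.^ (K ℕ.* K) ℕ.≤ κ X
      κ-big = ℕₚ.*-cancelˡ-≤ 2 (ℕₚ.≤-trans (ℕₚ.≤-reflexive (trans (cong (λ y → 2 ℕ.* (2 ℕ.* K ℕ.* y)) (ℕₚ.^-*-assoc 2 2 (K ℕ.* K))) (l′ K (2 ℕ.^ (2 ℕ.* (K ℕ.* K))))))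
        (ℕₚ.≤-trans (2^-*≤ 2 (K ℕ.+ 2 ℕ.* (K ℕ.* K)) ℕₚ.≤-refl (2^-*≤ K (2 ℕ.* (K ℕ.* K)) (ℕₚ.≤-trans (ℕₚ.n≤1+n K) (suc≤2^ K)) ℕₚ.≤-refl))
        (ℕₚ.≤-trans (ℕₚ.^-monoʳ-≤ 2 (ℕₚ.≤-pred exponents)) (cube-growth X (1≤seq (suc (suc i))) r cubes))))
        where
        l′ : ∀ K y → 2 ℕ.* (2 ℕ.* K ℕ.* y) ≡ 4 ℕ.* (K ℕ.* y)
        l′ = ℕSolver.solve-∀

    -- It provides the 2p ≤ n of `step-regular`, which keeps every part at least n/(2p) large.
    level-double : 2 ℕ.* t ℕ.≤ seq (suc (suc (suc i)))
    level-double = ℕₚ.≤-trans (ℕₚ.≤-trans (ℕₚ.≤-reflexive (ℕₚ.*-comm 2 t)) (ℕₚ.*-monoʳ-≤ t (ℕₚ.≤-trans (ℕₚ.≤ᵇ⇒≤ 2 4 _) (ℕₚ.*-monoʳ-≤ 4 (1≤seq i)))))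
      (ℕₚ.≤-trans (4sq≤seq i) (seq-mono (ℕₚ.≤-trans (ℕₚ.n≤1+n (suc i)) (ℕₚ.n≤1+n (suc (suc i))))))

floor≤ : ∀ q → ℚ.floor q ℤ.* ℚ.↧ q ℤ.≤ ℚ.↥ q
floor≤ q@record{} = ℤDM.[n/d]*d≤n (ℚ.↥ q) (ℚ.↧ q)

≤ceiling : ∀ p → ℚ.↥ p ℤ.≤ ceiling p ℤ.* ℚ.↧ p
≤ceiling p@record{} = ℤₚ.≤-trans (ℤₚ.≤-reflexive (≡-sym (trans (cong ℤ.-_ (ℚₚ.↥-neg p)) (ℤₚ.neg-involutive (ℚ.↥ p)))))
  (ℤₚ.≤-trans (ℤₚ.neg-mono-≤ (floor≤ (- p))) (ℤₚ.≤-reflexive (trans (ℤₚ.neg-distribˡ-* (ℚ.floor (- p)) (ℚ.↧ (- p)))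
    (cong (ceiling p ℤ.*_) (ℚₚ.↧-neg p)))))

≤∣ceiling∣ : ∀ p → p ≤ toℚ ℤ.∣ ceiling p ∣
≤∣ceiling∣ p = ≤-trans (ℚ.*≤* {q = mkℚ (+ ℤ.∣ ceiling p ∣) 0 (Coprimality.sym (Coprimality.1-coprimeTo ℤ.∣ ceiling p ∣))}
  (ℤₚ.≤-trans (ℤₚ.≤-reflexive (ℤₚ.*-identityʳ (ℚ.↥ p))) (ℤₚ.≤-trans (≤ceiling p) (ℤₚ.*-monoʳ-≤-nonNeg (ℚ.↧ p) (i≤∣i∣ (ceiling p))))))
  (≤-reflexive (≡-sym (toℚ-mk ℤ.∣ ceiling p ∣)))
  where
  i≤∣i∣ : ∀ i → i ℤ.≤ + ℤ.∣ i ∣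
  i≤∣i∣ (+ n) = ℤₚ.≤-refl
  i≤∣i∣ (-[1+ n ]) = ℤ.-≤+

-- The iteration along the sequence and the degenerate cases

module Main (k : ℚ → ℕ) (fk : FKBound k) (ε : ℚ) (0<ε : 0ℚ < ε) (s : ℕ) (1≤s : 1 ℕ.≤ s)
  (g : ℕ → ℚ) (g-rng : ∀ t → 0ℚ < g t × g t < 1ℚ) (n : ℕ) (G : Graph n) where

  open Growth k fk ε 0<ε s 1≤s g g-rng

  J : ℕ
  J = jIdx ε ℕ.∸ 1

  -- All cases keep the number of parts within T₀, which is `seq J`; `within-Tbound` passes from
  -- there to T.
  Goal : Set
  Goal = ∃ λ (G′ : Graph n) → ι (editDist G G′) ≤ ε * (ι n * ι n) ×
    ∃ λ (m : ℕ) → s ℕ.≤ m × m ℕ.≤ seq J × ∃ λ (P : Fin n → Fin m) → GRegularPartition G′ g P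

  s≤seq : ∀ i → s ℕ.≤ seq i
  s≤seq i = ℕₚ.≤-trans (ℕₚ.≤-reflexive (≡-sym seq-zero)) (seq-mono {0} {i} ℕ.z≤n)

  32dl≤1 : ∀ i → 32ℚ * dl (seq i) ≤ 1ℚ
  32dl≤1 i = ≤-trans (by (0≤* (0≤* (<⇒≤ (ℚₚ.positive⁻¹ 32ℚ)) (<⇒≤ (0<dl (seq i) (1≤seq i)))) (≤⇒0≤ (≤-mul 0≤1 (1≤ι (1≤seq i)) 0≤1 (1≤ι (1≤seq i)))))
      (l 32ℚ (ι (seq i)) (dl (seq i)))) (<⇒≤ (dl<1 (seq i) (1≤seq i)))
    where
    l : ∀ c t d → c * d * (t * t - 1ℚ * 1ℚ) ≡ c * (t * t) * d - c * d
    l = solve-∀ ring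

  dl≤1 : ∀ i → dl (seq i) ≤ 1ℚ
  dl≤1 i = ≤-trans (by (0≤* (<⇒≤ (ℚₚ.positive⁻¹ (32ℚ - 1ℚ))) (<⇒≤ (0<dl (seq i) (1≤seq i)))) (l 32ℚ (dl (seq i)))) (32dl≤1 i)
    where
    l : ∀ c d → (c - 1ℚ) * d ≡ c * d - d
    l = solve-∀ ring

  within-Tbound : ∀ m → m ℕ.≤ seq J → toℚ m ≤ Tbound k g ε s
  within-Tbound m m≤ = ≤-trans (≤-reflexive (≡-sym (ι-def m))) (≤-trans (≤-trans (ι-mono m≤)
      (≤-trans (≤-reflexive (l (ι T))) (≤-mul (0≤* 0≤1 (0≤ι T)) (≤-mul 0≤1 (1≤ι {16} (ℕ.s≤s ℕ.z≤n)) (0≤ι T) ≤-refl) 0≤1 1≤inv)))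
    (≤-reflexive (cong₂ _*_ (cong₂ _*_ (ι-def 16) (trans (ι-def T) (cong toℚ (seq-def J)))) (cong (λ z → inv (z * z)) (trans (dl-def T) (cong (δ g ε) (seq-def J)))))))
    where
    T = seq J
    D = dl T
    0<DD : 0ℚ < D * D
    0<DD = 0<* (0<dl T (1≤seq J)) (0<dl T (1≤seq J))
    0≤D : 0ℚ ≤ D
    0≤D = <⇒≤ (0<dl T (1≤seq J))
    1≤inv : 1ℚ ≤ inv (D * D)
    1≤inv = ≤-trans (≤-reflexive (≡-sym (inv-pos 0<DD))) (≤-trans (≤-mul (0≤² D) (≤-mul 0≤D (dl≤1 J) 0≤D (dl≤1 J)) (0≤inv (<⇒≤ 0<DD)) ≤-refl)
      (≤-reflexive (trans (cong (_* inv (D * D)) (ℚₚ.*-identityˡ 1ℚ)) (ℚₚ.*-identityˡ (inv (D * D))))))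
    l : ∀ t → t ≡ 1ℚ * t * 1ℚ
    l = solve-∀ ring

  conclude : Goal → ∃ λ (G′ : Graph n) → toℚ (editDist G G′) ≤ ε * toℚ (n ℕ.* n) ×
    ∃ λ (m : ℕ) → s ℕ.≤ m × toℚ m ≤ Tbound k g ε s × ∃ λ (P : Fin n → Fin m) → GRegularPartition G′ g P
  conclude (G′ , close , m , s≤m , m≤T , rest) = G′
    , ≤-trans (≤-reflexive (≡-sym (ι-def (editDist G G′)))) (≤-trans close (≤-reflexive (cong (ε *_) (trans (≡-sym (ι-* n n)) (ι-def (n ℕ.* n))))))
    , m , s≤m , within-Tbound m m≤T , rest

  0≤γ : ∀ m → 0ℚ ≤ g m
  0≤γ m = <⇒≤ (proj₁ (g-rng m))

  ∣x-x∣≤ : ∀ {x y} m → x ≡ y → ∣ x - y ∣ ≤ g m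
  ∣x-x∣≤ {x} m refl = ≤-trans (≤-reflexive (cong ∣_∣ (ℚₚ.+-inverseʳ x))) (0≤γ m)

  e-cong : ∀ (H : Graph n) {A A′ B B′ : VSet n} → (∀ v → A v ≡ A′ v) → (∀ v → B v ≡ B′ v) → e H A B ≡ e H A′ B′
  e-cong H {A} {A′} {B} {B′} hA hB = ι-injective (trans (e-Σ H A B) (trans (ΣΣ-cong n (λ u v → cong₂ (λ a b → 𝟙 a * 𝟙 b * χ H u v) (hA u) (hB v))) (≡-sym (e-Σ H A′ B′))))

  d-cong : ∀ (H : Graph n) {A A′ B B′ : VSet n} → (∀ v → A v ≡ A′ v) → (∀ v → B v ≡ B′ v) → d H A B ≡ d H A′ B′
  d-cong H hA hB = cong₂ (λ x y → toℚ x * inv (toℚ y)) (e-cong H hA hB) (cong₂ ℕ._*_ (size-cong hA) (size-cong hB))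

  empty : Graph n
  adj empty u v = false
  sym empty u v = refl
  irrefl empty u = refl

  large-ε : ½ ≤ ε → Goal
  large-ε ½≤ε = empty , close , s , ℕₚ.≤-refl , s≤seq J , proj₁ P , proj₂ P ,
      λ i j _ A B _ _ _ _ → ∣x-x∣≤ s (trans (density A B) (≡-sym (density (part (proj₁ P) i) (part (proj₁ P) j))))
    where
    P = equitable-exists n s 1≤s
    density : ∀ A B → d empty A B ≡ 0ℚ
    density A B = trans (cong (_* inv (toℚ (size A ℕ.* size B))) (trans (≡-sym (ι-def (e empty A B))) (trans (e-Σ empty A B)
      (trans (ΣΣ-cong n (λ u v → ℚₚ.*-zeroʳ (𝟙 (A u) * 𝟙 (B v)))) (trans (ΣΣ-const n 0ℚ) (ℚₚ.*-zeroˡ (ι n * ι n))))))) (ℚₚ.*-zeroˡ (inv (toℚ (size A ℕ.* size B))))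
    close : ι (editDist G empty) ≤ ε * (ι n * ι n)
    close = ≤-trans (≤-reflexive (editDist-Σ G empty)) (≤-trans (ΣΣ-mono n (λ u v → entry (lt u v) (adj G u v xor false)))
      (≤-cancelˡ 2ℚ (ℚₚ.positive⁻¹ 2ℚ) (≤-trans (half-sum n (λ _ _ → 1ℚ) (λ _ _ → refl) (λ _ _ → 0≤1)) (≤-trans (≤-reflexive (ΣΣ-const n 1ℚ))
        (by (0≤* 0≤2 (0≤* (≤⇒0≤ ½≤ε) (0≤² (ι n)))) (l ε (ι n * ι n)))))))
      where
      entry : ∀ a b → 𝟙 (a ∧ b) ≤ 𝟙 a * 1ℚ
      entry true b = 𝟙≤1 b
      entry false b = ≤-refl
      l : ∀ e m → 2ℚ * ((e - ½) * m) ≡ 2ℚ * (e * m) - 1ℚ * m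
      l = solve-∀ ring

  -- Parts have at most one vertex, some possibly none. As `g` is positive, a subset large enough to
  -- be tested is the whole part, so the two densities coincide.
  small-n : n ℕ.≤ seq J → Goal
  small-n n≤T = G , close , seq J , s≤seq J , ℕₚ.≤-refl , P , equitable ,
      λ i j _ A B A⊆ B⊆ hA hB → ∣x-x∣≤ (seq J) (d-cong G (full i A A⊆ hA) (full j B B⊆ hB))
    where
    P : Fin n → Fin (seq J)
    P v = Fin.inject≤ v n≤T
    P-inj : ∀ {u v} → P u ≡ P v → u ≡ v
    P-inj {u} {v} = Finₚ.inject≤-injective n≤T n≤T u v
    close : ι (editDist G G) ≤ ε * (ι n * ι n)
    close = ≤-trans (≤-reflexive (trans (editDist-Σ G G) (trans (ΣΣ-cong n (λ u v → trans (cong (λ b → 𝟙 (lt u v ∧ b)) (Boolₚ.xor-same (adj G u v))) (cong 𝟙 (Boolₚ.∧-zeroʳ (lt u v)))))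
      (trans (ΣΣ-const n 0ℚ) (ℚₚ.*-zeroˡ (ι n * ι n)))))) (0≤* (<⇒≤ 0<ε) (0≤² (ι n)))
    size≤1 : ∀ i → size (part P i) ℕ.≤ 1
    size≤1 i = go (Finₚ.any? (λ v → P v ≟ i))
      where
      go : Dec (∃ λ v → P v ≡ i) → size (part P i) ℕ.≤ 1
      go (yes (v , refl)) = ι-cancel (≤-trans (≤-reflexive (size-ι (part P i))) (≤-trans (Σ-mono n (λ u → le u (P u ≟ P v)))
          (≤-reflexive (trans (Σ-pick n v (λ _ → 1ℚ)) (≡-sym ι-1)))))
        where
        le : ∀ u (c : Dec (P u ≡ P v)) → 𝟙 ⌊ c ⌋ ≤ 𝟙 ⌊ v ≟ u ⌋ * 1ℚ
        le u (no _) = 0≤* (0≤𝟙 ⌊ v ≟ u ⌋) 0≤1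
        le u (yes eq) = ≤-reflexive (cong (λ b → 𝟙 b * 1ℚ) (≡-sym (trans (cong (λ x → ⌊ v ≟ x ⌋) (P-inj eq)) (⌊≟⌋-refl v))))
      go (no none) = ι-cancel (≤-trans (≤-reflexive (size-ι (part P i))) (≤-trans (≤-reflexive (Σ-zero n (λ u → zero-at u (P u ≟ i)))) (0≤ι 1)))
        where
        zero-at : ∀ u (c : Dec (P u ≡ i)) → 𝟙 ⌊ c ⌋ ≡ 0ℚ
        zero-at u (no _) = refl
        zero-at u (yes eq) = ⊥-elim (none (u , eq))
    equitable : Equitable P
    equitable i j = ℕₚ.≤-trans (size≤1 i) (ℕₚ.m≤n+m 1 (size (part P j)))
    full : ∀ i A → A ⊆ part P i → g (seq J) * toℚ (size (part P i)) ≤ toℚ (size A) → ∀ v → A v ≡ part P i v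
    full i A A⊆ big v = go (A v) (part P i v) refl refl
      where
      go : ∀ a b → A v ≡ a → part P i v ≡ b → A v ≡ part P i v
      go true b ha hb = trans ha (≡-sym (A⊆ v ha))
      go false false ha hb = trans ha (≡-sym hb)
      go false true ha hb = ⊥-elim (≤⇒≯ big (ℚₚ.≤-<-trans (≤-reflexive empty-A) (0<* (proj₁ (g-rng (seq J))) 0<part)))
        where
        other : ∀ w c → A w ≡ c → c ≡ false
        other w false h = refl
        other w true h = ⊥-elim (false≢true (trans (≡-sym ha) (trans (cong A (P-inj (trans (⌊≟⌋-true hb) (≡-sym (⌊≟⌋-true (A⊆ w h)))))) h)))
          where
          false≢true : false ≡ true → ⊥
          false≢true ()
        empty-A : toℚ (size A) ≡ 0ℚ
        empty-A = trans (≡-sym (ι-def (size A))) (trans (size-ι A) (Σ-zero n (λ w → cong 𝟙 (other w (A w) refl))))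
        0<part : 0ℚ < toℚ (size (part P i))
        0<part = subst (0ℚ <_) (ι-def (size (part P i))) (ℚₚ.<-≤-trans 0<1 (≤-trans (≤-reflexive (≡-sym (cong 𝟙 hb)))
          (≤-trans (Σ-term n (λ w → 𝟙 (part P i w)) (λ w → 0≤𝟙 (part P i w)) v) (≤-reflexive (≡-sym (size-ι (part P i)))))))

  module Large (ε<½ : ε < ½) (T<n : seq J ℕ.< n) where

    N² : ℚ
    N² = ι n * ι n

    0≤N² : 0ℚ ≤ N²
    0≤N² = 0≤² (ι n)

    1≤n : 1 ℕ.≤ n
    1≤n = ℕₚ.≤-trans (1≤seq J) (ℕₚ.<⇒≤ T<n)

    vertex : Fin n
    vertex = Fin.fromℕ< 1≤n

    energy≤N² : ∀ {p} (P : Fin n → Fin p) (F : Kernel p) → energy G P F ≤ N²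
    energy≤N² P F = ≤-trans (ΣΣ-mono n (λ u v → test-²≤1 (suc (suc (suc zero))) (Kernel.rng F (P u) (P v)) (χ-unit G u v)))
      (≤-reflexive (trans (ΣΣ-const n 1ℚ) (ℚₚ.*-identityˡ N²)))

    -- `f` bounds the energy in units of ε²N², hence the number of rounds that can still end far
    -- from `F`.
    Level : ℕ → ℕ → Set
    Level f i = (P : Fin n → Fin (seq i)) → Equitable P → (F : Kernel (seq i)) → energy G P F ≤ ι f * (ε * ε * N²) → Goal

    module Step (i : ℕ) (3≤i : 3 ℕ.≤ i) (i+3≤J : suc (suc (suc i)) ℕ.≤ J)
      (P : Fin n → Fin (seq i)) (eqP : Equitable P) (F : Kernel (seq i)) where

      K : ℕ
      K = scale i

      t : ℕ
      t = seq i

      D : ℚ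
      D = dl t

      0<D : 0ℚ < D
      0<D = 0<dl t (1≤seq i)

      0≤D : 0ℚ ≤ D
      0≤D = <⇒≤ 0<D

      0<K : 0ℚ < ι K
      0<K = 0<ι (1≤scale i 3≤i)

      -- The reciprocal of a natural number, so that τ⁻² = K² is itself a number of refinement
      -- steps; `dl-scale` makes it at most δ².
      τ : ℚ
      τ = inv (ι K)

      0<τ : 0ℚ < τ
      0<τ = 0<inv 0<K

      τK : τ * ι K ≡ 1ℚ
      τK = trans (ℚₚ.*-comm τ (ι K)) (inv-pos 0<K)

      τ≤DD : τ ≤ D * D
      τ≤DD = ≤-trans (≤-reflexive (≡-sym (ℚₚ.*-identityʳ τ))) (≤-trans (≤-mulˡ τ (<⇒≤ 0<τ) (dl-scale i))
        (≤-reflexive (trans (l τ D (ι K)) (trans (cong (D * D *_) τK) (ℚₚ.*-identityʳ (D * D))))))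
        where
        l : ∀ t d k → t * (d * d * k) ≡ d * d * (t * k)
        l = solve-∀ ring

      4τ≤εε : 2ℚ * 2ℚ * τ ≤ ε * ε
      4τ≤εε = ≤-trans (≤-mulˡ (2ℚ * 2ℚ) (0≤* 0≤2 0≤2) τ≤DD) (≤-trans (≤-reflexive (l D)) (≤-mul (0≤* 0≤2 0≤D) (2dl≤ε t) (0≤* 0≤2 0≤D) (2dl≤ε t)))
        where
        l : ∀ d → 2ℚ * 2ℚ * (d * d) ≡ 2ℚ * d * (2ℚ * d)
        l = solve-∀ ring

      6τ≤ε : (2ℚ + 2ℚ + 2ℚ) * τ ≤ ε
      6τ≤ε = by (0≤+ (0≤+ (0≤* (0≤+ (0≤+ 0≤2 0≤2) 0≤2) (≤⇒0≤ τ≤DD)) (0≤* 0≤D (≤⇒0≤ (32dl≤1 i))))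
          (0≤+ (0≤+ (0≤* (<⇒≤ (ℚₚ.positive⁻¹ (32ℚ - (2ℚ + 2ℚ + 2ℚ)))) (0≤* 0≤D 0≤D)) 0≤D) (≤⇒0≤ (2dl≤ε t)))) (l τ D ε)
        where
        l : ∀ t d e → (2ℚ + 2ℚ + 2ℚ) * (d * d - t) + d * (1ℚ - 2ℚ * 2ℚ * 2ℚ * 2ℚ * 2ℚ * d)
          + ((2ℚ * 2ℚ * 2ℚ * 2ℚ * 2ℚ - (2ℚ + 2ℚ + 2ℚ)) * (d * d) + d + (e - 2ℚ * d)) ≡ e - (2ℚ + 2ℚ + 2ℚ) * t
        l = solve-∀ ring

      start : Refined P
      start = record { q = t ; Q = P ; π = λ x → x ; πQ = λ u → refl ; W = F }

      open Decrement G P F τ 0<τ using (regularize; Passes; Regularized; corr; E)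

      regularized : Regularized (K ℕ.* K) start
      regularized = regularize (K ℕ.* K) start (≤-trans (energy≤N² P F) (≤-reflexive
        (≡-sym (trans (cong (_* (τ * τ * N²)) (ι-* K K)) (trans (l (ι K) τ N²) (trans (cong (λ z → z * z * N²) τK) (l′ N²)))))))
        where
        l : ∀ k t m → k * k * (t * t * m) ≡ t * k * (t * k) * m
        l = solve-∀ ring
        l′ : ∀ m → 1ℚ * 1ℚ * m ≡ m
        l′ = solve-∀ ring

      A : Refined P
      A = proj₁ regularized

      q : ℕ
      q = Refined.q A

      passes : Passes A
      passes = proj₂ (proj₂ (proj₂ regularized))

      p′ : ℕ
      p′ = seq (suc (suc (suc i)))

      p′≤n : p′ ℕ.≤ n
      p′≤n = ℕₚ.≤-trans (seq-mono i+3≤J) (ℕₚ.<⇒≤ T<n)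

      big : (1ℚ + 2ℚ) * (1ℚ + 2ℚ) * (ι K * ι K * (ι K * ι K)) ≤ ι n
      big = ≤-trans (≤-reflexive (≡-sym (trans (ι-* 9 (K ℕ.* K ℕ.* (K ℕ.* K))) (cong₂ _*_
          (trans (ι-* 3 3) (cong₂ _*_ ι-3 ι-3)) (trans (ι-* (K ℕ.* K) (K ℕ.* K)) (cong₂ _*_ (ι-* K K) (ι-* K K)))))))
        (ι-mono (ℕₚ.≤-trans (level-big i 3≤i) p′≤n))
        where
        ι-3 : ι 3 ≡ 1ℚ + 2ℚ
        ι-3 = trans (ι-suc 2) (cong (λ y → 1ℚ + y) ι-2)

      module Ed = Edit 1≤n G P F τ 0<τ A passes (ι K) (1≤ι (1≤scale i 3≤i)) τK big ε 0<ε 6τ≤ε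

      gap : ℚ
      gap = ΣΣ n Ed.sq

      finish : gap ≤ 2ℚ * (ε * ε) * N² → Goal
      finish close = Ed.G′ , Ed.edit-bound close , t , s≤seq i , seq-mono (ℕₚ.≤-trans (ℕₚ.≤-trans (ℕₚ.n≤1+n i) (ℕₚ.≤-trans (ℕₚ.n≤1+n (suc i)) (ℕₚ.n≤1+n (suc (suc i))))) i+3≤J) ,
          P , eqP , step-regular Ed.G′ P F eqP (1≤seq i) 2t≤n (g t) ((1ℚ + 2ℚ) * τ * N²) (proj₁ (g-rng t)) (<⇒≤ (proj₂ (g-rng t))) small Ed.cut-bound
        where
        2t≤n : 2ℚ * ι t ≤ ι n
        2t≤n = ≤-trans (≤-reflexive (≡-sym (trans (ι-* 2 t) (cong (_* ι t) ι-2)))) (ι-mono (ℕₚ.≤-trans (level-double i 3≤i) p′≤n))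
        small : 2ℚ * 2ℚ * 2ℚ * (ι t * ι t) * ((1ℚ + 2ℚ) * τ * N²) ≤ g t * g t * g t * N²
        -- The chain is 24t²τ ≤ 24t²δ² ≤ 32t²δ² ≤ γ³δ ≤ γ³.
        small = by (0≤* (0≤+ (0≤+ (0≤* (<⇒≤ (ℚₚ.positive⁻¹ (2ℚ * 2ℚ * 2ℚ * (1ℚ + 2ℚ)))) (0≤* (0≤² (ι t)) (≤⇒0≤ τ≤DD)))
              (0≤* (0≤* (<⇒≤ (ℚₚ.positive⁻¹ (2ℚ * 2ℚ * 2ℚ))) (0≤² (ι t))) (0≤² D)))
              (0≤+ (0≤* 0≤D (≤⇒0≤ (dl-γ t (1≤seq i)))) (0≤* (<⇒≤ (0<γ³ t)) (≤⇒0≤ (dl≤1 i))))) 0≤N²) (l (ι t) τ N² (g t * g t * g t) D)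
          where
          l : ∀ p t m g d → (2ℚ * 2ℚ * 2ℚ * (1ℚ + 2ℚ) * (p * p * (d * d - t)) + 2ℚ * 2ℚ * 2ℚ * (p * p) * (d * d)
              + (d * (g - 2ℚ * 2ℚ * 2ℚ * 2ℚ * 2ℚ * (p * p) * d) + g * (1ℚ - d))) * m
            ≡ g * m - 2ℚ * 2ℚ * 2ℚ * (p * p) * ((1ℚ + 2ℚ) * t * m)
          l = solve-∀ ring

      -- Pythagoras up to the cross term 2Σ(χ - w)(f - w), which the last test bounds by 2τN².
      energy-drop : E A + gap ≤ energy G P F + 2ℚ * (τ * N²)
      energy-drop = by (0≤* 0≤2 (≤⇒0≤ (passes (suc (suc (suc zero))) Ed.all Ed.all))) (trans (l₂ (τ * N²) C (E A) gap)
          (cong (λ z → z + 2ℚ * (τ * N²) - (E A + gap)) (≡-sym expand)))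
        where
        C = corr A (suc (suc (suc zero))) Ed.all Ed.all
        h₁ h₂ : Fin n → Fin n → ℚ
        h₁ u v = (χ G u v - Ed.wA u v) * (χ G u v - Ed.wA u v) + Ed.sq u v
        h₂ u v = (χ G u v - Ed.wA u v) * ((Ed.f u v - Ed.wA u v) * (1ℚ * 1ℚ))
        expand : energy G P F ≡ E A + gap + - 2ℚ * C
        expand = trans (ΣΣ-cong n (λ u v → l (χ G u v) (Ed.wA u v) (Ed.f u v))) (trans (ΣΣ-+ n h₁ (λ u v → - 2ℚ * h₂ u v))
          (cong₂ _+_ (ΣΣ-+ n (λ u v → (χ G u v - Ed.wA u v) * (χ G u v - Ed.wA u v)) Ed.sq) (ΣΣ-*ˡ n (- 2ℚ) h₂)))
          where
          l : ∀ x w c → (x - c) * (x - c) ≡ (x - w) * (x - w) + (w - c) * (w - c) + - 2ℚ * ((x - w) * ((c - w) * (1ℚ * 1ℚ)))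
          l = solve-∀ ring
        l₂ : ∀ t c e s → 2ℚ * (t - c) ≡ e + s + - 2ℚ * c + 2ℚ * t - (e + s)
        l₂ = solve-∀ ring

      -- The gap takes more than 2ε²N² from the energy. The cross term and the impure vertices give
      -- back at most 2τN² each, together at most ε²N², so one unit is spent.
      next : ∀ f → Level f (suc (suc (suc i))) → energy G P F ≤ ι (suc f) * (ε * ε * N²) → 2ℚ * (ε * ε) * N² < gap → Goal
      next f level bound far = level P″ eq″ (pull (Refined.W A) x) (≤-trans (energy-pull G (Refined.Q A) (Refined.W A) P″ x) total)
        where
        pure = equitable-pure n p′ q (1≤seq (suc (suc (suc i)))) p′≤n (Refined.Q A) (Refined.Q A vertex)
        P″ = proj₁ pure
        eq″ = proj₁ (proj₂ pure)
        x = proj₁ (proj₂ (proj₂ pure))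
        b : ℕ
        b = size (impure (Refined.Q A) P″ x)
        1≤q : 1 ℕ.≤ q
        1≤q = ℕₚ.≤-trans (ℕ.s≤s ℕ.z≤n) (Finₚ.toℕ<n (Refined.Q A vertex))
        -- Combine 2Kq ≤ p′ with p′b ≤ 2qn and cancel 2q.
        Kb≤n : K ℕ.* b ℕ.≤ n
        Kb≤n = ℕₚ.*-cancelˡ-≤ (2 ℕ.* q) {{ℕ.>-nonZero (ℕₚ.*-mono-≤ {1} {2} (ℕ.s≤s ℕ.z≤n) 1≤q)}} (ℕₚ.≤-trans (ℕₚ.≤-reflexive (l q K b))
          (ℕₚ.≤-trans (ℕₚ.*-monoˡ-≤ b (ℕₚ.≤-trans (ℕₚ.*-monoʳ-≤ (2 ℕ.* K) (proj₁ (proj₂ regularized))) (level-room i 3≤i)))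
          (ℕₚ.≤-trans (proj₂ (proj₂ (proj₂ pure))) (ℕₚ.≤-reflexive (≡-sym (ℕₚ.*-assoc 2 q n))))))
          where
          l : ∀ q k b → 2 ℕ.* q ℕ.* (k ℕ.* b) ≡ 2 ℕ.* k ℕ.* q ℕ.* b
          l = ℕSolver.solve-∀
        bad≤ : ι b ≤ τ * ι n
        bad≤ = ≤-trans (≤-reflexive (trans (≡-sym (ℚₚ.*-identityˡ (ι b))) (trans (cong (_* ι b) (≡-sym τK)) (trans (ℚₚ.*-assoc τ (ι K) (ι b)) (cong (τ *_) (≡-sym (ι-* K b)))))))
          (≤-mulˡ τ (<⇒≤ 0<τ) (ι-mono Kb≤n))
        bound′ : energy G P F ≤ (1ℚ + ι f) * (ε * ε * N²)
        bound′ = ≤-trans bound (≤-reflexive (cong (_* (ε * ε * N²)) (ι-suc f)))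
        total : E A + 2ℚ * ι n * ι b ≤ ι f * (ε * ε * N²)
        total = by (0≤+ (0≤+ (≤⇒0≤ energy-drop) (≤⇒0≤ (<⇒≤ far))) (0≤+ (0≤+ (0≤* 0≤N² (≤⇒0≤ 4τ≤εε)) (≤⇒0≤ bound′)) (0≤* (0≤* 0≤2 (0≤ι n)) (≤⇒0≤ bad≤))))
          (l (E A) gap (energy G P F) τ (ε * ε) (ι n) (ι b) (ι f))
          where
          l : ∀ a s e t ee n b f → e + 2ℚ * (t * (n * n)) - (a + s) + (s - 2ℚ * ee * (n * n)) +
            (n * n * (ee - 2ℚ * 2ℚ * t) + ((1ℚ + f) * (ee * (n * n)) - e) + 2ℚ * n * (t * n - b)) ≡ f * (ee * (n * n)) - (a + 2ℚ * n * b)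
          l = solve-∀ ring

      -- With no energy left, `energy-drop` leaves a gap of at most 2τN².
      exhausted : energy G P F ≤ ι 0 * (ε * ε * N²) → 2ℚ * (ε * ε) * N² < gap → ⊥
      exhausted bound far = ≤⇒≯ small far
        where
        bound′ : energy G P F ≤ 0ℚ
        bound′ = ≤-trans bound (≤-reflexive (trans (cong (_* (ε * ε * N²)) ι-0) (ℚₚ.*-zeroˡ (ε * ε * N²))))
        small : gap ≤ 2ℚ * (ε * ε) * N²
        small = by (0≤+ (0≤+ (≤⇒0≤ energy-drop) (0≤energy G (Refined.Q A) (Refined.W A))) (0≤+ (≤⇒0≤ bound′)
            (0≤+ (0≤* (0≤* 0≤2 0≤N²) (≤⇒0≤ 4τ≤εε)) (0≤* (0≤* (0≤+ 0≤2 (0≤+ 0≤2 0≤2)) 0≤N²) (<⇒≤ 0<τ)))))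
          (l (E A) gap (energy G P F) τ (ε * ε) N²)
          where
          l : ∀ a s e t ee m → e + 2ℚ * (t * m) - (a + s) + a + (0ℚ - e + (2ℚ * m * (ee - 2ℚ * 2ℚ * t) + (2ℚ + (2ℚ + 2ℚ)) * m * t)) ≡ 2ℚ * ee * m - s
          l = solve-∀ ring

    level : ∀ f i → 3 ℕ.≤ i → suc (suc (suc i)) ℕ.+ f ℕ.* 3 ℕ.≤ J → Level f i
    level f i 3≤i room P eqP F bound = decide f room bound (S.gap ℚₚ.≤? 2ℚ * (ε * ε) * N²)
      where
      module S = Step i 3≤i (ℕₚ.≤-trans (ℕₚ.m≤m+n (suc (suc (suc i))) (f ℕ.* 3)) room) P eqP F
      decide : ∀ f′ → suc (suc (suc i)) ℕ.+ f′ ℕ.* 3 ℕ.≤ J → energy G P F ≤ ι f′ * (ε * ε * N²) → Dec (S.gap ≤ 2ℚ * (ε * ε) * N²) → Goal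
      decide f′ _ _ (yes close) = S.finish close
      decide zero _ bound′ (no far) = ⊥-elim (S.exhausted bound′ (ℚₚ.≰⇒> far))
      decide (suc f′) room′ bound′ (no far) = S.next f′ (level f′ (suc (suc (suc i))) (ℕₚ.≤-trans 3≤i (ℕₚ.≤-trans (ℕₚ.n≤1+n i) (ℕₚ.≤-trans (ℕₚ.n≤1+n (suc i)) (ℕₚ.n≤1+n (suc (suc i))))))
        (ℕₚ.≤-trans (ℕₚ.≤-reflexive (l i (f′ ℕ.* 3))) room′)) bound′ (ℚₚ.≰⇒> far)
        where
        l : ∀ i x → 6 ℕ.+ i ℕ.+ x ≡ 3 ℕ.+ i ℕ.+ (3 ℕ.+ x)
        l = ℕSolver.solve-∀

    εε : ℚ
    εε = ε * ε

    0<εε : 0ℚ < εε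
    0<εε = 0<* 0<ε 0<ε

    j : ℕ
    j = jIdx ε

    4≤jεε : 2ℚ * 2ℚ ≤ ι j * εε
    4≤jεε = ≤-trans (≤-reflexive (≡-sym (trans (ℚₚ.*-assoc (toℚ 4) (inv εε) εε) (trans (cong (toℚ 4 *_) (trans (ℚₚ.*-comm (inv εε) εε) (inv-pos 0<εε))) (ℚₚ.*-identityʳ (toℚ 4))))))
      (≤-trans (ℚₚ.*-monoʳ-≤-nonNeg εε {{ℚ.nonNegative (<⇒≤ 0<εε)}} (≤∣ceiling∣ (toℚ 4 * inv εε))) (≤-reflexive (cong (_* εε) (≡-sym (ι-def j)))))

    εε≤¼ : εε ≤ ½ * ½
    εε≤¼ = ≤-mul (<⇒≤ 0<ε) (<⇒≤ ε<½) (<⇒≤ 0<ε) (<⇒≤ ε<½)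

    16≤j : 16 ℕ.≤ j
    16≤j = ι-cancel (≤-trans (≤-reflexive (trans (ι-* 4 4) (cong₂ _*_ ι-4 ι-4))) (≤-trans (≤-mulˡ (2ℚ * 2ℚ) (0≤* 0≤2 0≤2) (≤-trans 4≤jεε (≤-mulˡ (ι j) (0≤ι j) εε≤¼)))
      (≤-reflexive (l (ι j)))))
      where
      l : ∀ j → 2ℚ * 2ℚ * (j * (½ * ½)) ≡ j
      l = solve-∀ ring

    -- R rounds suffice, as Rε² ≥ jε²/16 ≥ 1/4 covers the initial energy. They also fit below J = j
    -- - 1: from r₀ ≥ 1 it follows that 6 + 3R + 1 = 10 + 3r₀ ≤ 16r₀ ≤ j.
    r₀ R : ℕ
    r₀ = j ℕ./ 16
    R = suc r₀

    j≤16R : j ℕ.≤ 16 ℕ.* R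
    j≤16R = ℕₚ.≤-trans (ℕₚ.≤-reflexive (ℕDM.m≡m%n+[m/n]*n j 16)) (ℕₚ.≤-trans (ℕₚ.+-monoˡ-≤ (r₀ ℕ.* 16) (ℕₚ.<⇒≤ (ℕDM.m%n<n j 16)))
      (ℕₚ.≤-reflexive (ℕₚ.*-comm R 16)))

    room : 6 ℕ.+ R ℕ.* 3 ℕ.≤ J
    room = ℕₚ.≤-pred (ℕₚ.≤-trans (ℕₚ.≤-trans (ℕₚ.+-monoˡ-≤ (r₀ ℕ.* 3) (ℕₚ.≤-trans (ℕₚ.≤ᵇ⇒≤ 10 13 _) (ℕₚ.*-monoˡ-≤ 13 1≤r₀)))
        (ℕₚ.≤-trans (ℕₚ.≤-reflexive (≡-sym (ℕₚ.*-distribˡ-+ r₀ 13 3))) (ℕDM.m/n*n≤m j 16)))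
      (ℕₚ.≤-reflexive (≡-sym (ℕₚ.m+[n∸m]≡n {1} {j} (ℕₚ.≤-trans (ℕ.s≤s ℕ.z≤n) 16≤j)))))
      where
      1≤r₀ : 1 ℕ.≤ r₀
      1≤r₀ = ℕDM./-monoˡ-≤ 16 16≤j

    -- Every entry of `χ` is at distance exactly 1/2 from this constant, so the iteration starts
    -- with energy N²/4 for every graph.
    half-kernel : Kernel (seq 3)
    Kernel.val half-kernel _ _ = ½
    Kernel.symm half-kernel _ _ = refl
    Kernel.rng half-kernel _ _ = 0≤½ , ℚₚ.p≤p⊔q ½ 1ℚ

    goal : Goal
    goal = level R 3 ℕₚ.≤-refl room (proj₁ initial) (proj₂ initial) half-kernel bound
      where
      initial = equitable-exists n (seq 3) (1≤seq 3)
      quarter : ∀ b → (𝟙 b - ½) * (𝟙 b - ½) ≡ ½ * ½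
      quarter true = refl
      quarter false = refl
      bound : energy G (proj₁ initial) half-kernel ≤ ι R * (ε * ε * N²)
      bound = ≤-trans (≤-reflexive (trans (ΣΣ-cong n (λ u v → quarter (adj G u v))) (ΣΣ-const n (½ * ½))))
        (by (0≤* (0≤* (0≤* 0≤½ (0≤* 0≤½ (0≤* 0≤½ 0≤½))) 0≤N²) (0≤+ (≤⇒0≤ 4≤jεε) (0≤* (<⇒≤ 0<εε) (≤⇒0≤ jR)))) (l N² (ι j) εε (ι R)))
        where
        jR : ι j ≤ 2ℚ * 2ℚ * (2ℚ * 2ℚ) * ι R
        jR = ≤-trans (ι-mono j≤16R) (≤-reflexive (trans (ι-* 16 R) (cong (_* ι R) (trans (ι-* 4 4) (cong₂ _*_ ι-4 ι-4)))))
        l : ∀ m j e r → ½ * (½ * (½ * ½)) * m * (j * e - 2ℚ * 2ℚ + e * (2ℚ * 2ℚ * (2ℚ * 2ℚ) * r - j)) ≡ r * (e * m) - ½ * ½ * m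
        l = solve-∀ ring

  main : Goal
  main = by-ε (½ ℚₚ.≤? ε)
    where
    by-n : ε < ½ → Dec (n ℕ.≤ seq J) → Goal
    by-n ε<½ (yes n≤T) = small-n n≤T
    by-n ε<½ (no n≰T) = Large.goal ε<½ (ℕₚ.≰⇒> n≰T)
    by-ε : Dec (½ ≤ ε) → Goal
    by-ε (yes ½≤ε) = large-ε ½≤ε
    by-ε (no ½≰ε) = by-n (ℚₚ.≰⇒> ½≰ε) (n ℕ.≤? seq J)

theorem1p12 : (k : ℚ → ℕ) → FKBound k →
    (ε : ℚ) → 0ℚ ℚ.< ε →
    (s : ℕ) → 1 ℕ.≤ s →
    (g : ℕ → ℚ) → (∀ t → 0ℚ ℚ.< g t × g t ℚ.< 1ℚ) → (∀ t u → t ℕ.≤ u → g u ℚ.≤ g t) →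
    (n : ℕ) (G : Graph n) →
    ∃ λ (G′ : Graph n) → toℚ (editDist G G′) ℚ.≤ ε ℚ.* toℚ (n ℕ.* n) ×
    ∃ λ (m : ℕ) → s ℕ.≤ m × toℚ m ℚ.≤ Tbound k g ε s ×
    ∃ λ (P : Fin n → Fin m) → GRegularPartition G′ g P
theorem1p12 k fk ε 0<ε s 1≤s g g-rng _ n G = Main.conclude k fk ε 0<ε s 1≤s g g-rng n G (Main.main k fk ε 0<ε s 1≤s g g-rng n G)
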